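{- For positive integers $L,M,N$ with at least one of them even, let $\mathrm{maxtw}(L,M,N)=\max\{\mathrm{Tw}(t): t \text{ a tiling of } [0,L]\times[0,M]\times[0,N]\}$. If $L,M,N\ge 2$, at least two of $L,M,N$ are strictly larger than $2$, and at least one of them is even, then $$C_0\,LMN\min(L,M,N)\le \mathrm{maxtw}(L,M,N)\le C_1\,LMN\min(L,M,N)$$ with $C_0=1/162$ and $C_1=1/16$. Moreover (limits taken over triples with at least one even entry), $$\limsup_{L,M,N\to\infty}\frac{\mathrm{maxtw}(L,M,N)}{LMN\min(L,M,N)}=\frac1{16},\qquad \liminf_{L,M,N\to\infty}\frac{\mathrm{maxtw}(L,M,N)}{LMN\min(L,M,N)}\le\frac1{24}.$$
   Context: A basic cube is $[x,x+1]\times[y,y+1]\times[z,z+1]$, $(x,y,z)\in\mathbb{Z}^3$; white if $x+y+z$ even, black if odd. A domino is the union of two basic cubes sharing a face; a tiling of a region (finite union of basic cubes) is a covering by dominoes with pairwise disjoint interiors. Let $\Phi=\{\pm e_x,\pm e_y,\pm e_z\}$. For a domino $d$, $v(d)\in\Phi$ is the center of its black cube minus the center of its white cube. For $X\subset\mathbb{R}^3$, $u\in\Phi$, $S^u(X)$ is the interior of $(X+[0,\infty)u)\setminus X$. For dominoes $d_0,d_1$: $\tau^u(d_0,d_1)=\tfrac14\det(v(d_1),v(d_0),u)$ if $d_1\cap S^u(d_0)\ne\emptyset$ and $0$ otherwise. For a tiling $t$, $T^u(t)=\sum_{d_0,d_1\in t}\tau^u(d_0,d_1)$ (ordered pairs).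 For a tiling $t$ of a box, $T^{e_x}(t)=T^{e_y}(t)=T^{e_z}(t)$ and this common value is the twist $\mathrm{Tw}(t)$. -}

module Defs where

open import Data.Bool using (Bool; true; false; _∧_; _∨_; not; if_then_else_)
open import Data.Nat as ℕ using (ℕ; _⊓_)
open import Data.Integer as ℤ using (ℤ; +_)
import Data.Integer.Properties as ℤP
open import Data.Integer.Divisibility using () renaming (_∣_ to _∣ℤ_)
open import Data.Rational as ℚ using (ℚ; 0ℚ)
open import Data.List using (List; foldr; map; length; lookup)
open import Data.Fin using (Fin)
open import Data.Product using (Σ; _×_; _,_)
open import Data.Sum using (_⊎_)
open import Data.List.Relation.Unary.All using (All)
open import Relation.Binary.PropositionalEquality using (_≡_)
open import Relation.Nullary.Decidable using (⌊_⌋)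

-- Points of ℤ³.  A basic cube [x,x+1]×[y,y+1]×[z,z+1] is identified
-- with its corner (x,y,z); vectors of ℤ³ use the same record.

record Cube : Set where
  constructor cube
  field
    cx cy cz : ℤ
open Cube public

_+³_ : Cube → Cube → Cube
cube a b c +³ cube a' b' c' = cube (a ℤ.+ a') (b ℤ.+ b') (c ℤ.+ c')

_-³_ : Cube → Cube → Cube
cube a b c -³ cube a' b' c' = cube (a ℤ.- a') (b ℤ.- b') (c ℤ.- c')

_•³_ : ℤ → Cube → Cube
k •³ cube a b c = cube (k ℤ.* a) (k ℤ.* b) (k ℤ.* c)

dot³ : Cube → Cube → ℤ
dot³ (cube a b c) (cube a' b' c') = a ℤ.* a' ℤ.+ b ℤ.* b' ℤ.+ c ℤ.* c'

det³ : Cube → Cube → Cube → ℤ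
det³ (cube a1 a2 a3) (cube b1 b2 b3) (cube c1 c2 c3) =
  a1 ℤ.* (b2 ℤ.* c3 ℤ.- b3 ℤ.* c2)
  ℤ.- b1 ℤ.* (a2 ℤ.* c3 ℤ.- a3 ℤ.* c2)
  ℤ.+ c1 ℤ.* (a2 ℤ.* b3 ℤ.- a3 ℤ.* b2)

_==³_ : Cube → Cube → Bool
cube a b c ==³ cube a' b' c' =
  ⌊ a ℤP.≟ a' ⌋ ∧ ⌊ b ℤP.≟ b' ⌋ ∧ ⌊ c ℤP.≟ c' ⌋

IsWhite : Cube → Set
IsWhite (cube a b c) = (+ 2) ∣ℤ (a ℤ.+ b ℤ.+ c)

data Dir : Set where
  +x -x +y -y +z -z : Dir

vec : Dir → Cube
vec +x = cube (+ 1) (+ 0) (+ 0)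
vec -x = cube (ℤ.- (+ 1)) (+ 0) (+ 0)
vec +y = cube (+ 0) (+ 1) (+ 0)
vec -y = cube (+ 0) (ℤ.- (+ 1)) (+ 0)
vec +z = cube (+ 0) (+ 0) (+ 1)
vec -z = cube (+ 0) (+ 0) (ℤ.- (+ 1))

-- A domino is given by its white cube and v(d) ∈ Φ; its black cube is
-- white + v(d).  (Validity: the white cube really is white.)

record Domino : Set where
  constructor domino
  field
    white : Cube
    dir   : Dir
open Domino public

black : Domino → Cube
black d = white d +³ vec (dir d)

v : Domino → Cube
v d = vec (dir d)

_∈ᵈ_ : Cube → Domino → Set
c ∈ᵈ d = (c ≡ white d) ⊎ (c ≡ black d)

_∈ᵈᵇ_ : Cube → Domino → Bool
c ∈ᵈᵇ d = (c ==³ white d) ∨ (c ==³ black d)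

InBox : ℕ → ℕ → ℕ → Cube → Set
InBox L M N (cube a b c) =
  ((+ 0) ℤ.≤ a × a ℤ.< (+ L)) ×
  ((+ 0) ℤ.≤ b × b ℤ.< (+ M)) ×
  ((+ 0) ℤ.≤ c × c ℤ.< (+ N))

IsTiling : ℕ → ℕ → ℕ → List Domino → Set
IsTiling L M N t =
  All (λ d → IsWhite (white d) × InBox L M N (white d) × InBox L M N (black d)) t
  × (∀ c → InBox L M N c →
       Σ (Fin (length t)) λ i → (c ∈ᵈ lookup t i)
         × (∀ j → c ∈ᵈ lookup t j → j ≡ i))

-- Shadows and the twist.
-- d₀ + [0,∞)u is the union of the basic cubes c₀ + k u (k ≥ 0, c₀ a cube
-- of d₀); the (closed) domino d₁ meets the open set S^u(d₀) iff one of
-- its basic cubes is such a c₀ + k u with k ≥ 1 and is not a cube of d₀.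

inRay : Dir → Cube → Cube → Bool
inRay u c₀ c =
  let δ = c -³ c₀ ; k = dot³ δ (vec u)
  in (δ ==³ (k •³ vec u)) ∧ ⌊ (+ 1) ℤP.≤? k ⌋

inShadow : Dir → Domino → Cube → Bool
inShadow u d₀ c =
  (inRay u (white d₀) c ∨ inRay u (black d₀) c) ∧ not (c ∈ᵈᵇ d₀)

meetsShadow : Dir → Domino → Domino → Bool
meetsShadow u d₀ d₁ = inShadow u d₀ (white d₁) ∨ inShadow u d₀ (black d₁)

τ : Dir → Domino → Domino → ℚ
τ u d₀ d₁ =
  if meetsShadow u d₀ d₁
  then det³ (v d₁) (v d₀) (vec u) ℚ./ 4
  else 0ℚ

sumℚ : List ℚ → ℚ
sumℚ = foldr ℚ._+_ 0ℚ

T : Dir → List Domino → ℚ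
T u t = sumℚ (map (λ d₀ → sumℚ (map (λ d₁ → τ u d₀ d₁) t)) t)

-- twist of a tiling of a box: the common value T^{e_x} = T^{e_y} = T^{e_z}
Tw : List Domino → ℚ
Tw t = T +x t

IsMaxTw : ℕ → ℕ → ℕ → ℚ → Set
IsMaxTw L M N m =
  (Σ (List Domino) λ t → IsTiling L M N t × Tw t ≡ m)
  × (∀ t → IsTiling L M N t → Tw t ℚ.≤ m)

toℚ : ℕ → ℚ
toℚ n = (+ n) ℚ./ 1

LMNmin : ℕ → ℕ → ℕ → ℕ
LMNmin L M N = L ℕ.* M ℕ.* N ℕ.* (L ⊓ M ⊓ N)

OneEven : ℕ → ℕ → ℕ → Set
OneEven L M N = (2 ∣ℕ L) ⊎ (2 ∣ℕ M) ⊎ (2 ∣ℕ N)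
  where open import Data.Nat.Divisibility using () renaming (_∣_ to _∣ℕ_)

TwoBig : ℕ → ℕ → ℕ → Set
TwoBig L M N = (2 ℕ.< L × 2 ℕ.< M) ⊎ (2 ℕ.< L × 2 ℕ.< N) ⊎ (2 ℕ.< M × 2 ℕ.< N)

Admissible : ℕ → ℕ → ℕ → Set
Admissible L M N = (1 ℕ.≤ L × 1 ℕ.≤ M × 1 ℕ.≤ N) × OneEven L M N

{-# OPTIONS --safe #-}

-- Let w be the field that assigns to each cube the vector from white to black of its domino.  On a
-- line in direction u, the contribution to 4 T^u is twice the area swept by the walk whose steps are
-- the values of w, projected along u.  In each direction a the component w_a is K_a d_a, where K_a is
-- antisymmetrised summation along a and d_a the a-part of the divergence of the flow of the dominoes
-- from white to black.  The operators K commute, they are antisymmetric, and d_x + d_y + d_z is the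
-- colouring.  Eliminating d_z from T^x gives T^z, an odd antisymmetric form in d_y, which vanishes, and
-- a colouring term, which vanishes because every domino is neutral.
--
-- Upper bounds: the walk on a line with a cells in direction y and b in direction z sweeps at most
-- a b ≤ (length / 2)², and the direction u may be chosen along the shortest side.  In a cube the three
-- directions are averaged; since a cell matters in only two of them, this gives 1/24.
--
-- Lower bounds: the twist is additive when two boxes are put together, since it may be computed along
-- a direction parallel to the cut, and it changes sign under reflections.  A solid torus of p × q
-- planar rings, with stacks of m × r rings around both of its long sides, has twist p q r m up to terms
-- that do not depend on the orientation of the stacks.

module Submission where

open import Defs

-- `Tw` is by definition the twist along x alone, so equality of the three directional twists has to
-- be proved: the bound by the shortest side, the average over a cube and the gluing of boxes along
-- any axis all rest on it. Shadows pair dominoes while swept areas pair cells; the two counts agree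
-- because a nonzero determinant needs perpendicular dominoes. After that everything is an integer,
-- `Qx` = 4 `Tw`, attached to a map from cells to directions. The twist of the ring construction is
-- never computed exactly. The lines whose area depends on the orientation of the stacks are those
-- through the long sides of the torus, and reversing the stacks negates their contribution; so one
-- of the two tilings, reflected if necessary, has twist at least p q r m. For cubes the choice r =
-- L / 6 gives about 1/81. The weaker 1/162 comes from small boxes: it is an equality in the
-- estimate for 3 × 6 × 6. The value 1/16 is approached when m is much larger than p, p much larger
-- than r, and q is half of the height.

-- Finite sums, swept area and antisymmetrised summation on a line.

module Sums where

  open import Data.Nat as ℕ using (ℕ; zero; suc)
  import Data.Nat.Properties as ℕP
  open import Data.Integer using (ℤ; -_; _+_; _*_; _-_; _≤_; 0ℤ; 1ℤ) renaming (+_ to pos)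
  open import Data.Integer.Properties
  open import Data.Integer.Tactic.RingSolver using (solve-∀)
  open import Data.Sum using (inj₁; inj₂)
  open import Relation.Binary.PropositionalEquality
  open ≡-Reasoning

  Σ< : ℕ → (ℕ → ℤ) → ℤ
  Σ< zero    f = 0ℤ
  Σ< (suc n) f = Σ< n f + f n

  Σ-cong : ∀ n {f g} → (∀ i → i ℕ.< n → f i ≡ g i) → Σ< n f ≡ Σ< n g
  Σ-cong zero    e = refl
  Σ-cong (suc n) e = cong₂ _+_ (Σ-cong n λ i l → e i (ℕP.m<n⇒m<1+n l)) (e n ℕP.≤-refl)

  Σ-cong′ : ∀ n {f g} → (∀ i → f i ≡ g i) → Σ< n f ≡ Σ< n g
  Σ-cong′ n e = Σ-cong n λ i _ → e i

  Σ-zero : ∀ n → Σ< n (λ _ → 0ℤ) ≡ 0ℤ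
  Σ-zero zero = refl
  Σ-zero (suc n) rewrite Σ-zero n = refl

  Σ-zero′ : ∀ n {f} → (∀ i → i ℕ.< n → f i ≡ 0ℤ) → Σ< n f ≡ 0ℤ
  Σ-zero′ n e = trans (Σ-cong n e) (Σ-zero n)

  Σ-const : ∀ n c → Σ< n (λ _ → c) ≡ pos n * c
  Σ-const zero c = refl
  Σ-const (suc n) c rewrite Σ-const n c = h (pos n) c
    where
    h : ∀ a c → a * c + c ≡ (1ℤ + a) * c
    h = solve-∀

  Σ-+ : ∀ n f g → Σ< n (λ i → f i + g i) ≡ Σ< n f + Σ< n g
  Σ-+ zero f g = refl
  Σ-+ (suc n) f g rewrite Σ-+ n f g = h (Σ< n f) (Σ< n g) (f n) (g n)
    where
    h : ∀ a b c d → a + b + (c + d) ≡ a + c + (b + d)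
    h = solve-∀

  Σ-*ˡ : ∀ n c f → Σ< n (λ i → c * f i) ≡ c * Σ< n f
  Σ-*ˡ zero c f = sym (*-zeroʳ c)
  Σ-*ˡ (suc n) c f rewrite Σ-*ˡ n c f = sym (*-distribˡ-+ c (Σ< n f) (f n))

  Σ-*ʳ : ∀ n c f → Σ< n (λ i → f i * c) ≡ Σ< n f * c
  Σ-*ʳ n c f = begin
    Σ< n (λ i → f i * c) ≡⟨ Σ-cong′ n (λ i → *-comm (f i) c) ⟩
    Σ< n (λ i → c * f i) ≡⟨ Σ-*ˡ n c f ⟩
    c * Σ< n f           ≡⟨ *-comm c _ ⟩
    Σ< n f * c           ∎

  Σ-neg : ∀ n f → Σ< n (λ i → - f i) ≡ - Σ< n f
  Σ-neg zero f = refl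
  Σ-neg (suc n) f rewrite Σ-neg n f = sym (neg-distrib-+ (Σ< n f) (f n))

  Σ-- : ∀ n f g → Σ< n (λ i → f i - g i) ≡ Σ< n f - Σ< n g
  Σ-- n f g = trans (Σ-+ n f (λ i → - g i)) (cong (Σ< n f +_) (Σ-neg n g))

  Σ-swap : ∀ m n (f : ℕ → ℕ → ℤ) →
    Σ< m (λ i → Σ< n (f i)) ≡ Σ< n (λ j → Σ< m (λ i → f i j))
  Σ-swap zero n f = sym (Σ-zero n)
  Σ-swap (suc m) n f rewrite Σ-swap m n f = sym (Σ-+ n (λ j → Σ< m (λ i → f i j)) (f m))

  Σ-split : ∀ m n f → Σ< (m ℕ.+ n) f ≡ Σ< m f + Σ< n (λ i → f (m ℕ.+ i))
  Σ-split m zero f rewrite ℕP.+-identityʳ m = sym (+-identityʳ _)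
  Σ-split m (suc n) f rewrite ℕP.+-suc m n | Σ-split m n f = +-assoc (Σ< m f) _ _

  Σ-mono : ∀ n {f g} → (∀ i → i ℕ.< n → f i ≤ g i) → Σ< n f ≤ Σ< n g
  Σ-mono zero e = ≤-refl
  Σ-mono (suc n) e = +-mono-≤ (Σ-mono n λ i l → e i (ℕP.m<n⇒m<1+n l)) (e n ℕP.≤-refl)

  Σ-rev : ∀ n f → Σ< n (λ i → f (n ℕ.∸ suc i)) ≡ Σ< n f
  Σ-rev zero f = refl
  Σ-rev (suc n) f = begin
    Σ< (suc n) (λ i → f (n ℕ.∸ i))                     ≡⟨ Σ-split 1 n (λ i → f (n ℕ.∸ i)) ⟩
    (0ℤ + f n) + Σ< n (λ i → f (n ℕ.∸ suc i))          ≡⟨ cong ((0ℤ + f n) +_) (Σ-rev n f) ⟩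
    (0ℤ + f n) + Σ< n f                                ≡⟨ h (f n) (Σ< n f) ⟩
    Σ< n f + f n                                       ∎
    where
    h : ∀ a b → (0ℤ + a) + b ≡ b + a
    h = solve-∀

  δ : ℕ → ℕ → ℤ
  δ zero    zero    = 1ℤ
  δ zero    (suc j) = 0ℤ
  δ (suc i) zero    = 0ℤ
  δ (suc i) (suc j) = δ i j

  δ-refl : ∀ i → δ i i ≡ 1ℤ
  δ-refl zero = refl
  δ-refl (suc i) = δ-refl i

  δ-≢ : ∀ i j → i ≢ j → δ i j ≡ 0ℤ
  δ-≢ zero zero n with () ← n refl
  δ-≢ zero (suc j) n = refl
  δ-≢ (suc i) zero n = refl
  δ-≢ (suc i) (suc j) n = δ-≢ i j λ e → n (cong suc e)

  Σ-δ-≥ : ∀ n a (f : ℕ → ℤ) → n ℕ.≤ a → Σ< n (λ i → δ i a * f i) ≡ 0ℤ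
  Σ-δ-≥ n a f l = Σ-zero′ n λ i i<n →
    trans (cong (_* f i) (δ-≢ i a (ℕP.<⇒≢ (ℕP.<-≤-trans i<n l)))) (*-zeroˡ (f i))

  Σ-δ : ∀ n a (f : ℕ → ℤ) → a ℕ.< n → Σ< n (λ i → δ i a * f i) ≡ f a
  Σ-δ (suc n) a f (ℕ.s≤s l) with ℕP.m≤n⇒m<n∨m≡n l
  ... | inj₁ a<n rewrite Σ-δ n a f a<n | δ-≢ n a (ℕP.>⇒≢ a<n) = +-identityʳ (f a)
  ... | inj₂ refl rewrite Σ-δ-≥ n n f ℕP.≤-refl | δ-refl n = h (f n)
    where
    h : ∀ a → 0ℤ + 1ℤ * a ≡ a
    h = solve-∀

  -- Twice the signed area swept by the planar walk with steps (v i , u i).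
  Area : ℕ → (ℕ → ℤ) → (ℕ → ℤ) → ℤ
  Area zero    u v = 0ℤ
  Area (suc n) u v = Area n u v + (u n * Σ< n v - v n * Σ< n u)

  Area-cong : ∀ n {u u′ v v′} → (∀ i → i ℕ.< n → u i ≡ u′ i) → (∀ i → i ℕ.< n → v i ≡ v′ i) →
    Area n u v ≡ Area n u′ v′
  Area-cong zero e f = refl
  Area-cong (suc n) {u} {u′} {v} {v′} e f = cong₂ _+_
    (Area-cong n (λ i l → e i (ℕP.m<n⇒m<1+n l)) (λ i l → f i (ℕP.m<n⇒m<1+n l)))
    (cong₂ _-_ (cong₂ _*_ (e n ℕP.≤-refl) (Σ-cong n λ i l → f i (ℕP.m<n⇒m<1+n l)))
               (cong₂ _*_ (f n ℕP.≤-refl) (Σ-cong n λ i l → e i (ℕP.m<n⇒m<1+n l))))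

  Area-antisym : ∀ n u v → Area n u v ≡ - Area n v u
  Area-antisym zero u v = refl
  Area-antisym (suc n) u v rewrite Area-antisym n u v = h (Area n v u) (u n * Σ< n v) (v n * Σ< n u)
    where
    h : ∀ a b c → - a + (b - c) ≡ - (a + (c - b))
    h = solve-∀

  Area-scale : ∀ n s t u v → Area n (λ i → s * u i) (λ i → t * v i) ≡ s * t * Area n u v
  Area-scale zero s t u v = sym (*-zeroʳ (s * t))
  Area-scale (suc n) s t u v rewrite Area-scale n s t u v | Σ-*ˡ n s u | Σ-*ˡ n t v =
    h s t (Area n u v) (u n) (v n) (Σ< n u) (Σ< n v)
    where
    h : ∀ s t a x y p q → s * t * a + (s * x * (t * q) - t * y * (s * p)) ≡ s * t * (a + (x * q - y * p))
    h = solve-∀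

  -- Cutting a walk in two leaves, besides the areas of the pieces, the triangle spanned by their
  -- chords.
  Area-split : ∀ m n u v → Area (m ℕ.+ n) u v ≡
    Area m u v + Area n (λ i → u (m ℕ.+ i)) (λ i → v (m ℕ.+ i))
      + (Σ< n (λ i → u (m ℕ.+ i)) * Σ< m v - Σ< n (λ i → v (m ℕ.+ i)) * Σ< m u)
  Area-split m zero u v rewrite ℕP.+-identityʳ m = h (Area m u v) (Σ< m v) (Σ< m u)
    where
    h : ∀ a b c → a ≡ a + 0ℤ + (0ℤ * b - 0ℤ * c)
    h = solve-∀
  Area-split m (suc n) u v rewrite ℕP.+-suc m n | Area-split m n u v | Σ-split m n u | Σ-split m n v =
    h (Area m u v) (Area n (λ i → u (m ℕ.+ i)) (λ i → v (m ℕ.+ i)))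
      (Σ< n (λ i → u (m ℕ.+ i))) (Σ< n (λ i → v (m ℕ.+ i))) (Σ< m u) (Σ< m v) (u (m ℕ.+ n)) (v (m ℕ.+ n))
    where
    h : ∀ a b p q r s x y →
      a + b + (p * s - q * r) + (x * (s + q) - y * (r + p))
      ≡ a + (b + (x * q - y * p)) + ((p + x) * s - (q + y) * r)
    h = solve-∀

  Area-zeroˡ : ∀ n u v → (∀ i → i ℕ.< n → u i ≡ 0ℤ) → Area n u v ≡ 0ℤ
  Area-zeroˡ n u v e = begin
    Area n u v                                ≡⟨ Area-cong n (λ i l → trans (e i l) (sym (*-zeroˡ 0ℤ))) (λ i _ → sym (*-identityˡ (v i))) ⟩
    Area n (λ i → 0ℤ * 0ℤ) (λ i → 1ℤ * v i)   ≡⟨ Area-scale n 0ℤ 1ℤ (λ _ → 0ℤ) v ⟩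
    0ℤ * 1ℤ * Area n (λ _ → 0ℤ) v             ≡⟨ *-zeroˡ (Area n (λ _ → 0ℤ) v) ⟩
    0ℤ                                        ∎

  Area-const : ∀ n c d → Area n (λ _ → c) (λ _ → d) ≡ 0ℤ
  Area-const zero c d = refl
  Area-const (suc n) c d rewrite Area-const n c d | Σ-const n c | Σ-const n d = h (pos n) c d
    where
    h : ∀ a c d → 0ℤ + (c * (a * d) - d * (a * c)) ≡ 0ℤ
    h = solve-∀

  -- Preceding terms minus following terms.
  K : ℕ → (ℕ → ℤ) → ℕ → ℤ
  K n f j = Σ< j f + Σ< (suc j) f - Σ< n f

  K-cong : ∀ n {f g} → (∀ i → i ℕ.< n → f i ≡ g i) → ∀ j → j ℕ.< n → K n f j ≡ K n g j
  K-cong n e j l = cong₂ _-_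
    (cong₂ _+_ (Σ-cong j λ i i<j → e i (ℕP.<-trans i<j l)) (Σ-cong (suc j) λ i i≤j → e i (ℕP.≤-trans i≤j l)))
    (Σ-cong n e)

  K-cong′ : ∀ n {f g} → (∀ i → f i ≡ g i) → ∀ j → K n f j ≡ K n g j
  K-cong′ n e j = cong₂ _-_ (cong₂ _+_ (Σ-cong′ j e) (Σ-cong′ (suc j) e)) (Σ-cong′ n e)

  K-*ˡ : ∀ n c f j → K n (λ i → c * f i) j ≡ c * K n f j
  K-*ˡ n c f j rewrite Σ-*ˡ j c f | Σ-*ˡ n c f = h c (Σ< j f) (f j) (Σ< n f)
    where
    h : ∀ c a b d → c * a + (c * a + c * b) - c * d ≡ c * (a + (a + b) - d)
    h = solve-∀

  K-- : ∀ n f g j → K n (λ i → f i - g i) j ≡ K n f j - K n g j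
  K-- n f g j rewrite Σ-- j f g | Σ-- n f g = h (Σ< j f) (Σ< j g) (f j) (g j) (Σ< n f) (Σ< n g)
    where
    h : ∀ a b c d e f → (a - b) + ((a - b) + (c - d)) - (e - f) ≡ (a + (a + c) - e) - (b + (b + d) - f)
    h = solve-∀

  K-Σ : ∀ n m (f : ℕ → ℕ → ℤ) j → K m (λ k → Σ< n (λ i → f i k)) j ≡ Σ< n (λ i → K m (f i) j)
  K-Σ n m f j = begin
    K m (λ k → Σ< n (λ i → f i k)) j
      ≡⟨ cong₂ _-_ (cong₂ _+_ (Σ-swap j n (λ k i → f i k)) (Σ-swap (suc j) n (λ k i → f i k))) (Σ-swap m n (λ k i → f i k)) ⟩
    Σ< n (λ i → Σ< j (f i)) + Σ< n (λ i → Σ< (suc j) (f i)) - Σ< n (λ i → Σ< m (f i))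
      ≡⟨ cong (_- Σ< n (λ i → Σ< m (f i))) (Σ-+ n _ _) ⟨
    Σ< n (λ i → Σ< j (f i) + Σ< (suc j) (f i)) - Σ< n (λ i → Σ< m (f i))
      ≡⟨ Σ-- n _ _ ⟨
    Σ< n (λ i → K m (f i) j) ∎

  K-comm : ∀ n m (f : ℕ → ℕ → ℤ) i j → K n (λ i → K m (f i) j) i ≡ K m (λ j → K n (λ i → f i j) i) j
  K-comm n m f i j = begin
    Σ< i g + (Σ< i g + g i) - Σ< n g
      ≡⟨ cong₂ _-_ (cong₂ _+_ (K-Σ i m f j) (cong (_+ g i) (K-Σ i m f j))) (K-Σ n m f j) ⟨
    K m a j + (K m a j + K m b j) - K m c j
      ≡⟨ h (Σ< j a) (a j) (Σ< m a) (Σ< j b) (b j) (Σ< m b) (Σ< j c) (c j) (Σ< m c) ⟩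
    (Σ< j a + (Σ< j a + Σ< j b) - Σ< j c)
      + ((Σ< j a + (Σ< j a + Σ< j b) - Σ< j c) + (a j + (a j + b j) - c j))
      - (Σ< m a + (Σ< m a + Σ< m b) - Σ< m c)
      ≡⟨ cong₂ _-_ (cong₂ _+_ (s j) (cong (_+ (a j + (a j + b j) - c j)) (s j))) (s m) ⟨
    K m (λ j → K n (λ i → f i j) i) j ∎
    where
    g a b c : ℕ → ℤ
    g i = K m (f i) j
    a k = Σ< i (λ i → f i k)
    b k = f i k
    c k = Σ< n (λ i → f i k)
    s : ∀ l → Σ< l (λ k → a k + (a k + b k) - c k) ≡ Σ< l a + (Σ< l a + Σ< l b) - Σ< l c
    s l = trans (Σ-- l _ _) (cong (_- Σ< l c) (trans (Σ-+ l _ _) (cong (Σ< l a +_) (Σ-+ l _ _))))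
    h : ∀ a a′ a″ b b′ b″ c c′ c″ →
      (a + (a + a′) - a″) + ((a + (a + a′) - a″) + (b + (b + b′) - b″)) - (c + (c + c′) - c″)
      ≡ (a + (a + b) - c) + ((a + (a + b) - c) + (a′ + (a′ + b′) - c′)) - (a″ + (a″ + b″) - c″)
    h = solve-∀

  -- A pair i < j contributes u_j v_i - u_i v_j to the area; collecting by the index of u leaves the
  -- preceding v minus the following ones. The area thus becomes a bilinear form given by an
  -- operator, to which commutation and antisymmetry apply.
  Area-K : ∀ n u v → Area n u v ≡ Σ< n (λ j → u j * K n v j)
  Area-K zero u v = refl
  Area-K (suc n) u v = begin
    Area n u v + (u n * V - v n * U)
      ≡⟨ cong (_+ (u n * V - v n * U)) (Area-K n u v) ⟩
    Σ< n (λ j → u j * K n v j) + (u n * V - v n * U)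
      ≡⟨ h (Σ< n (λ j → u j * K n v j)) (u n) (v n) U V ⟩
    (Σ< n (λ j → u j * K n v j) - U * v n) + u n * (V + (V + v n) - (V + v n))
      ≡⟨ cong (_+ u n * (V + (V + v n) - (V + v n))) (trans (cong (λ z → Σ< n (λ j → u j * K n v j) - z) (sym (Σ-*ʳ n (v n) u))) (sym (Σ-- n (λ j → u j * K n v j) (λ j → u j * v n)))) ⟩
    Σ< n (λ j → u j * K n v j - u j * v n) + u n * (V + (V + v n) - (V + v n))
      ≡⟨ cong (_+ u n * (V + (V + v n) - (V + v n))) (Σ-cong′ n λ j → h′ (u j) (Σ< j v + Σ< (suc j) v) V (v n)) ⟩
    Σ< n (λ j → u j * K (suc n) v j) + u n * K (suc n) v n ∎
    where
    U V : ℤ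
    U = Σ< n u
    V = Σ< n v
    h : ∀ s a b U V → s + (a * V - b * U) ≡ (s - U * b) + a * (V + (V + b) - (V + b))
    h = solve-∀
    h′ : ∀ a b c d → a * (b - c) - a * d ≡ a * (b - (c + d))
    h′ = solve-∀

  K-adjoint : ∀ n u v → Σ< n (λ j → u j * K n v j) ≡ - Σ< n (λ j → K n u j * v j)
  K-adjoint n u v = begin
    Σ< n (λ j → u j * K n v j)   ≡⟨ Area-K n u v ⟨
    Area n u v                   ≡⟨ Area-antisym n u v ⟩
    - Area n v u                 ≡⟨ cong -_ (Area-K n v u) ⟩
    - Σ< n (λ j → v j * K n u j) ≡⟨ cong -_ (Σ-cong′ n λ j → *-comm (v j) (K n u j)) ⟩
    - Σ< n (λ j → K n u j * v j) ∎

-- Independence of the direction for the discrete helicity of a box.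

module Helicity where

  open Sums
  open import Data.Nat as ℕ using (ℕ; zero; suc)
  open import Data.Integer using (ℤ; -[1+_]; -_; _+_; _*_; _-_; 0ℤ; 1ℤ) renaming (+_ to pos)
  open import Data.Integer.Properties
  open import Data.Integer.Tactic.RingSolver using (solve-∀)
  open import Relation.Binary.PropositionalEquality
  open ≡-Reasoning

  Field : Set
  Field = ℕ → ℕ → ℕ → ℤ

  sg : ℕ → ℤ
  sg zero    = 1ℤ
  sg (suc n) = - sg n

  x≡-x⇒x≡0 : ∀ {x} → x ≡ - x → x ≡ 0ℤ
  x≡-x⇒x≡0 {pos zero} e = refl
  x≡-x⇒x≡0 {pos (suc n)} ()
  x≡-x⇒x≡0 { -[1+ n ]} ()

  module Box (L M N : ℕ) where

    KX KY KZ : Field → Field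
    KX f x y z = K L (λ i → f i y z) x
    KY f x y z = K M (λ i → f x i z) y
    KZ f x y z = K N (λ i → f x y i) z

    infix 4 _≈_
    _≈_ : Field → Field → Set
    f ≈ g = ∀ x y z → x ℕ.< L → y ℕ.< M → z ℕ.< N → f x y z ≡ g x y z

    KX-cong : ∀ {f g} → f ≈ g → KX f ≈ KX g
    KX-cong e x y z lx ly lz = K-cong L (λ i l → e i y z l ly lz) x lx

    KZ-cong : ∀ {f g} → f ≈ g → KZ f ≈ KZ g
    KZ-cong e x y z lx ly lz = K-cong N (λ i l → e x y i lx ly l) z lz

    dot : Field → Field → ℤ
    dot f g = Σ< L λ x → Σ< M λ y → Σ< N λ z → f x y z * g x y z

    Σ³-cong : ∀ {f g : Field} → f ≈ g →
      Σ< L (λ x → Σ< M λ y → Σ< N λ z → f x y z) ≡ Σ< L (λ x → Σ< M λ y → Σ< N λ z → g x y z)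
    Σ³-cong e = Σ-cong L λ x lx → Σ-cong M λ y ly → Σ-cong N λ z lz → e x y z lx ly lz

    dot-cong : ∀ {f f′ g g′} → f ≈ f′ → g ≈ g′ → dot f g ≡ dot f′ g′
    dot-cong e e′ = Σ³-cong λ x y z lx ly lz → cong₂ _*_ (e x y z lx ly lz) (e′ x y z lx ly lz)

    dot-comm : ∀ f g → dot f g ≡ dot g f
    dot-comm f g = Σ³-cong λ x y z _ _ _ → *-comm (f x y z) (g x y z)

    dot-- : ∀ f g h → dot f (λ x y z → g x y z - h x y z) ≡ dot f g - dot f h
    dot-- f g h = begin
      dot f (λ x y z → g x y z - h x y z)
        ≡⟨ Σ³-cong (λ x y z _ _ _ → lem (f x y z) (g x y z) (h x y z)) ⟩
      Σ< L (λ x → Σ< M λ y → Σ< N λ z → f x y z * g x y z - f x y z * h x y z)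
        ≡⟨ Σ-cong′ L (λ x → trans (Σ-cong′ M λ y → Σ-- N _ _) (Σ-- M _ _)) ⟩
      Σ< L (λ x → (Σ< M λ y → Σ< N λ z → f x y z * g x y z) - (Σ< M λ y → Σ< N λ z → f x y z * h x y z))
        ≡⟨ Σ-- L _ _ ⟩
      dot f g - dot f h ∎
      where
      lem : ∀ a b c → a * (b - c) ≡ a * b - a * c
      lem = solve-∀

    Σ³-zxy : ∀ (f : Field) →
      Σ< L (λ x → Σ< M λ y → Σ< N λ z → f x y z) ≡ Σ< M (λ y → Σ< N λ z → Σ< L λ x → f x y z)
    Σ³-zxy f = trans (Σ-swap L M _) (Σ-cong′ M λ y → Σ-swap L N _)

    Σ³-xzy : ∀ (f : Field) →
      Σ< L (λ x → Σ< M λ y → Σ< N λ z → f x y z) ≡ Σ< L (λ x → Σ< N λ z → Σ< M λ y → f x y z)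
    Σ³-xzy f = Σ-cong′ L λ x → Σ-swap M N _

    adjX : ∀ f g → dot (KX f) g ≡ - dot f (KX g)
    adjX f g = begin
      dot (KX f) g
        ≡⟨ Σ³-zxy _ ⟩
      Σ< M (λ y → Σ< N λ z → Σ< L λ x → KX f x y z * g x y z)
        ≡⟨ Σ-cong′ M (λ y → trans (Σ-cong′ N λ z → lem (λ x → f x y z) (λ x → g x y z)) (Σ-neg N _)) ⟩
      Σ< M (λ y → - (Σ< N λ z → Σ< L λ x → f x y z * KX g x y z))
        ≡⟨ Σ-neg M _ ⟩
      - Σ< M (λ y → Σ< N λ z → Σ< L λ x → f x y z * KX g x y z)
        ≡⟨ cong -_ (Σ³-zxy _) ⟨
      - dot f (KX g) ∎
      where
      lem : ∀ u v → Σ< L (λ j → K L u j * v j) ≡ - Σ< L (λ j → u j * K L v j)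
      lem u v = sym (trans (cong -_ (K-adjoint L u v)) (neg-involutive _))

    adjY : ∀ f g → dot (KY f) g ≡ - dot f (KY g)
    adjY f g = begin
      dot (KY f) g
        ≡⟨ Σ³-xzy _ ⟩
      Σ< L (λ x → Σ< N λ z → Σ< M λ y → KY f x y z * g x y z)
        ≡⟨ Σ-cong′ L (λ x → trans (Σ-cong′ N λ z → lem (λ y → f x y z) (λ y → g x y z)) (Σ-neg N _)) ⟩
      Σ< L (λ x → - (Σ< N λ z → Σ< M λ y → f x y z * KY g x y z))
        ≡⟨ Σ-neg L _ ⟩
      - Σ< L (λ x → Σ< N λ z → Σ< M λ y → f x y z * KY g x y z)
        ≡⟨ cong -_ (Σ³-xzy _) ⟨
      - dot f (KY g) ∎
      where
      lem : ∀ u v → Σ< M (λ j → K M u j * v j) ≡ - Σ< M (λ j → u j * K M v j)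
      lem u v = sym (trans (cong -_ (K-adjoint M u v)) (neg-involutive _))

    adjZ : ∀ f g → dot (KZ f) g ≡ - dot f (KZ g)
    adjZ f g = begin
      dot (KZ f) g
        ≡⟨ Σ-cong′ L (λ x → trans (Σ-cong′ M λ y → lem (f x y) (g x y)) (Σ-neg M _)) ⟩
      Σ< L (λ x → - (Σ< M λ y → Σ< N λ z → f x y z * KZ g x y z))
        ≡⟨ Σ-neg L _ ⟩
      - dot f (KZ g) ∎
      where
      lem : ∀ u v → Σ< N (λ j → K N u j * v j) ≡ - Σ< N (λ j → u j * K N v j)
      lem u v = sym (trans (cong -_ (K-adjoint N u v)) (neg-involutive _))

    KX-KZ : ∀ f x y z → KX (KZ f) x y z ≡ KZ (KX f) x y z
    KX-KZ f x y z = K-comm L N (λ i j → f i y j) x z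

    KX-KY : ∀ f x y z → KX (KY f) x y z ≡ KY (KX f) x y z
    KX-KY f x y z = K-comm L M (λ i j → f i j z) x y

    KY-KZ : ∀ f x y z → KY (KZ f) x y z ≡ KZ (KY f) x y z
    KY-KZ f x y z = K-comm M N (λ i j → f x i j) y z

    -- KX ∘ KY ∘ KZ is an odd product of commuting antisymmetric operators.
    KY-KX-KZ-isotropic : ∀ d → dot (KY d) (KX (KZ d)) ≡ 0ℤ
    KY-KX-KZ-isotropic d = x≡-x⇒x≡0 (begin
      dot (KY d) (KX (KZ d))       ≡⟨ dot-comm (KY d) (KX (KZ d)) ⟩
      dot (KX (KZ d)) (KY d)       ≡⟨ adjX (KZ d) (KY d) ⟩
      - dot (KZ d) (KX (KY d))     ≡⟨ cong -_ (adjZ d (KX (KY d))) ⟩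
      - - dot d (KZ (KX (KY d)))   ≡⟨ cong (λ e → - - e) (dot-cong {f = d} (λ _ _ _ _ _ _ → refl) perm) ⟩
      - - dot d (KY (KX (KZ d)))   ≡⟨ cong -_ (adjY d (KX (KZ d))) ⟨
      - dot (KY d) (KX (KZ d))     ∎)
      where
      perm : KZ (KX (KY d)) ≈ KY (KX (KZ d))
      perm x y z _ _ _ = begin
        KZ (KX (KY d)) x y z ≡⟨ KX-KZ (KY d) x y z ⟨
        KX (KZ (KY d)) x y z ≡⟨ K-cong′ L (λ i → sym (KY-KZ d i y z)) x ⟩
        KX (KY (KZ d)) x y z ≡⟨ KX-KY (KZ d) x y z ⟩
        KY (KX (KZ d)) x y z ∎

    Qx Qz : Field → Field → ℤ
    Qx v w = Σ< M λ y → Σ< N λ z → Area L (λ x → v x y z) (λ x → w x y z)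
    Qz v w = Σ< L λ x → Σ< M λ y → Area N (v x y) (w x y)

    -- The discrete helicity of the field w does not depend on the gauge.  Here w = K d in each
    -- direction, and dx + dy + dz is the charge of the colouring.
    Qx≡Qz : ∀ (wx wy wz dx dy dz : Field) → wx ≈ KX dx → wy ≈ KY dy → wz ≈ KZ dz →
      (∀ x y z → x ℕ.< L → y ℕ.< M → z ℕ.< N → dx x y z + dy x y z + dz x y z ≡ sg x * sg z * sg y) →
      (∀ x z → x ℕ.< L → z ℕ.< N → Σ< M (λ y → wy x y z * sg y) ≡ 0ℤ) →
      Qx wy wz ≡ Qz wx wy
    Qx≡Qz wx wy wz dx dy dz ex ey ez div neutral = begin
      Qx wy wz
        ≡⟨ Σ-cong′ M (λ y → Σ-cong′ N λ z → Area-K L (λ x → wy x y z) (λ x → wz x y z)) ⟩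
      Σ< M (λ y → Σ< N λ z → Σ< L λ x → wy x y z * KX wz x y z)
        ≡⟨ Σ³-zxy _ ⟨
      dot wy (KX wz)
        ≡⟨ dot-cong {f = wy} (λ _ _ _ _ _ _ → refl) expand ⟩
      dot wy (λ x y z → KX (KZ ρ) x y z - KX (KZ dx) x y z - KX (KZ dy) x y z)
        ≡⟨ trans (dot-- wy _ _) (cong (_- dot wy (KX (KZ dy))) (dot-- wy _ _)) ⟩
      dot wy (KX (KZ ρ)) - dot wy (KX (KZ dx)) - dot wy (KX (KZ dy))
        ≡⟨ cong₂ _-_ (cong₂ _-_ charge gauge) isotropic ⟩
      0ℤ - - Qz wx wy - 0ℤ
        ≡⟨ lem (Qz wx wy) ⟩
      Qz wx wy ∎
      where
      lem : ∀ a → 0ℤ - - a - 0ℤ ≡ a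
      lem = solve-∀
      ρ : Field
      ρ x y z = sg x * sg z * sg y
      expand : KX wz ≈ (λ x y z → KX (KZ ρ) x y z - KX (KZ dx) x y z - KX (KZ dy) x y z)
      expand x y z lx ly lz = begin
        KX wz x y z
          ≡⟨ KX-cong ez x y z lx ly lz ⟩
        KX (KZ dz) x y z
          ≡⟨ KX-cong (KZ-cong (λ x y z lx ly lz → trans (l1 (dx x y z) (dy x y z) (dz x y z)) (cong (λ t → t - dx x y z - dy x y z) (div x y z lx ly lz)))) x y z lx ly lz ⟩
        KX (KZ (λ x y z → ρ x y z - dx x y z - dy x y z)) x y z
          ≡⟨ K-cong′ L (λ i → trans (K-- N (λ j → ρ i y j - dx i y j) (dy i y) z) (cong (_- KZ dy i y z) (K-- N (ρ i y) (dx i y) z))) x ⟩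
        KX (λ x y z → KZ ρ x y z - KZ dx x y z - KZ dy x y z) x y z
          ≡⟨ trans (K-- L (λ i → KZ ρ i y z - KZ dx i y z) (λ i → KZ dy i y z) x) (cong (_- KX (KZ dy) x y z) (K-- L (λ i → KZ ρ i y z) (λ i → KZ dx i y z) x)) ⟩
        KX (KZ ρ) x y z - KX (KZ dx) x y z - KX (KZ dy) x y z ∎
        where
        l1 : ∀ a b c → c ≡ (a + b + c) - a - b
        l1 = solve-∀
      isotropic : dot wy (KX (KZ dy)) ≡ 0ℤ
      isotropic = trans (dot-cong {g = KX (KZ dy)} ey (λ _ _ _ _ _ _ → refl)) (KY-KX-KZ-isotropic dy)
      -- Commuting `KX` past `KZ` recovers w_x = `KX dx`; the sign comes from exchanging the two
      -- arguments of the area along z.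
      gauge : dot wy (KX (KZ dx)) ≡ - Qz wx wy
      gauge = begin
        dot wy (KX (KZ dx))
          ≡⟨ dot-cong {f = wy} (λ _ _ _ _ _ _ → refl) (λ x y z lx ly lz → trans (KX-KZ dx x y z) (KZ-cong (λ a b c la lb lc → sym (ex a b c la lb lc)) x y z lx ly lz)) ⟩
        dot wy (KZ wx)
          ≡⟨ Σ-cong′ L (λ x → Σ-cong′ M λ y → sym (trans (sym (Area-antisym N (wy x y) (wx x y))) (Area-K N (wy x y) (wx x y)))) ⟩
        Σ< L (λ x → Σ< M λ y → - Area N (wx x y) (wy x y))
          ≡⟨ trans (Σ-cong′ L (λ x → Σ-neg M _)) (Σ-neg L _) ⟩
        - Qz wx wy ∎
      charge : dot wy (KX (KZ ρ)) ≡ 0ℤ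
      charge = begin
        dot wy (KX (KZ ρ))
          ≡⟨ Σ³-xzy _ ⟩
        Σ< L (λ x → Σ< N λ z → Σ< M λ y → wy x y z * KX (KZ ρ) x y z)
          ≡⟨ Σ-zero′ L (λ x lx → Σ-zero′ N λ z lz → begin
            Σ< M (λ y → wy x y z * KX (KZ ρ) x y z)
              ≡⟨ Σ-cong′ M (λ y → trans (cong (wy x y z *_) (sep x y z)) (l2 (wy x y z) (sg y) (h x z))) ⟩
            Σ< M (λ y → h x z * (wy x y z * sg y))
              ≡⟨ Σ-*ˡ M (h x z) _ ⟩
            h x z * Σ< M (λ y → wy x y z * sg y)
              ≡⟨ cong (h x z *_) (neutral x z lx lz) ⟩
            h x z * 0ℤ
              ≡⟨ *-zeroʳ (h x z) ⟩
            0ℤ ∎) ⟩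
        0ℤ ∎
        where
        h : ℕ → ℕ → ℤ
        h x z = K L (λ i → K N (λ j → sg i * sg j) z) x
        l2 : ∀ a b c → a * (b * c) ≡ c * (a * b)
        l2 = solve-∀
        sep : ∀ x y z → KX (KZ ρ) x y z ≡ sg y * h x z
        sep x y z = trans
          (K-cong′ L (λ i → trans (K-cong′ N (λ j → *-comm (sg i * sg j) (sg y)) z) (K-*ˡ N (sg y) (λ j → sg i * sg j) z)) x)
          (K-*ˡ L (sg y) (λ i → K N (λ j → sg i * sg j) z) x)

-- Dominoes on a line: divergence, and the bound for the swept area.

module Lines where

  open Sums
  open Helicity using (sg)
  open import Data.Nat as ℕ using (ℕ; zero; suc)
  import Data.Nat.Properties as ℕP
  open import Data.Integer using (ℤ; +≤+; -≤+; -_; _+_; _*_; _-_; _≤_; 0ℤ; 1ℤ; -1ℤ)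
  open import Data.Integer.Properties
  open import Data.Integer.Tactic.RingSolver using (solve-∀)
  open import Data.Product using (_×_; _,_; ∃; proj₁; proj₂)
  open import Data.Empty using (⊥-elim)
  open import Relation.Binary.PropositionalEquality
  open ≡-Reasoning

  data Trit : ℤ → Set where
    neg  : Trit -1ℤ
    null : Trit 0ℤ
    one  : Trit 1ℤ

  -- The steps towards the partner cubes, projected to a line of the box.
  record Line (n : ℕ) (g : ℕ → ℤ) : Set where
    field
      trit : ∀ i → Trit (g i)
      fwd  : ∀ i → i ℕ.< n → g i ≡ 1ℤ → suc i ℕ.< n × g (suc i) ≡ -1ℤ
      bwd  : ∀ i → i ℕ.< n → g i ≡ -1ℤ → ∃ λ j → i ≡ suc j × g j ≡ 1ℤ

  module _ {n g} (l : Line n g) (e a : ℕ → ℤ)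
           (e0 : ∀ i → g i ≡ 0ℤ → e i ≡ 0ℤ) (e1 : ∀ i → g i ≡ 1ℤ → e i ≡ a i)
           (e- : ∀ i → g (suc i) ≡ -1ℤ → e (suc i) ≡ - a i) where

    open Line l

    -- By hypothesis `e` cancels on every domino lying along the line and vanishes where the domino
    -- leaves it, so a prefix sum sees only a domino that is cut by its end. `prefix-` treats an end
    -- between the two cells of a domino, `prefix` any other end.
    prefix- : ∀ i → suc i ℕ.< n → g (suc i) ≡ -1ℤ → Σ< (suc i) e ≡ a i
    prefix  : ∀ i → i ℕ.< n → g i ≢ -1ℤ → Σ< i e ≡ 0ℤ
    prefix- i lt q with bwd (suc i) lt q
    ... | j , refl , p =
      trans (cong₂ _+_ (prefix i (ℕP.<-trans (ℕP.n<1+n i) lt) λ r → case (trans (sym p) r)) (e1 i p)) (+-identityˡ (a i))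
      where
      case : 1ℤ ≢ -1ℤ
      case ()
    prefix zero lt ne = refl
    prefix (suc i) lt ne with g i in eq | trit i
    ... | _ | one = ⊥-elim (ne (proj₂ (fwd i (ℕP.<-trans (ℕP.n<1+n i) lt) eq)))
    ... | _ | null = cong₂ _+_ (prefix i (ℕP.<-trans (ℕP.n<1+n i) lt) λ r → case (trans (sym eq) r)) (e0 i eq)
      where
      case : 0ℤ ≢ -1ℤ
      case ()
    ... | _ | neg with bwd i (ℕP.<-trans (ℕP.n<1+n i) lt) eq
    ...   | j , refl , _ = trans (cong₂ _+_ (prefix- j (ℕP.<-trans (ℕP.n<1+n i) lt) eq) (e- j eq)) (+-inverseʳ (a j))

    total : Σ< n e ≡ 0ℤ
    total = upto n refl
      where
      upto : ∀ m → n ≡ m → Σ< m e ≡ 0ℤ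
      upto zero _ = refl
      upto (suc m) eqn with g m in eq | trit m
      ... | _ | one = ⊥-elim (ℕP.<-irrefl refl (subst (suc m ℕ.<_) eqn (proj₁ (fwd m (ℕP.≤-reflexive (sym eqn)) eq))))
      ... | _ | null = cong₂ _+_ (prefix m (ℕP.≤-reflexive (sym eqn)) λ r → case (trans (sym eq) r)) (e0 m eq)
        where
        case : 0ℤ ≢ -1ℤ
        case ()
      ... | _ | neg with bwd m (ℕP.≤-reflexive (sym eqn)) eq
      ...   | j , refl , _ = trans (cong₂ _+_ (prefix- j (ℕP.≤-reflexive (sym eqn)) eq) (e- j eq)) (+-inverseʳ (a j))

  line-neutral : ∀ {n g} → Line n g → Σ< n g ≡ 0ℤ
  line-neutral {g = g} l = total l g (λ _ → 1ℤ) (λ _ e → e) (λ _ e → e) (λ _ e → e)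

  -- The function s g² takes opposite values on the two cells of a domino along the line, because
  -- `s` alternates. Hence `K` at a cell sees only the domino of that cell: it gives s_j at a first
  -- cell and -s_j at a second one, which is s_j g_j. With `s` the colouring this says w = K d.
  line-K : ∀ {n g} → Line n g → (s : ℕ → ℤ) → (∀ i → s (suc i) ≡ - s i) →
    ∀ j → j ℕ.< n → s j * g j ≡ K n (λ i → s i * (g i * g i)) j
  line-K {n} {g} l s alt j lt = by-trit (Line.trit l j) refl
    where
    e : ℕ → ℤ
    e i = s i * (g i * g i)
    e0 : ∀ i → g i ≡ 0ℤ → e i ≡ 0ℤ
    e0 i q = trans (cong (λ t → s i * (t * t)) q) (*-zeroʳ (s i))
    e1 : ∀ i → g i ≡ 1ℤ → e i ≡ s i
    e1 i q = trans (cong (λ t → s i * (t * t)) q) (*-identityʳ (s i))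
    e- : ∀ i → g (suc i) ≡ -1ℤ → e (suc i) ≡ - s i
    e- i q = trans (cong (λ t → s (suc i) * (t * t)) q) (trans (*-identityʳ (s (suc i))) (alt i))
    h0 : ∀ a → a * 0ℤ ≡ 0ℤ + (0ℤ + a * (0ℤ * 0ℤ)) - 0ℤ
    h0 = solve-∀
    h1 : ∀ a → a * 1ℤ ≡ 0ℤ + (0ℤ + a * (1ℤ * 1ℤ)) - 0ℤ
    h1 = solve-∀
    h- : ∀ a → - a * -1ℤ ≡ a + (a + - a * (-1ℤ * -1ℤ)) - 0ℤ
    h- = solve-∀
    eval : ∀ {p t} → Σ< j e ≡ p → g j ≡ t → p + (p + s j * (t * t)) - 0ℤ ≡ K n e j
    eval p q = sym (cong₂ _-_ (cong₂ _+_ p (cong₂ _+_ p (cong (λ t → s j * (t * t)) q))) (total l e s e0 e1 e-))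
    by-trit : ∀ {t} → Trit t → g j ≡ t → s j * g j ≡ K n e j
    by-trit null q = trans (trans (cong (s j *_) q) (h0 (s j)))
      (eval (prefix l e s e0 e1 e- j lt λ r → case (trans (sym q) r)) q)
      where
      case : 0ℤ ≢ -1ℤ
      case ()
    by-trit one q = trans (trans (cong (s j *_) q) (h1 (s j)))
      (eval (prefix l e s e0 e1 e- j lt λ r → case (trans (sym q) r)) q)
      where
      case : 1ℤ ≢ -1ℤ
      case ()
    by-trit neg q with Line.bwd l j lt q
    ... | i , refl , _ = trans (cong₂ _*_ (alt i) q) (trans (h- (s i))
      (trans (cong (λ b → s i + (s i + b * (-1ℤ * -1ℤ)) - 0ℤ) (sym (alt i)))
        (eval (prefix- l e s e0 e1 e- i lt q) q)))

  sq : (ℕ → ℤ) → ℕ → ℤ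
  sq u i = u i * u i

  trit-≤ : ∀ {t V W} → Trit t → V ≤ W → - V ≤ W → t * V ≤ (t * t) * W
  trit-≤ {V = V} {W} neg p q = subst₂ _≤_ (sym (-1*i≡-i V)) (sym (*-identityˡ W)) q
  trit-≤ null p q = ≤-refl
  trit-≤ {V = V} {W} one p q = subst₂ _≤_ (sym (*-identityˡ V)) (sym (*-identityˡ W)) p

  trit-sq≥0 : ∀ {s t} → Trit s → Trit t → 0ℤ ≤ (s * s) * (t * t)
  trit-sq≥0 neg neg = +≤+ ℕ.z≤n
  trit-sq≥0 neg null = +≤+ ℕ.z≤n
  trit-sq≥0 neg one = +≤+ ℕ.z≤n
  trit-sq≥0 null t = +≤+ ℕ.z≤n
  trit-sq≥0 one neg = +≤+ ℕ.z≤n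
  trit-sq≥0 one null = +≤+ ℕ.z≤n
  trit-sq≥0 one one = +≤+ ℕ.z≤n

  trit-neg : ∀ {t} → Trit t → Trit (- t)
  trit-neg neg = one
  trit-neg null = null
  trit-neg one = neg

  Σ-≤-sq : ∀ n {u} → (∀ i → Trit (u i)) → Σ< n u ≤ Σ< n (sq u)
  Σ-≤-sq n {u} tu = Σ-mono n λ i _ → lem (tu i)
    where
    lem : ∀ {t} → Trit t → t ≤ t * t
    lem neg = -≤+
    lem null = ≤-refl
    lem one = ≤-refl

  neg-Σ-≤-sq : ∀ n {u} → (∀ i → Trit (u i)) → - Σ< n u ≤ Σ< n (sq u)
  neg-Σ-≤-sq n {u} tu = subst₂ _≤_ (Σ-neg n u) (Σ-cong′ n λ i → lem (u i))
    (Σ-≤-sq n {λ i → - u i} λ i → trit-neg (tu i))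
    where
    lem : ∀ a → - a * - a ≡ a * a
    lem = solve-∀

  -- The area is a signed sum over pairs of a nonzero u-step and a nonzero v-step, each of weight at
  -- most 1. In the induction the new step meets the earlier ones through |Σ v| ≤ Σ v²; the pair of
  -- a step with itself is the nonnegative slack.
  Area-≤ : ∀ n u v → (∀ i → Trit (u i)) → (∀ i → Trit (v i)) →
    Area n u v ≤ Σ< n (sq u) * Σ< n (sq v)
  Area-≤ zero u v tu tv = ≤-refl
  Area-≤ (suc n) u v tu tv = bound
    where
    A B a b : ℤ
    A = Σ< n (sq u)
    B = Σ< n (sq v)
    a = sq u n
    b = sq v n
    h : ∀ A B a b → A * B + (a * B + b * A) + a * b ≡ (A + a) * (B + b)
    h = solve-∀
    h′ : ∀ x y → - (x * y) ≡ (- x) * y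
    h′ = solve-∀
    h″ : ∀ x → - x * - x ≡ x * x
    h″ = solve-∀
    t1 : u n * Σ< n v ≤ a * B
    t1 = trit-≤ (tu n) (Σ-≤-sq n tv) (neg-Σ-≤-sq n tv)
    t2 : - (v n * Σ< n u) ≤ b * A
    t2 = subst₂ _≤_ (sym (h′ (v n) (Σ< n u))) (cong (_* A) (h″ (v n)))
           (trit-≤ (trit-neg (tv n)) (Σ-≤-sq n tu) (neg-Σ-≤-sq n tu))
    bound : Area n u v + (u n * Σ< n v - v n * Σ< n u) ≤ (A + a) * (B + b)
    bound = ≤-trans (+-mono-≤ (Area-≤ n u v tu tv) (+-mono-≤ t1 t2))
      (subst (A * B + (a * B + b * A) ≤_) (h A B a b)
        (subst (_≤ A * B + (a * B + b * A) + a * b) (+-identityʳ _)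
          (+-monoʳ-≤ (A * B + (a * B + b * A)) (trit-sq≥0 (tu n) (tv n)))))

-- Tilings as direction maps, the three directional forms and their upper bounds.

module Partner where

  open Sums
  open Helicity using (Field; sg; module Box)
  open Lines
  open import Data.Nat as ℕ using (ℕ; zero; suc)
  open import Data.Integer using (ℤ; -[1+_]; +≤+; -_; _+_; _*_; _-_; _≤_; 0ℤ; 1ℤ; -1ℤ; nonNegative) renaming (+_ to pos)
  open import Data.Integer.Properties
  open import Data.Integer.Tactic.RingSolver using (solve-∀)
  open import Data.Product using (_×_; _,_; ∃)
  open import Relation.Binary.PropositionalEquality
  open ≡-Reasoning

  opp : Dir → Dir
  opp +x = -x
  opp -x = +x
  opp +y = -y
  opp -y = +y
  opp +z = -z
  opp -z = +z

  by-dir : {P : Dir → Set} → P +x → P -x → P +y → P -y → P +z → P -z → ∀ d → P d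
  by-dir a b c d e f +x = a
  by-dir a b c d e f -x = b
  by-dir a b c d e f +y = c
  by-dir a b c d e f -y = d
  by-dir a b c d e f +z = e
  by-dir a b c d e f -z = f

  cX cY cZ : Dir → ℤ
  cX d = cx (vec d)
  cY d = cy (vec d)
  cZ d = cz (vec d)

  Pos : Set
  Pos = ℕ × ℕ × ℕ

  -- A relation instead of vector addition: matching on it computes the neighbour, and no step
  -- leaves the natural numbers.
  data Nb : Pos → Dir → Pos → Set where
    n+x : ∀ {x y z} → Nb (x , y , z) +x (suc x , y , z)
    n-x : ∀ {x y z} → Nb (suc x , y , z) -x (x , y , z)
    n+y : ∀ {x y z} → Nb (x , y , z) +y (x , suc y , z)
    n-y : ∀ {x y z} → Nb (x , suc y , z) -y (x , y , z)
    n+z : ∀ {x y z} → Nb (x , y , z) +z (x , y , suc z)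
    n-z : ∀ {x y z} → Nb (x , y , suc z) -z (x , y , z)

  -- A tiling of the region R, given by the direction from each cube to the other cube of its domino.
  Valid : (Pos → Set) → (Pos → Dir) → Set
  Valid R D = ∀ c → R c → ∃ λ c′ → Nb c (D c) c′ × R c′ × D c′ ≡ opp (D c)

  In : ℕ → ℕ → ℕ → Pos → Set
  In L M N (x , y , z) = x ℕ.< L × y ℕ.< M × z ℕ.< N

  trit-X : ∀ d → Trit (cX d)
  trit-X = by-dir one neg null null null null

  trit-Y : ∀ d → Trit (cY d)
  trit-Y = by-dir null null one neg null null

  trit-Z : ∀ d → Trit (cZ d)
  trit-Z = by-dir null null null null one neg

  unit : ∀ d → cX d * cX d + cY d * cY d + cZ d * cZ d ≡ 1ℤ
  unit = by-dir refl refl refl refl refl refl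

  cX-opp : ∀ d → cX (opp d) ≡ - cX d
  cX-opp = by-dir refl refl refl refl refl refl

  cY-opp : ∀ d → cY (opp d) ≡ - cY d
  cY-opp = by-dir refl refl refl refl refl refl

  cZ-opp : ∀ d → cZ (opp d) ≡ - cZ d
  cZ-opp = by-dir refl refl refl refl refl refl

  module _ {L M N D} (v : Valid (In L M N) D) where

    line-X : ∀ y z → y ℕ.< M → z ℕ.< N → Line L (λ x → cX (D (x , y , z)))
    line-X y z ly lz = record { trit = λ i → trit-X (D (i , y , z)) ; fwd = f ; bwd = b }
      where
      fwd-nb : ∀ {i d x′ y′ z′} → Nb (i , y , z) d (x′ , y′ , z′) → cX d ≡ 1ℤ → suc i ≡ x′ × y ≡ y′ × z ≡ z′
      fwd-nb n+x _ = refl , refl , refl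
      bwd-nb : ∀ {i d x′ y′ z′} → Nb (i , y , z) d (x′ , y′ , z′) → cX d ≡ -1ℤ → i ≡ suc x′ × y ≡ y′ × z ≡ z′
      bwd-nb n-x _ = refl , refl , refl
      f : ∀ i → i ℕ.< L → cX (D (i , y , z)) ≡ 1ℤ → suc i ℕ.< L × cX (D (suc i , y , z)) ≡ -1ℤ
      f i lt e with v (i , y , z) (lt , ly , lz)
      ... | c′ , nb , (r , _) , q with fwd-nb nb e
      ...   | refl , refl , refl = r , trans (cong cX q) (trans (cX-opp (D (i , y , z))) (cong -_ e))
      b : ∀ i → i ℕ.< L → cX (D (i , y , z)) ≡ -1ℤ → ∃ λ j → i ≡ suc j × cX (D (j , y , z)) ≡ 1ℤ
      b i lt e with v (i , y , z) (lt , ly , lz)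
      ... | (j , _) , nb , (r , _) , q with bwd-nb nb e
      ...   | refl , refl , refl = j , refl , trans (cong cX q) (trans (cX-opp (D (suc j , y , z))) (cong -_ e))

    line-Y : ∀ x z → x ℕ.< L → z ℕ.< N → Line M (λ y → cY (D (x , y , z)))
    line-Y x z lx lz = record { trit = λ i → trit-Y (D (x , i , z)) ; fwd = f ; bwd = b }
      where
      fwd-nb : ∀ {i d x′ y′ z′} → Nb (x , i , z) d (x′ , y′ , z′) → cY d ≡ 1ℤ → x ≡ x′ × suc i ≡ y′ × z ≡ z′
      fwd-nb n+y _ = refl , refl , refl
      bwd-nb : ∀ {i d x′ y′ z′} → Nb (x , i , z) d (x′ , y′ , z′) → cY d ≡ -1ℤ → x ≡ x′ × i ≡ suc y′ × z ≡ z′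
      bwd-nb n-y _ = refl , refl , refl
      f : ∀ i → i ℕ.< M → cY (D (x , i , z)) ≡ 1ℤ → suc i ℕ.< M × cY (D (x , suc i , z)) ≡ -1ℤ
      f i lt e with v (x , i , z) (lx , lt , lz)
      ... | c′ , nb , (_ , r , _) , q with fwd-nb nb e
      ...   | refl , refl , refl = r , trans (cong cY q) (trans (cY-opp (D (x , i , z))) (cong -_ e))
      b : ∀ i → i ℕ.< M → cY (D (x , i , z)) ≡ -1ℤ → ∃ λ j → i ≡ suc j × cY (D (x , j , z)) ≡ 1ℤ
      b i lt e with v (x , i , z) (lx , lt , lz)
      ... | (_ , j , _) , nb , _ , q with bwd-nb nb e
      ...   | refl , refl , refl = j , refl , trans (cong cY q) (trans (cY-opp (D (x , suc j , z))) (cong -_ e))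

    line-Z : ∀ x y → x ℕ.< L → y ℕ.< M → Line N (λ z → cZ (D (x , y , z)))
    line-Z x y lx ly = record { trit = λ i → trit-Z (D (x , y , i)) ; fwd = f ; bwd = b }
      where
      fwd-nb : ∀ {i d x′ y′ z′} → Nb (x , y , i) d (x′ , y′ , z′) → cZ d ≡ 1ℤ → x ≡ x′ × y ≡ y′ × suc i ≡ z′
      fwd-nb n+z _ = refl , refl , refl
      bwd-nb : ∀ {i d x′ y′ z′} → Nb (x , y , i) d (x′ , y′ , z′) → cZ d ≡ -1ℤ → x ≡ x′ × y ≡ y′ × i ≡ suc z′
      bwd-nb n-z _ = refl , refl , refl
      f : ∀ i → i ℕ.< N → cZ (D (x , y , i)) ≡ 1ℤ → suc i ℕ.< N × cZ (D (x , y , suc i)) ≡ -1ℤ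
      f i lt e with v (x , y , i) (lx , ly , lt)
      ... | c′ , nb , (_ , _ , r) , q with fwd-nb nb e
      ...   | refl , refl , refl = r , trans (cong cZ q) (trans (cZ-opp (D (x , y , i))) (cong -_ e))
      b : ∀ i → i ℕ.< N → cZ (D (x , y , i)) ≡ -1ℤ → ∃ λ j → i ≡ suc j × cZ (D (x , y , j)) ≡ 1ℤ
      b i lt e with v (x , y , i) (lx , ly , lt)
      ... | (_ , _ , j) , nb , _ , q with bwd-nb nb e
      ...   | refl , refl , refl = j , refl , trans (cong cZ q) (trans (cZ-opp (D (x , y , suc j))) (cong -_ e))

  sg² : ∀ n → sg n * sg n ≡ 1ℤ
  sg² zero = refl
  sg² (suc n) = trans (h (sg n)) (sg² n)
    where
    h : ∀ a → - a * - a ≡ a * a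
    h = solve-∀

  sg-+ : ∀ m n → sg (m ℕ.+ n) ≡ sg m * sg n
  sg-+ zero n = sym (*-identityˡ (sg n))
  sg-+ (suc m) n = trans (cong -_ (sg-+ m n)) (neg-distribˡ-* (sg m) (sg n))

  trit-* : ∀ {s t} → Trit s → Trit t → Trit (s * t)
  trit-* {t = t} neg q = subst Trit (sym (-1*i≡-i t)) (trit-neg q)
  trit-* null q = null
  trit-* {t = t} one q = subst Trit (sym (*-identityˡ t)) q

  trit-sg : ∀ n → Trit (sg n)
  trit-sg zero = one
  trit-sg (suc n) = trit-neg (trit-sg n)

  sq≥0 : ∀ a → 0ℤ ≤ a * a
  sq≥0 (pos n) = subst (0ℤ ≤_) (pos-* n n) (+≤+ ℕ.z≤n)
  sq≥0 (-[1+ n ]) = +≤+ ℕ.z≤n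

  Σ≥0 : ∀ n {f} → (∀ i → 0ℤ ≤ f i) → 0ℤ ≤ Σ< n f
  Σ≥0 n {f} p = subst (_≤ Σ< n f) (Σ-zero n) (Σ-mono n λ i _ → p i)

  infixl 7 _⊙_
  _⊙_ : Field → Field → Field
  (σ ⊙ g) x y z = σ x y z * g x y z

  -- The fields are arbitrary and the colouring enters only through its separated form, so that all
  -- three cyclic orders of the coordinates are instances of one proof.
  module Rotate (L M N : ℕ) (σ gx gy gz : Field)
    (sep : ∀ x y z → σ x y z ≡ sg x * sg z * sg y)
    (lx : ∀ y z → y ℕ.< M → z ℕ.< N → Line L (λ x → gx x y z))
    (ly : ∀ x z → x ℕ.< L → z ℕ.< N → Line M (λ y → gy x y z))
    (lz : ∀ x y → x ℕ.< L → y ℕ.< M → Line N (λ z → gz x y z))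
    (uni : ∀ x y z → gx x y z * gx x y z + gy x y z * gy x y z + gz x y z * gz x y z ≡ 1ℤ)
    (ty : ∀ x y z → Trit (gy x y z)) (tz : ∀ x y z → Trit (gz x y z)) where

    d : Field → Field
    d g x y z = σ x y z * (g x y z * g x y z)

    rotate : Box.Qx L M N (σ ⊙ gy) (σ ⊙ gz) ≡ Box.Qz L M N (σ ⊙ gx) (σ ⊙ gy)
    rotate = Box.Qx≡Qz L M N (σ ⊙ gx) (σ ⊙ gy) (σ ⊙ gz) (d gx) (d gy) (d gz)
      (λ x y z a b c → line-K (lx y z b c) (λ i → σ i y z) (altx y z) x a)
      (λ x y z a b c → line-K (ly x z a c) (λ i → σ x i z) (alty x z) y b)
      (λ x y z a b c → line-K (lz x y a b) (λ i → σ x y i) (altz x y) z c)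
      (λ x y z _ _ _ → trans (h₁ (σ x y z) (gx x y z) (gy x y z) (gz x y z))
        (trans (cong (σ x y z *_) (uni x y z)) (trans (*-identityʳ _) (sep x y z))))
      (λ x z a c → begin
        Σ< M (λ y → σ x y z * gy x y z * sg y)
          ≡⟨ Σ-cong′ M (λ y → trans (cong (λ t → t * gy x y z * sg y) (sep x y z))
               (trans (h₂ (sg x * sg z) (sg y) (gy x y z)) (cong (λ t → sg x * sg z * (t * gy x y z)) (sg² y)))) ⟩
        Σ< M (λ y → sg x * sg z * (1ℤ * gy x y z))
          ≡⟨ Σ-*ˡ M (sg x * sg z) _ ⟩
        sg x * sg z * Σ< M (λ y → 1ℤ * gy x y z)
          ≡⟨ cong (sg x * sg z *_) (trans (Σ-cong′ M λ y → *-identityˡ (gy x y z)) (line-neutral (ly x z a c))) ⟩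
        sg x * sg z * 0ℤ
          ≡⟨ *-zeroʳ (sg x * sg z) ⟩
        0ℤ ∎)
      where
      h₁ : ∀ s a b c → s * (a * a) + s * (b * b) + s * (c * c) ≡ s * (a * a + b * b + c * c)
      h₁ = solve-∀
      h₂ : ∀ s t a → s * t * a * t ≡ s * (t * t * a)
      h₂ = solve-∀
      h₃ : ∀ a b c → - a * b * c ≡ - (a * b * c)
      h₃ = solve-∀
      h₄ : ∀ a b c → a * b * - c ≡ - (a * b * c)
      h₄ = solve-∀
      h₅ : ∀ a b c → a * - b * c ≡ - (a * b * c)
      h₅ = solve-∀
      altx : ∀ y z i → σ (suc i) y z ≡ - σ i y z
      altx y z i = trans (sep _ _ _) (trans (h₃ (sg i) (sg z) (sg y)) (cong -_ (sym (sep i y z))))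
      alty : ∀ x z i → σ x (suc i) z ≡ - σ x i z
      alty x z i = trans (sep _ _ _) (trans (h₄ (sg x) (sg z) (sg i)) (cong -_ (sym (sep x i z))))
      altz : ∀ x y i → σ x y (suc i) ≡ - σ x y i
      altz x y i = trans (sep _ _ _) (trans (h₅ (sg x) (sg i) (sg y)) (cong -_ (sym (sep x y i))))

    -- The factor a + b is kept instead of being replaced by `l`: it counts the cells that matter
    -- for this direction, and averaging over the directions of a cube depends on it.
    4xy≤ : ∀ l a b → 0ℤ ≤ a + b → a + b ≤ l → pos 4 * (a * b) ≤ l * (a + b)
    4xy≤ l a b p q = ≤-trans (subst₂ _≤_ (+-identityˡ _) (h a b) (+-monoˡ-≤ (pos 4 * (a * b)) (sq≥0 (a - b))))
      (*-monoʳ-≤-nonNeg (a + b) {{nonNegative p}} q)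
      where
      h : ∀ a b → (a - b) * (a - b) + pos 4 * (a * b) ≡ (a + b) * (a + b)
      h = solve-∀

    S : Field → ℤ
    S g = Σ< M λ y → Σ< N λ z → Σ< L λ x → g x y z * g x y z

    bound : pos 4 * Box.Qx L M N (σ ⊙ gy) (σ ⊙ gz) ≤ pos L * (S gy + S gz)
    bound = subst₂ _≤_ (trans (Σ-cong′ M λ y → Σ-*ˡ N (pos 4) _) (Σ-*ˡ M (pos 4) _))
      (begin
        Σ< M (λ y → Σ< N λ z → pos L * (s gy y z + s gz y z))
          ≡⟨ trans (Σ-cong′ M λ y → Σ-*ˡ N (pos L) _) (Σ-*ˡ M (pos L) _) ⟩
        pos L * Σ< M (λ y → Σ< N λ z → s gy y z + s gz y z)
          ≡⟨ cong (pos L *_) (trans (Σ-cong′ M λ y → Σ-+ N _ _) (Σ-+ M _ _)) ⟩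
        pos L * (S gy + S gz) ∎)
      (Σ-mono M λ y _ → Σ-mono N λ z _ → line y z)
      where
      s : Field → ℕ → ℕ → ℤ
      s g y z = Σ< L λ x → g x y z * g x y z
      σ² : ∀ x y z → σ x y z * σ x y z ≡ 1ℤ
      σ² x y z rewrite sep x y z = trans (h (sg x) (sg z) (sg y)) (cong₂ _*_ (cong₂ _*_ (sg² x) (sg² z)) (sg² y))
        where
        h : ∀ a b c → a * b * c * (a * b * c) ≡ a * a * (b * b) * (c * c)
        h = solve-∀
      σg² : ∀ g x y z → σ x y z * g x y z * (σ x y z * g x y z) ≡ g x y z * g x y z
      σg² g x y z = trans (h (σ x y z) (g x y z)) (trans (cong (_* (g x y z * g x y z)) (σ² x y z)) (*-identityˡ _))
        where
        h : ∀ a b → a * b * (a * b) ≡ a * a * (b * b)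
        h = solve-∀
      tσ : ∀ x y z → Trit (σ x y z)
      tσ x y z = subst Trit (sym (sep x y z)) (trit-* (trit-* (trit-sg x) (trit-sg z)) (trit-sg y))
      s≥0 : ∀ g y z → 0ℤ ≤ s g y z
      s≥0 g y z = Σ≥0 L λ x → sq≥0 (g x y z)
      s≤L : ∀ y z → s gy y z + s gz y z ≤ pos L
      s≤L y z = subst₂ _≤_ (Σ-+ L _ _) (trans (Σ-const L 1ℤ) (*-identityʳ (pos L)))
        (Σ-mono L λ x _ → subst₂ _≤_ (+-identityˡ _) (trans (sym (+-assoc (gx x y z * gx x y z) _ _)) (uni x y z))
          (+-monoˡ-≤ (gy x y z * gy x y z + gz x y z * gz x y z) (sq≥0 (gx x y z))))
      line : ∀ y z → pos 4 * Area L (λ x → (σ ⊙ gy) x y z) (λ x → (σ ⊙ gz) x y z) ≤ pos L * (s gy y z + s gz y z)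
      line y z = ≤-trans
        (*-monoˡ-≤-nonNeg (pos 4) (subst (Area L (λ x → (σ ⊙ gy) x y z) (λ x → (σ ⊙ gz) x y z) ≤_)
          (cong₂ _*_ (Σ-cong′ L λ x → σg² gy x y z) (Σ-cong′ L λ x → σg² gz x y z))
          (Area-≤ L _ _ (λ x → trit-* (tσ x y z) (ty x y z)) (λ x → trit-* (tσ x y z) (tz x y z)))))
        (4xy≤ (pos L) (s gy y z) (s gz y z) (+-mono-≤ (s≥0 gy y z) (s≥0 gz y z)) (s≤L y z))

  color : Field
  color x y z = sg (x ℕ.+ y ℕ.+ z)

  color-sep : ∀ x y z → color x y z ≡ sg x * sg z * sg y
  color-sep x y z = trans (sg-+ (x ℕ.+ y) z) (trans (cong (_* sg z) (sg-+ x y)) (h (sg x) (sg y) (sg z)))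
    where
    h : ∀ a b c → a * b * c ≡ a * c * b
    h = solve-∀

  comp : (Dir → ℤ) → (Pos → Dir) → Field
  comp c D x y z = c (D (x , y , z))

  -- At a white cell the direction to the partner points to black; at a black cell it points to
  -- white and the colour -1 reverses it. Both cells of a domino thus carry v(d).
  wX wY wZ : (Pos → Dir) → Field
  wX D = color ⊙ comp cX D
  wY D = color ⊙ comp cY D
  wZ D = color ⊙ comp cZ D

  Qx Qy Qz : ℕ → ℕ → ℕ → (Pos → Dir) → ℤ
  Qx L M N D = Σ< M λ y → Σ< N λ z → Area L (λ x → wY D x y z) (λ x → wZ D x y z)
  Qy L M N D = Σ< N λ z → Σ< L λ x → Area M (λ y → wZ D x y z) (λ y → wX D x y z)
  Qz L M N D = Σ< L λ x → Σ< M λ y → Area N (λ z → wX D x y z) (λ z → wY D x y z)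

  module _ {L M N D} (v : Valid (In L M N) D) where

    private
      h₁ : ∀ a b c → a * b * c ≡ c * a * b
      h₁ = solve-∀
      h₂ : ∀ a b c → a * b * c ≡ b * c * a
      h₂ = solve-∀
      h₃ : ∀ a b c → b * b + c * c + a * a ≡ a * a + b * b + c * c
      h₃ = solve-∀
      h₄ : ∀ a b c → c * c + a * a + b * b ≡ a * a + b * b + c * c
      h₄ = solve-∀

      module R = Rotate L M N color (comp cX D) (comp cY D) (comp cZ D) color-sep
        (line-X v) (line-Y v) (line-Z v)
        (λ x y z → unit (D (x , y , z)))
        (λ x y z → trit-Y (D (x , y , z))) (λ x y z → trit-Z (D (x , y , z)))

      -- The coordinates are read in the order (y, z, x); in this order the first form is `Qy` and
      -- the last one is `Qx`. The next instance uses (z, x, y).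
      module R′ = Rotate M N L (λ y z x → color x y z)
        (λ y z x → comp cY D x y z) (λ y z x → comp cZ D x y z) (λ y z x → comp cX D x y z)
        (λ y z x → trans (color-sep x y z) (h₁ (sg x) (sg z) (sg y)))
        (λ z x lz lx → line-Y v x z lx lz) (λ y x ly lx → line-Z v x y lx ly) (λ y z ly lz → line-X v y z ly lz)
        (λ y z x → trans (h₃ (comp cX D x y z) (comp cY D x y z) (comp cZ D x y z)) (unit (D (x , y , z))))
        (λ y z x → trit-Z (D (x , y , z))) (λ y z x → trit-X (D (x , y , z)))

      module R″ = Rotate N L M (λ z x y → color x y z)
        (λ z x y → comp cZ D x y z) (λ z x y → comp cX D x y z) (λ z x y → comp cY D x y z)
        (λ z x y → trans (color-sep x y z) (h₂ (sg x) (sg z) (sg y)))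
        (λ x y lx ly → line-Z v x y lx ly) (λ z y lz ly → line-X v y z ly lz) (λ z x lz lx → line-Y v x z lx lz)
        (λ z x y → trans (h₄ (comp cX D x y z) (comp cY D x y z) (comp cZ D x y z)) (unit (D (x , y , z))))
        (λ z x y → trit-X (D (x , y , z))) (λ z x y → trit-Y (D (x , y , z)))

    Qx≡Qz : Qx L M N D ≡ Qz L M N D
    Qx≡Qz = R.rotate

    Qy≡Qx : Qy L M N D ≡ Qx L M N D
    Qy≡Qx = R′.rotate

    count : (Dir → ℤ) → ℤ
    count c = Σ< M λ y → Σ< N λ z → Σ< L λ x → c (D (x , y , z)) * c (D (x , y , z))

    count-X+Y+Z : count cX + count cY + count cZ ≡ pos L * pos M * pos N
    count-X+Y+Z = begin
      count cX + count cY + count cZ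
        ≡⟨ trans (cong (_+ count cZ) (sum+ _ _)) (sum+ _ _) ⟩
      Σ< M (λ y → Σ< N λ z → Σ< L λ x → cX (D (x , y , z)) * cX (D (x , y , z)) + cY (D (x , y , z)) * cY (D (x , y , z)) + cZ (D (x , y , z)) * cZ (D (x , y , z)))
        ≡⟨ Σ-cong′ M (λ y → trans (Σ-cong′ N λ z → trans (Σ-cong′ L λ x → unit (D (x , y , z))) (Σ-const L 1ℤ)) (Σ-const N _)) ⟩
      Σ< M (λ y → pos N * (pos L * 1ℤ))
        ≡⟨ Σ-const M _ ⟩
      pos M * (pos N * (pos L * 1ℤ))
        ≡⟨ h (pos L) (pos M) (pos N) ⟩
      pos L * pos M * pos N ∎
      where
      h : ∀ a b c → b * (c * (a * 1ℤ)) ≡ a * b * c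
      h = solve-∀
      sum+ : ∀ (f g : ℕ → ℕ → ℕ → ℤ) → Σ< M (λ y → Σ< N λ z → Σ< L λ x → f x y z) + Σ< M (λ y → Σ< N λ z → Σ< L λ x → g x y z)
        ≡ Σ< M (λ y → Σ< N λ z → Σ< L λ x → f x y z + g x y z)
      sum+ f g = sym (trans (Σ-cong′ M λ y → trans (Σ-cong′ N λ z → Σ-+ L _ _) (Σ-+ N _ _)) (Σ-+ M _ _))

    count≥0 : ∀ c → 0ℤ ≤ count c
    count≥0 c = Σ≥0 M λ y → Σ≥0 N λ z → Σ≥0 L λ x → sq≥0 (c (D (x , y , z)))

    Σ³-yzx : ∀ (f : Field) → Σ< L (λ x → Σ< M λ y → Σ< N λ z → f x y z) ≡ Σ< M λ y → Σ< N λ z → Σ< L λ x → f x y z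
    Σ³-yzx f = trans (Σ-swap L M _) (Σ-cong′ M λ y → Σ-swap L N _)

    Σ³-zxy : ∀ (f : Field) → Σ< N (λ z → Σ< L λ x → Σ< M λ y → f x y z) ≡ Σ< M λ y → Σ< N λ z → Σ< L λ x → f x y z
    Σ³-zxy f = trans (trans (Σ-cong′ N λ z → Σ-swap L M _) (Σ-swap N M _)) refl

    bound-X : pos 4 * Qx L M N D ≤ pos L * (count cY + count cZ)
    bound-X = R.bound

    bound-Y : pos 4 * Qx L M N D ≤ pos M * (count cZ + count cX)
    bound-Y = subst₂ _≤_ (cong (pos 4 *_) Qy≡Qx) (cong (pos M *_) (cong₂ _+_ (Σ³-zxy _) (Σ³-zxy _))) R′.bound

    bound-Z : pos 4 * Qx L M N D ≤ pos N * (count cX + count cY)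
    bound-Z = subst₂ _≤_ (cong (pos 4 *_) (sym Qx≡Qz)) (cong (pos N *_) (cong₂ _+_ (Σ³-yzx _) (Σ³-yzx _))) R″.bound

-- The twist as a quarter of the integer form `Qx`.

module Twist where

  open Sums
  open Helicity using (Field; sg)
  open Partner
  open import Data.Bool using (Bool; true; false; _∧_; _∨_; not; if_then_else_) renaming (T to IsTrue)
  open import Data.Bool.Properties using (∧-zeroʳ)
  open import Data.Nat as ℕ using (ℕ; zero; suc; _≡ᵇ_; _<ᵇ_)
  import Data.Nat.Properties as ℕP
  import Data.Nat.Divisibility as ℕD
  open import Data.Integer as ℤ using (ℤ; +≤+; +<+; -_; _+_; _*_; _-_; 0ℤ; 1ℤ; -1ℤ) renaming (+_ to pos)
  open import Data.Integer.Properties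
  open import Data.Integer.Tactic.RingSolver using (solve-∀)
  open import Data.Product using (_×_; _,_; ∃; proj₁; proj₂)
  open import Data.Sum using (_⊎_; inj₁; inj₂)
  open import Data.Empty using (⊥-elim)
  open import Data.List using (List; []; _∷_; map; lookup)
  open import Data.List.Relation.Unary.All as All using (All; []; _∷_)
  import Data.Fin as Fin
  open import Data.List.Membership.Propositional.Properties using (∈-lookup)
  open import Data.Rational as ℚ using (ℚ)
  import Data.Rational.Properties as ℚP
  open import Data.Rational.Unnormalised using (mkℚᵘ; _≃_; *≡*)
  import Data.Rational.Unnormalised.Properties as ℚᵘP
  open import Relation.Nullary using (Dec; yes; no; ¬_)
  open import Relation.Nullary.Decidable using (⌊_⌋)
  open import Relation.Binary.PropositionalEquality
  open ≡-Reasoning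

  pt : Pos → Cube
  pt (x , y , z) = cube (pos x) (pos y) (pos z)

  pt-injective : ∀ {p q} → pt p ≡ pt q → p ≡ q
  pt-injective refl = refl

  cube-≡ : ∀ {a b c a′ b′ c′} → a ≡ a′ → b ≡ b′ → c ≡ c′ → cube a b c ≡ cube a′ b′ c′
  cube-≡ refl refl refl = refl

  x+1 : ∀ x → pos (x ℕ.+ 1) ≡ pos (suc x)
  x+1 x = cong pos (ℕP.+-comm x 1)

  x+0 : ∀ x → pos (x ℕ.+ 0) ≡ pos x
  x+0 x = cong pos (ℕP.+-identityʳ x)

  Nb⇒black : ∀ {p d q} → Nb p d q → pt p +³ vec d ≡ pt q
  Nb⇒black n+x = cube-≡ (x+1 _) (x+0 _) (x+0 _)
  Nb⇒black n-x = cube-≡ refl (x+0 _) (x+0 _)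
  Nb⇒black n+y = cube-≡ (x+0 _) (x+1 _) (x+0 _)
  Nb⇒black n-y = cube-≡ (x+0 _) refl (x+0 _)
  Nb⇒black n+z = cube-≡ (x+0 _) (x+0 _) (x+1 _)
  Nb⇒black n-z = cube-≡ (x+0 _) (x+0 _) refl

  black⇒Nb : ∀ {p} d {q} → pt p +³ vec d ≡ pt q → Nb p d q
  black⇒Nb +x e with refl ← pt-injective (trans (sym e) (Nb⇒black n+x)) = n+x
  black⇒Nb {suc x , _} -x e with refl ← pt-injective (trans (sym e) (Nb⇒black n-x)) = n-x
  black⇒Nb {zero , _} -x ()
  black⇒Nb +y e with refl ← pt-injective (trans (sym e) (Nb⇒black n+y)) = n+y
  black⇒Nb {_ , suc y , _} -y e with refl ← pt-injective (trans (sym e) (Nb⇒black n-y)) = n-y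
  black⇒Nb {_ , zero , _} -y ()
  black⇒Nb +z e with refl ← pt-injective (trans (sym e) (Nb⇒black n+z)) = n+z
  black⇒Nb {_ , _ , suc z} -z e with refl ← pt-injective (trans (sym e) (Nb⇒black n-z)) = n-z
  black⇒Nb {_ , _ , zero} -z ()

  InBox⇒In : ∀ {L M N} c → InBox L M N c → ∃ λ p → c ≡ pt p × In L M N p
  InBox⇒In (cube (pos a) (pos b) (pos c)) ((_ , +<+ l) , (_ , +<+ m) , (_ , +<+ n)) =
    (a , b , c) , refl , l , m , n
  InBox⇒In (cube ℤ.-[1+ _ ] _ _) ((() , _) , _)
  InBox⇒In (cube (pos _) ℤ.-[1+ _ ] _) (_ , (() , _) , _)
  InBox⇒In (cube (pos _) (pos _) ℤ.-[1+ _ ]) (_ , _ , (() , _))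

  In⇒InBox : ∀ {L M N} p → In L M N p → InBox L M N (pt p)
  In⇒InBox _ (l , m , n) = (+≤+ ℕ.z≤n , +<+ l) , (+≤+ ℕ.z≤n , +<+ m) , (+≤+ ℕ.z≤n , +<+ n)

  ind : Bool → ℤ
  ind true  = 1ℤ
  ind false = 0ℤ

  ind-∧ : ∀ a b → ind (a ∧ b) ≡ ind a * ind b
  ind-∧ true b = sym (*-identityˡ (ind b))
  ind-∧ false b = refl

  ⌊⌋-≡ : ∀ {P : Set} (d : Dec P) (b : Bool) → (P → IsTrue b) → (IsTrue b → P) → ⌊ d ⌋ ≡ b
  ⌊⌋-≡ (yes p) true f g = refl
  ⌊⌋-≡ (yes p) false f g = ⊥-elim (f p)
  ⌊⌋-≡ (no n) true f g = ⊥-elim (n (g _))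
  ⌊⌋-≡ (no n) false f g = refl

  ≟-≡ᵇ : ∀ m n → ⌊ pos m ≟ pos n ⌋ ≡ (m ≡ᵇ n)
  ≟-≡ᵇ m n = ⌊⌋-≡ (pos m ≟ pos n) (m ≡ᵇ n) (λ e → ℕP.≡⇒≡ᵇ m n (+-injective e)) (λ t → cong pos (ℕP.≡ᵇ⇒≡ m n t))

  ray : Pos → Pos → Bool
  ray (x , y , z) (x′ , y′ , z′) = (y ≡ᵇ y′) ∧ (z ≡ᵇ z′) ∧ (x <ᵇ x′)

  inRay-ray : ∀ p q → inRay +x (pt p) (pt q) ≡ ray p q
  inRay-ray (x , y , z) (x′ , y′ , z′) = begin
    (⌊ X ≟ k * 1ℤ ⌋ ∧ ⌊ Y ≟ k * 0ℤ ⌋ ∧ ⌊ Z ≟ k * 0ℤ ⌋) ∧ ⌊ 1ℤ ≤? k ⌋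
      ≡⟨ cong (λ k → (⌊ X ≟ k * 1ℤ ⌋ ∧ ⌊ Y ≟ k * 0ℤ ⌋ ∧ ⌊ Z ≟ k * 0ℤ ⌋) ∧ ⌊ 1ℤ ≤? k ⌋) (h X Y Z) ⟩
    (⌊ X ≟ X * 1ℤ ⌋ ∧ ⌊ Y ≟ X * 0ℤ ⌋ ∧ ⌊ Z ≟ X * 0ℤ ⌋) ∧ ⌊ 1ℤ ≤? X ⌋
      ≡⟨ cong₂ _∧_ (cong₂ _∧_ (⌊⌋-≡ (X ≟ X * 1ℤ) true _ λ _ → sym (*-identityʳ X))
           (cong₂ _∧_ (zero-diff y y′) (zero-diff z z′))) less ⟩
    ((y ≡ᵇ y′) ∧ (z ≡ᵇ z′)) ∧ (x <ᵇ x′)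
      ≡⟨ assoc (y ≡ᵇ y′) ⟩
    ray (x , y , z) (x′ , y′ , z′) ∎
    where
    X Y Z k : ℤ
    X = pos x′ - pos x
    Y = pos y′ - pos y
    Z = pos z′ - pos z
    k = X * 1ℤ + Y * 0ℤ + Z * 0ℤ
    h : ∀ a b c → a * 1ℤ + b * 0ℤ + c * 0ℤ ≡ a
    h = solve-∀
    zero-diff : ∀ m n → ⌊ (pos n - pos m) ≟ X * 0ℤ ⌋ ≡ (m ≡ᵇ n)
    zero-diff m n = ⌊⌋-≡ ((pos n - pos m) ≟ X * 0ℤ) (m ≡ᵇ n)
      (λ e → ℕP.≡⇒≡ᵇ m n (sym (+-injective (i-j≡0⇒i≡j (pos n) (pos m) (trans e (*-zeroʳ X))))))
      (λ t → trans (i≡j⇒i-j≡0 (cong pos (sym (ℕP.≡ᵇ⇒≡ m n t)))) (sym (*-zeroʳ X)))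
    less : ⌊ 1ℤ ≤? X ⌋ ≡ (x <ᵇ x′)
    less = ⌊⌋-≡ (1ℤ ≤? X) (x <ᵇ x′)
      (λ e → ℕP.<⇒<ᵇ (drop‿+<+ (0<i-j⇒j<i e)))
      (λ t → i<j⇒0<j-i (+<+ (ℕP.<ᵇ⇒< x x′ t)))
      where
      0<i-j⇒j<i : 1ℤ ℤ.≤ X → pos x ℤ.< pos x′
      0<i-j⇒j<i e = subst₂ ℤ._<_ (+-identityʳ (pos x)) (h₂ (pos x) (pos x′))
        (+-monoʳ-< (pos x) (suc[i]≤j⇒i<j {0ℤ} {X} e))
        where
        h₂ : ∀ a b → a + (b - a) ≡ b
        h₂ = solve-∀
      i<j⇒0<j-i : pos x ℤ.< pos x′ → 1ℤ ℤ.≤ X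
      i<j⇒0<j-i e = subst (ℤ._≤ X) (h₂ (pos x)) (+-monoˡ-≤ (- pos x) (i<j⇒suc[i]≤j e))
        where
        h₂ : ∀ a → 1ℤ + a - a ≡ 1ℤ
        h₂ = solve-∀
    assoc : ∀ a {b c} → (a ∧ b) ∧ c ≡ a ∧ b ∧ c
    assoc true = refl
    assoc false = refl

  eq³ : Pos → Pos → Bool
  eq³ (x , y , z) (x′ , y′ , z′) = (x ≡ᵇ x′) ∧ (y ≡ᵇ y′) ∧ (z ≡ᵇ z′)

  ==³-eq³ : ∀ p q → (pt p ==³ pt q) ≡ eq³ p q
  ==³-eq³ (x , y , z) (x′ , y′ , z′) = cong₂ _∧_ (≟-≡ᵇ x x′) (cong₂ _∧_ (≟-≡ᵇ y y′) (≟-≡ᵇ z z′))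

  δ-ind : ∀ m n → δ m n ≡ ind (m ≡ᵇ n)
  δ-ind zero zero = refl
  δ-ind zero (suc n) = refl
  δ-ind (suc m) zero = refl
  δ-ind (suc m) (suc n) = δ-ind m n

  ≡ᵇ-false : ∀ m n → m ≢ n → (m ≡ᵇ n) ≡ false
  ≡ᵇ-false m n ne with m ≡ᵇ n in e
  ... | false = refl
  ... | true = ⊥-elim (ne (ℕP.≡ᵇ⇒≡ m n (subst IsTrue (sym e) _)))

  <ᵇ-false : ∀ m n → ¬ m ℕ.< n → (m <ᵇ n) ≡ false
  <ᵇ-false m n ne with m <ᵇ n in e
  ... | false = refl
  ... | true = ⊥-elim (ne (ℕP.<ᵇ⇒< m n (subst IsTrue (sym e) _)))

  <ᵇ-true : ∀ m n → m ℕ.< n → (m <ᵇ n) ≡ true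
  <ᵇ-true m n lt with m <ᵇ n in e
  ... | true = refl
  ... | false = ⊥-elim (subst IsTrue e (ℕP.<⇒<ᵇ lt))

  ind-< : ∀ a n → Σ< n (λ i → δ i a) ≡ ind (a <ᵇ n)
  ind-< a n with a ℕP.<? n
  ... | yes lt = trans (trans (Σ-cong′ n λ i → sym (*-identityʳ (δ i a))) (Σ-δ n a (λ _ → 1ℤ) lt)) (cong ind (sym (<ᵇ-true a n lt)))
  ... | no ge = trans (trans (Σ-cong′ n λ i → sym (*-identityʳ (δ i a))) (Σ-δ-≥ n a (λ _ → 1ℤ) (ℕP.≮⇒≥ ge))) (cong ind (sym (<ᵇ-false a n ge)))

  Meets : Pos → Pos → Pos → Pos → Bool
  Meets w₀ b₀ w₁ b₁ =
    ((ray w₀ w₁ ∨ ray b₀ w₁) ∧ not (eq³ w₁ w₀ ∨ eq³ w₁ b₀)) ∨ ((ray w₀ b₁ ∨ ray b₀ b₁) ∧ not (eq³ b₁ w₀ ∨ eq³ b₁ b₀))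

  Count : Pos → Pos → Pos → Pos → ℤ
  Count w₀ b₀ w₁ b₁ = ind (ray w₀ w₁) + ind (ray b₀ w₁) + (ind (ray w₀ b₁) + ind (ray b₀ b₁))

  -- Perpendicular dominoes project to segments with at most one common unit square.
  or-exclusive : ∀ p p′ q q′ → p ∧ p′ ≡ false → q ∧ q′ ≡ false →
    ind ((((p ∧ q ∧ true) ∨ (p ∧ q′ ∧ true)) ∧ true) ∨ (((p′ ∧ q ∧ true) ∨ (p′ ∧ q′ ∧ true)) ∧ true))
    ≡ ind (p ∧ q ∧ true) + ind (p ∧ q′ ∧ true) + (ind (p′ ∧ q ∧ true) + ind (p′ ∧ q′ ∧ true))
  or-exclusive false false q q′ e f = refl
  or-exclusive false true false false e f = refl
  or-exclusive false true false true e f = refl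
  or-exclusive false true true false e f = refl
  or-exclusive true false false false e f = refl
  or-exclusive true false false true e f = refl
  or-exclusive true false true false e f = refl

  or-exclusive′ : ∀ p p′ q q′ → p ∧ p′ ≡ false → q ∧ q′ ≡ false →
    ind ((((p ∧ q ∧ true) ∨ (p′ ∧ q ∧ true)) ∧ true) ∨ (((p ∧ q′ ∧ true) ∨ (p′ ∧ q′ ∧ true)) ∧ true))
    ≡ ind (p ∧ q ∧ true) + ind (p′ ∧ q ∧ true) + (ind (p ∧ q′ ∧ true) + ind (p′ ∧ q′ ∧ true))
  or-exclusive′ false false q q′ e f = refl
  or-exclusive′ false true false false e f = refl
  or-exclusive′ false true false true e f = refl
  or-exclusive′ false true true false e f = refl
  or-exclusive′ true false false false e f = refl
  or-exclusive′ true false false true e f = refl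
  or-exclusive′ true false true false e f = refl

  ≡ᵇ-exclusiveʳ : ∀ a {b b′} → b ≢ b′ → (a ≡ᵇ b) ∧ (a ≡ᵇ b′) ≡ false
  ≡ᵇ-exclusiveʳ a {b} {b′} ne with a ≡ᵇ b in e | a ≡ᵇ b′ in e′
  ... | false | _ = refl
  ... | true | false = refl
  ... | true | true = ⊥-elim (ne (trans (sym (ℕP.≡ᵇ⇒≡ a b (subst IsTrue (sym e) _))) (ℕP.≡ᵇ⇒≡ a b′ (subst IsTrue (sym e′) _))))

  ≡ᵇ-exclusiveˡ : ∀ a {b b′} → b ≢ b′ → (b ≡ᵇ a) ∧ (b′ ≡ᵇ a) ≡ false
  ≡ᵇ-exclusiveˡ a {b} {b′} ne with b ≡ᵇ a in e | b′ ≡ᵇ a in e′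
  ... | false | _ = refl
  ... | true | false = refl
  ... | true | true = ⊥-elim (ne (trans (ℕP.≡ᵇ⇒≡ b a (subst IsTrue (sym e) _)) (sym (ℕP.≡ᵇ⇒≡ b′ a (subst IsTrue (sym e′) _)))))

  meets-zy : ∀ i j a c c′ b b′ e → c ≢ c′ → b ≢ b′ →
    ind (Meets (i , a , c) (i , a , c′) (j , b , e) (j , b′ , e)) ≡ Count (i , a , c) (i , a , c′) (j , b , e) (j , b′ , e)
  meets-zy i j a c c′ b b′ e nc nb with i ℕP.<? j
  ... | yes lt rewrite <ᵇ-true i j lt | ≡ᵇ-false j i (ℕP.>⇒≢ lt) =
    or-exclusive (a ≡ᵇ b) (a ≡ᵇ b′) (c ≡ᵇ e) (c′ ≡ᵇ e) (≡ᵇ-exclusiveʳ a nb) (≡ᵇ-exclusiveˡ e nc)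
  ... | no ge rewrite <ᵇ-false i j ge
      | ∧-zeroʳ (c ≡ᵇ e) | ∧-zeroʳ (c′ ≡ᵇ e) | ∧-zeroʳ (a ≡ᵇ b) | ∧-zeroʳ (a ≡ᵇ b′) = refl

  meets-yz : ∀ i j a a′ c b e e′ → a ≢ a′ → e ≢ e′ →
    ind (Meets (i , a , c) (i , a′ , c) (j , b , e) (j , b , e′)) ≡ Count (i , a , c) (i , a′ , c) (j , b , e) (j , b , e′)
  meets-yz i j a a′ c b e e′ na ne with i ℕP.<? j
  ... | yes lt rewrite <ᵇ-true i j lt | ≡ᵇ-false j i (ℕP.>⇒≢ lt) =
    or-exclusive′ (a ≡ᵇ b) (a′ ≡ᵇ b) (c ≡ᵇ e) (c ≡ᵇ e′) (≡ᵇ-exclusiveˡ b na) (≡ᵇ-exclusiveʳ c ne)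
  ... | no ge rewrite <ᵇ-false i j ge
      | ∧-zeroʳ (c ≡ᵇ e) | ∧-zeroʳ (c ≡ᵇ e′) | ∧-zeroʳ (a ≡ᵇ b) | ∧-zeroʳ (a′ ≡ᵇ b) = refl

  detYZ : Dir → Dir → ℤ
  detYZ d₁ d₀ = cY d₁ * cZ d₀ - cZ d₁ * cY d₀

  det³-x : ∀ d₁ d₀ → det³ (vec d₁) (vec d₀) (vec +x) ≡ detYZ d₁ d₀
  det³-x d₁ d₀ = h (cX d₁) (cX d₀) (cY d₁) (cZ d₁) (cY d₀) (cZ d₀)
    where
    h : ∀ a b p q r s → a * (r * 0ℤ - s * 0ℤ) - b * (p * 0ℤ - q * 0ℤ) + 1ℤ * (p * s - q * r) ≡ p * s - q * r
    h = solve-∀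

  n≢suc : ∀ {n} → n ≢ suc n
  n≢suc ()

  -- A nonzero determinant forces one domino along y and the other along z. Then at most one of the
  -- four pairs of cells lies on a common ray, so the disjunction is a sum, and a cell strictly
  -- further along x cannot belong to the first domino.
  parallel-or-count : ∀ {w₀ b₀ w₁ b₁ d₀ d₁} → Nb w₁ d₁ b₁ → Nb w₀ d₀ b₀ →
    detYZ d₁ d₀ ≡ 0ℤ ⊎ ind (Meets w₀ b₀ w₁ b₁) ≡ Count w₀ b₀ w₁ b₁
  parallel-or-count n+x _ = inj₁ refl
  parallel-or-count n-x _ = inj₁ refl
  parallel-or-count n+y n+x = inj₁ refl
  parallel-or-count n+y n-x = inj₁ refl
  parallel-or-count n+y n+y = inj₁ refl
  parallel-or-count n+y n-y = inj₁ refl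
  parallel-or-count (n+y {j} {b} {e}) (n+z {i} {a} {c}) = inj₂ (meets-zy i j a c (suc c) b (suc b) e n≢suc n≢suc)
  parallel-or-count (n+y {j} {b} {e}) (n-z {i} {a} {c}) = inj₂ (meets-zy i j a (suc c) c b (suc b) e (≢-sym n≢suc) n≢suc)
  parallel-or-count n-y n+x = inj₁ refl
  parallel-or-count n-y n-x = inj₁ refl
  parallel-or-count n-y n+y = inj₁ refl
  parallel-or-count n-y n-y = inj₁ refl
  parallel-or-count (n-y {j} {b} {e}) (n+z {i} {a} {c}) = inj₂ (meets-zy i j a c (suc c) (suc b) b e n≢suc (≢-sym n≢suc))
  parallel-or-count (n-y {j} {b} {e}) (n-z {i} {a} {c}) = inj₂ (meets-zy i j a (suc c) c (suc b) b e (≢-sym n≢suc) (≢-sym n≢suc))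
  parallel-or-count n+z n+x = inj₁ refl
  parallel-or-count n+z n-x = inj₁ refl
  parallel-or-count (n+z {j} {b} {e}) (n+y {i} {a} {c}) = inj₂ (meets-yz i j a (suc a) c b e (suc e) n≢suc n≢suc)
  parallel-or-count (n+z {j} {b} {e}) (n-y {i} {a} {c}) = inj₂ (meets-yz i j (suc a) a c b e (suc e) (≢-sym n≢suc) n≢suc)
  parallel-or-count n+z n+z = inj₁ refl
  parallel-or-count n+z n-z = inj₁ refl
  parallel-or-count n-z n+x = inj₁ refl
  parallel-or-count n-z n-x = inj₁ refl
  parallel-or-count (n-z {j} {b} {e}) (n+y {i} {a} {c}) = inj₂ (meets-yz i j a (suc a) c b (suc e) e n≢suc (≢-sym n≢suc))
  parallel-or-count (n-z {j} {b} {e}) (n-y {i} {a} {c}) = inj₂ (meets-yz i j (suc a) a c b (suc e) e (≢-sym n≢suc) (≢-sym n≢suc))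
  parallel-or-count n-z n+z = inj₁ refl
  parallel-or-count n-z n-z = inj₁ refl

  record Placed (L M N : ℕ) (d : Domino) : Set where
    field
      w b     : Pos
      w-in    : In L M N w
      b-in    : In L M N b
      nb      : Nb w (dir d) b
      white≡  : white d ≡ pt w

    black≡ : black d ≡ pt b
    black≡ = trans (cong (_+³ vec (dir d)) white≡) (Nb⇒black nb)

  τℤ : Domino → Domino → ℤ
  τℤ d₀ d₁ = if meetsShadow +x d₀ d₁ then detYZ (dir d₁) (dir d₀) else 0ℤ

  module _ {L M N : ℕ} where

    open Placed

    meets-Meets : ∀ {d₀ d₁} (p₀ : Placed L M N d₀) (p₁ : Placed L M N d₁) →
      meetsShadow +x d₀ d₁ ≡ Meets (w p₀) (b p₀) (w p₁) (b p₁)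
    meets-Meets p₀ p₁ = at (white≡ p₀) (black≡ p₀) (white≡ p₁) (black≡ p₁)
      where
      at : ∀ {w₀′ b₀′ w₁′ b₁′ w₀ b₀ w₁ b₁} → w₀′ ≡ pt w₀ → b₀′ ≡ pt b₀ → w₁′ ≡ pt w₁ → b₁′ ≡ pt b₁ →
        ((inRay +x w₀′ w₁′ ∨ inRay +x b₀′ w₁′) ∧ not ((w₁′ ==³ w₀′) ∨ (w₁′ ==³ b₀′)))
        ∨ ((inRay +x w₀′ b₁′ ∨ inRay +x b₀′ b₁′) ∧ not ((b₁′ ==³ w₀′) ∨ (b₁′ ==³ b₀′)))
        ≡ Meets w₀ b₀ w₁ b₁
      at {w₀ = w₀} {b₀} {w₁} {b₁} refl refl refl refl = cong₂ _∨_
        (cong₂ _∧_ (cong₂ _∨_ (inRay-ray w₀ w₁) (inRay-ray b₀ w₁))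
          (cong not (cong₂ _∨_ (==³-eq³ w₁ w₀) (==³-eq³ w₁ b₀))))
        (cong₂ _∧_ (cong₂ _∨_ (inRay-ray w₀ b₁) (inRay-ray b₀ b₁))
          (cong not (cong₂ _∨_ (==³-eq³ b₁ w₀) (==³-eq³ b₁ b₀))))

    τℤ-count : ∀ {d₀ d₁} (p₀ : Placed L M N d₀) (p₁ : Placed L M N d₁) →
      τℤ d₀ d₁ ≡ detYZ (dir d₁) (dir d₀) * Count (w p₀) (b p₀) (w p₁) (b p₁)
    τℤ-count {d₀} {d₁} p₀ p₁ rewrite meets-Meets p₀ p₁ with parallel-or-count (nb p₁) (nb p₀)
    ... | inj₂ e = trans (h (Meets (w p₀) (b p₀) (w p₁) (b p₁)) _) (cong (detYZ (dir d₁) (dir d₀) *_) e)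
      where
      h : ∀ c a → (if c then a else 0ℤ) ≡ a * ind c
      h true a = sym (*-identityʳ a)
      h false a = sym (*-zeroʳ a)
    ... | inj₁ e rewrite e = h (Meets (w p₀) (b p₀) (w p₁) (b p₁))
      where
      h : ∀ c → (if c then 0ℤ else 0ℤ) ≡ 0ℤ
      h true = refl
      h false = refl

  cell : Pos → Field
  cell (a , b , c) x y z = δ x a * (δ y b * δ z c)

  δ-sym : ∀ m n → δ m n ≡ δ n m
  δ-sym zero zero = refl
  δ-sym zero (suc n) = refl
  δ-sym (suc m) zero = refl
  δ-sym (suc m) (suc n) = δ-sym m n

  module _ (L M N : ℕ) where

    Σ-cell : ∀ {q} (f : Field) → In L M N q →
      Σ< M (λ y → Σ< N λ z → Σ< L λ x → cell q x y z * f x y z) ≡ f (proj₁ q) (proj₁ (proj₂ q)) (proj₂ (proj₂ q))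
    Σ-cell {a , b , c} f (la , lb , lc) = begin
      Σ< M (λ y → Σ< N λ z → Σ< L λ x → δ x a * (δ y b * δ z c) * f x y z)
        ≡⟨ Σ-cong′ M (λ y → Σ-cong′ N λ z → trans (Σ-cong′ L λ x → *-assoc (δ x a) _ _) (Σ-δ L a _ la)) ⟩
      Σ< M (λ y → Σ< N λ z → δ y b * δ z c * f a y z)
        ≡⟨ Σ-cong′ M (λ y → trans (Σ-cong′ N λ z → h (δ y b) (δ z c) (f a y z)) (Σ-δ N c (λ z → δ y b * f a y z) lc)) ⟩
      Σ< M (λ y → δ y b * f a y c)
        ≡⟨ Σ-δ M b _ lb ⟩
      f a b c ∎
      where
      h : ∀ p q r → p * q * r ≡ q * (p * r)
      h = solve-∀

    Σ-ray : ∀ q₀ q₁ → In L M N q₁ →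
      Σ< M (λ y → Σ< N λ z → Σ< L λ j → cell q₁ j y z * Σ< j (λ i → cell q₀ i y z)) ≡ ind (ray q₀ q₁)
    Σ-ray q₀@(a , b , c) q₁@(a′ , b′ , c′) i₁ = begin
      _ ≡⟨ Σ-cell (λ j y z → Σ< j (λ i → cell q₀ i y z)) i₁ ⟩
      Σ< a′ (λ i → δ i a * (δ b′ b * δ c′ c))
        ≡⟨ Σ-*ʳ a′ (δ b′ b * δ c′ c) (λ i → δ i a) ⟩
      Σ< a′ (λ i → δ i a) * (δ b′ b * δ c′ c)
        ≡⟨ cong₂ _*_ (ind-< a a′) (cong₂ _*_ (trans (δ-sym b′ b) (δ-ind b b′)) (trans (δ-sym c′ c) (δ-ind c c′))) ⟩
      ind (a <ᵇ a′) * (ind (b ≡ᵇ b′) * ind (c ≡ᵇ c′))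
        ≡⟨ h (ind (a <ᵇ a′)) (ind (b ≡ᵇ b′)) (ind (c ≡ᵇ c′)) ⟩
      ind (b ≡ᵇ b′) * (ind (c ≡ᵇ c′) * ind (a <ᵇ a′))
        ≡⟨ trans (ind-∧ (b ≡ᵇ b′) _) (cong (ind (b ≡ᵇ b′) *_) (ind-∧ (c ≡ᵇ c′) _)) ⟨
      ind (ray q₀ q₁) ∎
      where
      h : ∀ p q r → p * (q * r) ≡ q * (r * p)
      h = solve-∀

    occ : Pos → Pos → Field
    occ w b x y z = cell w x y z + cell b x y z

    Σ³-+ : ∀ (f g : Field) → Σ< M (λ y → Σ< N λ z → Σ< L λ x → f x y z + g x y z)
      ≡ Σ< M (λ y → Σ< N λ z → Σ< L λ x → f x y z) + Σ< M (λ y → Σ< N λ z → Σ< L λ x → g x y z)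
    Σ³-+ f g = trans (Σ-cong′ M λ y → trans (Σ-cong′ N λ z → Σ-+ L _ _) (Σ-+ N _ _)) (Σ-+ M _ _)

    Σ-occ : ∀ w₀ b₀ w₁ b₁ → In L M N w₁ → In L M N b₁ →
      Σ< M (λ y → Σ< N λ z → Σ< L λ j → occ w₁ b₁ j y z * Σ< j (λ i → occ w₀ b₀ i y z)) ≡ Count w₀ b₀ w₁ b₁
    Σ-occ w₀ b₀ w₁ b₁ iw ib = begin
      Σ< M (λ y → Σ< N λ z → Σ< L λ j → occ w₁ b₁ j y z * Σ< j (λ i → occ w₀ b₀ i y z))
        ≡⟨ Σ-cong′ M (λ y → Σ-cong′ N λ z → Σ-cong′ L λ j → trans (cong (occ w₁ b₁ j y z *_) (Σ-+ j _ _))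
             (h (cell w₁ j y z) (cell b₁ j y z) (Σ< j (λ i → cell w₀ i y z)) (Σ< j (λ i → cell b₀ i y z)))) ⟩
      Σ< M (λ y → Σ< N λ z → Σ< L λ j → R w₀ w₁ j y z + R b₀ w₁ j y z + (R w₀ b₁ j y z + R b₀ b₁ j y z))
        ≡⟨ trans (Σ³-+ _ _) (cong₂ _+_ (Σ³-+ _ _) (Σ³-+ _ _)) ⟩
      _ ≡⟨ cong₂ _+_ (cong₂ _+_ (Σ-ray w₀ w₁ iw) (Σ-ray b₀ w₁ iw)) (cong₂ _+_ (Σ-ray w₀ b₁ ib) (Σ-ray b₀ b₁ ib)) ⟩
      Count w₀ b₀ w₁ b₁ ∎
      where
      R : Pos → Pos → Field
      R q₀ q₁ j y z = cell q₁ j y z * Σ< j (λ i → cell q₀ i y z)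
      h : ∀ a b c d → (a + b) * (c + d) ≡ a * c + a * d + (b * c + b * d)
      h = solve-∀

    -- The bilinear form whose diagonal is Qx.
    Form : (f₁ g₁ f₀ g₀ : Field) → ℤ
    Form f₁ g₁ f₀ g₀ = Σ< M λ y → Σ< N λ z → Σ< L λ j →
      f₁ j y z * Σ< j (λ i → g₀ i y z) - g₁ j y z * Σ< j (λ i → f₀ i y z)

    -- The share of a single domino in the field w: the same component of v(d) on both of its cells
    -- and zero elsewhere.
    fld : (Dir → ℤ) → Domino → Field
    fld c d x y z = (ind (pt (x , y , z) ==³ white d) + ind (pt (x , y , z) ==³ black d)) * c (dir d)

    ind-eq³ : ∀ q x y z → ind (eq³ (x , y , z) q) ≡ cell q x y z
    ind-eq³ (a , b , c) x y z = trans (ind-∧ (x ≡ᵇ a) _) (cong₂ _*_ (sym (δ-ind x a))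
      (trans (ind-∧ (y ≡ᵇ b) _) (cong₂ _*_ (sym (δ-ind y b)) (sym (δ-ind z c)))))

    fld-occ : ∀ c {d} (p : Placed L M N d) x y z →
      fld c d x y z ≡ occ (Placed.w p) (Placed.b p) x y z * c (dir d)
    fld-occ c {d} p x y z = at (Placed.white≡ p) (Placed.black≡ p)
      where
      at : ∀ {w′ b′ w b} → w′ ≡ pt w → b′ ≡ pt b →
        (ind (pt (x , y , z) ==³ w′) + ind (pt (x , y , z) ==³ b′)) * c (dir d) ≡ occ w b x y z * c (dir d)
      at {w = w} {b} refl refl = cong (_* c (dir d)) (cong₂ _+_
        (trans (cong ind (==³-eq³ (x , y , z) w)) (ind-eq³ w x y z))
        (trans (cong ind (==³-eq³ (x , y , z) b)) (ind-eq³ b x y z)))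

    -- Once shadows are counted cell by cell, the contribution of two dominoes is bilinear in their
    -- fields. Summing over all ordered pairs therefore evaluates the form at the total field, and
    -- the individual dominoes disappear.
    τℤ-Form : ∀ {d₀ d₁} → Placed L M N d₀ → Placed L M N d₁ →
      τℤ d₀ d₁ ≡ Form (fld cY d₁) (fld cZ d₁) (fld cY d₀) (fld cZ d₀)
    τℤ-Form {d₀} {d₁} p₀ p₁ = sym (begin
      Form (fld cY d₁) (fld cZ d₁) (fld cY d₀) (fld cZ d₀)
        ≡⟨ Σ-cong′ M (λ y → Σ-cong′ N λ z → Σ-cong′ L λ j → cong₂ _-_
            (cong₂ _*_ (fld-occ cY p₁ j y z) (trans (Σ-cong′ j λ i → fld-occ cZ p₀ i y z) (Σ-*ʳ j _ _)))
            (cong₂ _*_ (fld-occ cZ p₁ j y z) (trans (Σ-cong′ j λ i → fld-occ cY p₀ i y z) (Σ-*ʳ j _ _)))) ⟩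
      Σ< M (λ y → Σ< N λ z → Σ< L λ j →
        o₁ j y z * cY (dir d₁) * (Σ< j (λ i → o₀ i y z) * cZ (dir d₀)) - o₁ j y z * cZ (dir d₁) * (Σ< j (λ i → o₀ i y z) * cY (dir d₀)))
        ≡⟨ Σ-cong′ M (λ y → Σ-cong′ N λ z → Σ-cong′ L λ j →
             h (o₁ j y z) (Σ< j (λ i → o₀ i y z)) (cY (dir d₁)) (cZ (dir d₀)) (cZ (dir d₁)) (cY (dir d₀))) ⟩
      Σ< M (λ y → Σ< N λ z → Σ< L λ j → detYZ (dir d₁) (dir d₀) * (o₁ j y z * Σ< j (λ i → o₀ i y z)))
        ≡⟨ trans (Σ-cong′ M λ y → trans (Σ-cong′ N λ z → Σ-*ˡ L dt _) (Σ-*ˡ N dt _)) (Σ-*ˡ M dt _) ⟩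
      detYZ (dir d₁) (dir d₀) * Σ< M (λ y → Σ< N λ z → Σ< L λ j → o₁ j y z * Σ< j (λ i → o₀ i y z))
        ≡⟨ cong (detYZ (dir d₁) (dir d₀) *_) (Σ-occ _ _ _ _ (Placed.w-in p₁) (Placed.b-in p₁)) ⟩
      detYZ (dir d₁) (dir d₀) * Count (Placed.w p₀) (Placed.b p₀) (Placed.w p₁) (Placed.b p₁)
        ≡⟨ τℤ-count p₀ p₁ ⟨
      τℤ d₀ d₁ ∎)
      where
      dt : ℤ
      dt = detYZ (dir d₁) (dir d₀)
      o₁ o₀ : Field
      o₁ = occ (Placed.w p₁) (Placed.b p₁)
      o₀ = occ (Placed.w p₀) (Placed.b p₀)
      h : ∀ o s a b c d → o * a * (s * b) - o * c * (s * d) ≡ (a * b - c * d) * (o * s)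
      h = solve-∀

  module _ {A : Set} where

    ΣL : List A → (A → ℤ) → ℤ
    ΣL [] f = 0ℤ
    ΣL (a ∷ t) f = f a + ΣL t f

    ΣL-cong : ∀ {P : A → Set} {t f g} → All P t → (∀ {a} → P a → f a ≡ g a) → ΣL t f ≡ ΣL t g
    ΣL-cong [] e = refl
    ΣL-cong (p ∷ ps) e = cong₂ _+_ (e p) (ΣL-cong ps e)

    ΣL-Σ< : ∀ t n (f : A → ℕ → ℤ) → ΣL t (λ a → Σ< n (f a)) ≡ Σ< n (λ i → ΣL t (λ a → f a i))
    ΣL-Σ< [] n f = sym (Σ-zero n)
    ΣL-Σ< (a ∷ t) n f = trans (cong (Σ< n (f a) +_) (ΣL-Σ< t n f)) (sym (Σ-+ n _ _))

    ΣL-*ˡ : ∀ t c f → ΣL t (λ a → c * f a) ≡ c * ΣL t f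
    ΣL-*ˡ [] c f = sym (*-zeroʳ c)
    ΣL-*ˡ (a ∷ t) c f = trans (cong (c * f a +_) (ΣL-*ˡ t c f)) (sym (*-distribˡ-+ c (f a) (ΣL t f)))

    ΣL-- : ∀ t f g → ΣL t (λ a → f a - g a) ≡ ΣL t f - ΣL t g
    ΣL-- [] f g = refl
    ΣL-- (a ∷ t) f g = trans (cong (f a - g a +_) (ΣL-- t f g)) (h (f a) (g a) (ΣL t f) (ΣL t g))
      where
      h : ∀ a b c d → a - b + (c - d) ≡ (a + c) - (b + d)
      h = solve-∀

    ΣL-zero : ∀ t f → (∀ i → f (lookup t i) ≡ 0ℤ) → ΣL t f ≡ 0ℤ
    ΣL-zero [] f e = refl
    ΣL-zero (a ∷ t) f e rewrite e Fin.zero | ΣL-zero t f (λ i → e (Fin.suc i)) = refl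

    ΣL-only : ∀ t f i → (∀ j → j ≢ i → f (lookup t j) ≡ 0ℤ) → ΣL t f ≡ f (lookup t i)
    ΣL-only (a ∷ t) f Fin.zero e rewrite ΣL-zero t f (λ j → e (Fin.suc j) λ ()) = +-identityʳ (f a)
    ΣL-only (a ∷ t) f (Fin.suc i) e rewrite e Fin.zero (λ ())
      | ΣL-only t f i (λ j ne → e (Fin.suc j) λ { refl → ne refl }) = +-identityˡ _

  ΣL-bilinear : ∀ {A B : Set} (s : List A) (t : List B) (u v : B → ℤ) (U V : A → ℤ) →
    ΣL s (λ a → ΣL t (λ b → u b * V a - v b * U a)) ≡ ΣL t u * ΣL s V - ΣL t v * ΣL s U
  ΣL-bilinear s t u v U V = begin
    ΣL s (λ a → ΣL t (λ b → u b * V a - v b * U a))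
      ≡⟨ ext s (λ a → trans (ΣL-- t _ _) (cong₂ _-_ (right t u (V a)) (right t v (U a)))) ⟩
    ΣL s (λ a → ΣL t u * V a - ΣL t v * U a)
      ≡⟨ trans (ΣL-- s _ _) (cong₂ _-_ (ΣL-*ˡ s (ΣL t u) V) (ΣL-*ˡ s (ΣL t v) U)) ⟩
    ΣL t u * ΣL s V - ΣL t v * ΣL s U ∎
    where
    ext : ∀ {A : Set} (s : List A) {f g : A → ℤ} → (∀ a → f a ≡ g a) → ΣL s f ≡ ΣL s g
    ext [] e = refl
    ext (a ∷ s) e = cong₂ _+_ (e a) (ext s e)
    right : ∀ {A : Set} (s : List A) (f : A → ℤ) c → ΣL s (λ a → f a * c) ≡ ΣL s f * c
    right s f c = trans (ext s λ a → *-comm (f a) c) (trans (ΣL-*ˡ s c f) (*-comm c (ΣL s f)))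

  Area-Σ : ∀ n u v → Area n u v ≡ Σ< n (λ j → u j * Σ< j v - v j * Σ< j u)
  Area-Σ zero u v = refl
  Area-Σ (suc n) u v = cong (_+ (u n * Σ< n v - v n * Σ< n u)) (Area-Σ n u v)

  module _ (L M N : ℕ) where

    W : (Dir → ℤ) → List Domino → Field
    W c t x y z = ΣL t λ d → fld L M N c d x y z

    Στℤ : ∀ t → All (Placed L M N) t →
      ΣL t (λ d₀ → ΣL t (λ d₁ → τℤ d₀ d₁)) ≡ Σ< M (λ y → Σ< N λ z → Area L (λ x → W cY t x y z) (λ x → W cZ t x y z))
    Στℤ t ps = begin
      ΣL t (λ d₀ → ΣL t (λ d₁ → τℤ d₀ d₁))
        ≡⟨ ΣL-cong ps (λ {d₀} p₀ → trans (ΣL-cong ps λ p₁ → τℤ-Form L M N p₀ p₁) (commute λ d₁ x y z → term d₁ d₀ x y z)) ⟩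
      ΣL t (λ d₀ → Σ< M λ y → Σ< N λ z → Σ< L λ x → ΣL t λ d₁ → term d₁ d₀ x y z)
        ≡⟨ commute (λ d₀ x y z → ΣL t λ d₁ → term d₁ d₀ x y z) ⟩
      Σ< M (λ y → Σ< N λ z → Σ< L λ x → ΣL t λ d₀ → ΣL t λ d₁ → term d₁ d₀ x y z)
        ≡⟨ Σ-cong′ M (λ y → Σ-cong′ N λ z → trans (Σ-cong′ L λ x → trans
             (ΣL-bilinear t t (λ d → fld L M N cY d x y z) (λ d → fld L M N cZ d x y z)
               (λ d → Σ< x (λ i → fld L M N cY d i y z)) (λ d → Σ< x (λ i → fld L M N cZ d i y z)))
             (cong₂ _-_ (cong (W cY t x y z *_) (ΣL-Σ< t x _)) (cong (W cZ t x y z *_) (ΣL-Σ< t x _))))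
             (sym (Area-Σ L (λ x → W cY t x y z) (λ x → W cZ t x y z)))) ⟩
      Σ< M (λ y → Σ< N λ z → Area L (λ x → W cY t x y z) (λ x → W cZ t x y z)) ∎
      where
      term : Domino → Domino → Field
      term d₁ d₀ x y z = fld L M N cY d₁ x y z * Σ< x (λ i → fld L M N cZ d₀ i y z)
        - fld L M N cZ d₁ x y z * Σ< x (λ i → fld L M N cY d₀ i y z)
      commute : ∀ (f : Domino → Field) →
        ΣL t (λ d → Σ< M λ y → Σ< N λ z → Σ< L λ x → f d x y z) ≡ Σ< M (λ y → Σ< N λ z → Σ< L λ x → ΣL t λ d → f d x y z)
      commute f = trans (ΣL-Σ< t M _) (Σ-cong′ M λ y → trans (ΣL-Σ< t N _) (Σ-cong′ N λ z → ΣL-Σ< t L _))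

  sg-even : ∀ {n} → 2 ℕD.∣ n → sg n ≡ 1ℤ
  sg-even (ℕD.divides q refl) = go q
    where
    go : ∀ q → sg (q ℕ.* 2) ≡ 1ℤ
    go zero = refl
    go (suc q) = trans (neg-involutive _) (go q)

  color-Nb : ∀ {p d q} → Nb p d q → sg (proj₁ q ℕ.+ proj₁ (proj₂ q) ℕ.+ proj₂ (proj₂ q)) ≡
    - sg (proj₁ p ℕ.+ proj₁ (proj₂ p) ℕ.+ proj₂ (proj₂ p))
  color-Nb n+x = refl
  color-Nb n-x = sym (neg-involutive _)
  color-Nb (n+y {x} {y} {z}) rewrite ℕP.+-suc x y = refl
  color-Nb (n-y {x} {y} {z}) rewrite ℕP.+-suc x y = sym (neg-involutive _)
  color-Nb (n+z {x} {y} {z}) rewrite ℕP.+-suc (x ℕ.+ y) z = refl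
  color-Nb (n-z {x} {y} {z}) rewrite ℕP.+-suc (x ℕ.+ y) z = sym (neg-involutive _)

  Compatible : (Pos → Dir) → Domino → Set
  Compatible D d = (∀ p → pt p ≡ white d → D p ≡ dir d) × (∀ p → pt p ≡ black d → D p ≡ opp (dir d))

  ==³-true : ∀ {p q} → pt p ≡ pt q → (pt p ==³ pt q) ≡ true
  ==³-true {p@(x , y , z)} refl = trans (==³-eq³ p p) (cong₂ _∧_ (r x) (cong₂ _∧_ (r y) (r z)))
    where
    r : ∀ n → (n ≡ᵇ n) ≡ true
    r zero = refl
    r (suc n) = r n

  eq³-sound : ∀ p q → eq³ p q ≡ true → p ≡ q
  eq³-sound (x , y , z) (x′ , y′ , z′) t with x ≡ᵇ x′ in ex | y ≡ᵇ y′ in ey | z ≡ᵇ z′ in ez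
  ... | true | true | true = cong₂ _,_ (ℕP.≡ᵇ⇒≡ x x′ (subst IsTrue (sym ex) _))
    (cong₂ _,_ (ℕP.≡ᵇ⇒≡ y y′ (subst IsTrue (sym ey) _)) (ℕP.≡ᵇ⇒≡ z z′ (subst IsTrue (sym ez) _)))
  eq³-sound _ _ () | false | _ | _
  eq³-sound _ _ () | true | false | _
  eq³-sound _ _ () | true | true | false

  ==³-false : ∀ p q → p ≢ q → (pt p ==³ pt q) ≡ false
  ==³-false p q ne = trans (==³-eq³ p q) (go (eq³ p q) refl)
    where
    go : ∀ b → eq³ p q ≡ b → b ≡ false
    go false _ = refl
    go true e = ⊥-elim (ne (eq³-sound p q e))

  Nb-≢ : ∀ {p d q} → Nb p d q → p ≢ q
  Nb-≢ n+x ()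
  Nb-≢ n-x ()
  Nb-≢ n+y ()
  Nb-≢ n-y ()
  Nb-≢ n+z ()
  Nb-≢ n-z ()

  placed : ∀ {L M N d} → IsWhite (white d) × InBox L M N (white d) × InBox L M N (black d) → Placed L M N d
  placed {d = d} (_ , iw , ib) with InBox⇒In (white d) iw | InBox⇒In (black d) ib
  ... | w , ew , w-in | b , eb , b-in = record
    { w = w ; b = b ; w-in = w-in ; b-in = b-in ; white≡ = ew
    ; nb = black⇒Nb (dir d) (trans (cong (_+³ vec (dir d)) (sym ew)) eb) }

  module _ {L M N : ℕ} where

    open Placed

    fld-outside : ∀ c {d} (p : Placed L M N d) q → ¬ (pt q ∈ᵈ d) → fld L M N c d (proj₁ q) (proj₁ (proj₂ q)) (proj₂ (proj₂ q)) ≡ 0ℤ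
    fld-outside c {d} p q ne
      rewrite trans (cong (pt q ==³_) (white≡ p)) (==³-false q (w p) λ { refl → ne (inj₁ (sym (white≡ p))) })
            | trans (cong (pt q ==³_) (black≡ p)) (==³-false q (b p) λ { refl → ne (inj₂ (sym (black≡ p))) }) = refl

    fld-inside : ∀ c (c-opp : ∀ e → c (opp e) ≡ - c e) {d D} (p : Placed L M N d) → IsWhite (white d) → Compatible D d →
      ∀ q → pt q ∈ᵈ d → fld L M N c d (proj₁ q) (proj₁ (proj₂ q)) (proj₂ (proj₂ q))
        ≡ color (proj₁ q) (proj₁ (proj₂ q)) (proj₂ (proj₂ q)) * c (D q)
    fld-inside c c-opp {d} {D} p iw (cw , cb) q (inj₁ e)
      rewrite trans (cong (pt q ==³_) (white≡ p)) (==³-true {q} {w p} (trans e (white≡ p)))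
            | trans (cong (pt q ==³_) (black≡ p)) (==³-false q (b p) λ { refl → Nb-≢ (nb p) (pt-injective (sym (trans e (white≡ p)))) })
            | cw q e
            | sg-even {proj₁ q ℕ.+ proj₁ (proj₂ q) ℕ.+ proj₂ (proj₂ q)} (subst IsWhite (sym e) iw) = refl
    fld-inside c c-opp {d} {D} p iw (cw , cb) q (inj₂ e)
      rewrite trans (cong (pt q ==³_) (black≡ p)) (==³-true {q} {b p} (trans e (black≡ p)))
            | trans (cong (pt q ==³_) (white≡ p)) (==³-false q (w p) λ { refl → Nb-≢ (nb p) (pt-injective (trans e (black≡ p))) })
            | cb q e
            | pt-injective (trans e (black≡ p))
            | color-Nb (nb p)
            | sg-even {proj₁ (w p) ℕ.+ proj₁ (proj₂ (w p)) ℕ.+ proj₂ (proj₂ (w p))} (subst IsWhite (white≡ p) iw)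
            | c-opp (dir d) = h (c (dir d))
      where
      h : ∀ a → (0ℤ + 1ℤ) * a ≡ -1ℤ * - a
      h = solve-∀

    -- Exactly one domino of the tiling covers the cell, so one term of the sum survives;
    -- `Compatible` identifies it with the direction map.
    W-color : ∀ c (c-opp : ∀ e → c (opp e) ≡ - c e) {t D} → IsTiling L M N t → All (Compatible D) t →
      ∀ x y z → In L M N (x , y , z) → W L M N c t x y z ≡ color x y z * c (D (x , y , z))
    W-color c c-opp {t} {D} (valid , cover) comp x y z q-in with cover (pt (x , y , z)) (In⇒InBox (x , y , z) q-in)
    ... | i , mem , uniq = trans
      (ΣL-only t _ i λ j ne → fld-outside c (placed (All.lookup valid (∈-lookup j))) (x , y , z) λ m → ne (uniq j m))
      (fld-inside c c-opp {D = D} (placed (All.lookup valid (∈-lookup i))) (proj₁ (All.lookup valid (∈-lookup i)))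
        (All.lookup comp (∈-lookup i)) (x , y , z) mem)

    Στℤ≡Qx : ∀ {t D} → IsTiling L M N t → All (Compatible D) t → ΣL t (λ d₀ → ΣL t (λ d₁ → τℤ d₀ d₁)) ≡ Qx L M N D
    Στℤ≡Qx {t} {D} til@(valid , _) comp = trans (Στℤ L M N t (All.map placed valid))
      (Σ-cong M λ y ly → Σ-cong N λ z lz → Area-cong L
        (λ x lx → W-color cY cY-opp til comp x y z (lx , ly , lz))
        (λ x lx → W-color cZ cZ-opp til comp x y z (lx , ly , lz)))

  quarter : ℤ → ℚ
  quarter n = n ℚ./ 4

  quarter-≃ : ∀ n → ℚ.toℚᵘ (quarter n) ≃ mkℚᵘ n 3
  quarter-≃ n = ℚP.toℚᵘ-fromℚᵘ (mkℚᵘ n 3)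

  quarter-+ : ∀ m n → quarter m ℚ.+ quarter n ≡ quarter (m + n)
  quarter-+ m n = ℚP.toℚᵘ-injective (ℚᵘP.≃-trans (ℚP.toℚᵘ-homo-+ (quarter m) (quarter n))
    (ℚᵘP.≃-trans (ℚᵘP.+-cong (quarter-≃ m) (quarter-≃ n))
      (ℚᵘP.≃-trans (*≡* (h m n)) (ℚᵘP.≃-sym (quarter-≃ (m + n))))))
    where
    h : ∀ m n → (m * pos 4 + n * pos 4) * pos 4 ≡ (m + n) * pos 16
    h = solve-∀

  sumℚ-quarter : ∀ {A : Set} (t : List A) {f : A → ℚ} {g} → (∀ a → f a ≡ quarter (g a)) → sumℚ (map f t) ≡ quarter (ΣL t g)
  sumℚ-quarter [] e = refl
  sumℚ-quarter (a ∷ t) {f} {g} e = trans (cong₂ ℚ._+_ (e a) (sumℚ-quarter t e)) (quarter-+ (g a) (ΣL t g))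

  τ-quarter : ∀ d₀ d₁ → τ +x d₀ d₁ ≡ quarter (τℤ d₀ d₁)
  τ-quarter d₀ d₁ with meetsShadow +x d₀ d₁
  ... | true = cong quarter (det³-x (dir d₁) (dir d₀))
  ... | false = refl

  Tw≡Qx : ∀ {L M N t D} → IsTiling L M N t → All (Compatible D) t → Tw t ≡ quarter (Qx L M N D)
  Tw≡Qx {t = t} til comp = trans (sumℚ-quarter t λ d₀ → sumℚ-quarter t (τ-quarter d₀)) (cong quarter (Στℤ≡Qx til comp))

-- Lists of dominoes versus direction maps, and existence of the maximum.

module Conversion where

  open Sums
  open Helicity using (sg)
  open Partner
  open Twist
  open import Data.Nat as ℕ using (ℕ; zero; suc)
  import Data.Nat.Properties as ℕP
  import Data.Nat.Divisibility as ℕD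
  open import Data.Integer as ℤ using (ℤ; -_; _≤_; 1ℤ; -1ℤ)
  import Data.Integer.Properties as ℤP
  open import Data.Product using (Σ; _×_; _,_; ∃; proj₁; proj₂)
  open import Data.Sum using (_⊎_; inj₁; inj₂)
  open import Data.Empty using (⊥; ⊥-elim)
  open import Data.List using (List; _∷_; map; filter; lookup; upTo; cartesianProduct)
  open import Data.List.Relation.Unary.All as All using (All; _∷_)
  import Data.List.Relation.Unary.All.Properties as AllP
  open import Data.List.Relation.Unary.Any using (index)
  open import Data.List.Relation.Unary.Any.Properties using (lookup-index)
  open import Data.List.Relation.Unary.AllPairs using (_∷_)
  open import Data.List.Relation.Unary.Unique.Propositional using (Unique)
  import Data.List.Relation.Unary.Unique.Propositional.Properties as UniqueP
  open import Data.List.Membership.Propositional using (_∈_)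
  open import Data.List.Membership.Propositional.Properties
    using (∈-lookup; ∈-upTo⁺; ∈-upTo⁻; ∈-cartesianProduct⁺; ∈-cartesianProduct⁻; ∈-filter⁺; ∈-filter⁻; ∈-map⁺; ∈-map⁻)
  open import Data.Fin as Fin using (Fin)
  import Data.Fin.Properties as FinP
  open import Relation.Nullary using (Dec; yes; no)
  open import Relation.Nullary.Decidable using (map′; _×-dec_)
  open import Relation.Binary.PropositionalEquality

  Nb-sym : ∀ {p d q} → Nb p d q → Nb q (opp d) p
  Nb-sym n+x = n-x
  Nb-sym n-x = n+x
  Nb-sym n+y = n-y
  Nb-sym n-y = n+y
  Nb-sym n+z = n-z
  Nb-sym n-z = n+z

  Nb-functional : ∀ {p d q q′} → Nb p d q → Nb p d q′ → q ≡ q′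
  Nb-functional n+x n+x = refl
  Nb-functional n-x n-x = refl
  Nb-functional n+y n+y = refl
  Nb-functional n-y n-y = refl
  Nb-functional n+z n+z = refl
  Nb-functional n-z n-z = refl

  opp-involutive : ∀ d → opp (opp d) ≡ d
  opp-involutive = by-dir refl refl refl refl refl refl

  In? : ∀ L M N p → Dec (In L M N p)
  In? L M N (x , y , z) = (x ℕP.<? L) ×-dec (y ℕP.<? M) ×-dec (z ℕP.<? N)

  module FromList {L M N t} (til : IsTiling L M N t) where

    private
      valid = proj₁ til
      cover = proj₂ til

      place : ∀ i → Placed L M N (lookup t i)
      place i = placed (All.lookup valid (∈-lookup i))

    towards : ∀ {c} d → c ∈ᵈ d → Dir
    towards d (inj₁ _) = dir d
    towards d (inj₂ _) = opp (dir d)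

    partner : ∀ p → Dec (In L M N p) → Dir
    partner p (yes p-in) = towards (lookup t (proj₁ (cover (pt p) (In⇒InBox p p-in)))) (proj₁ (proj₂ (cover (pt p) (In⇒InBox p p-in))))
    -- Outside the box any direction serves, because `Valid` and `Qx` look only inside.
    partner p (no _) = +x

    D : Pos → Dir
    D p = partner p (In? L M N p)

    towards-unique : ∀ i {c} (m m′ : c ∈ᵈ lookup t i) → towards (lookup t i) m ≡ towards (lookup t i) m′
    towards-unique i (inj₁ _) (inj₁ _) = refl
    towards-unique i (inj₂ _) (inj₂ _) = refl
    towards-unique i (inj₁ e) (inj₂ e′) = ⊥-elim (Nb-≢ (Placed.nb (place i)) (pt-injective
      (trans (sym (Placed.white≡ (place i))) (trans (sym e) (trans e′ (Placed.black≡ (place i)))))))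
    towards-unique i (inj₂ e′) (inj₁ e) = ⊥-elim (Nb-≢ (Placed.nb (place i)) (pt-injective
      (trans (sym (Placed.white≡ (place i))) (trans (sym e) (trans e′ (Placed.black≡ (place i)))))))

    D-towards : ∀ i p → In L M N p → (m : pt p ∈ᵈ lookup t i) → D p ≡ towards (lookup t i) m
    D-towards i p p-in m with In? L M N p
    ... | no ne = ⊥-elim (ne p-in)
    ... | yes p-in′ = same {i} (proj₂ (proj₂ (cover (pt p) (In⇒InBox p p-in′))) i m) m (proj₁ (proj₂ (cover (pt p) (In⇒InBox p p-in′))))
      where
      same : ∀ {i k c} → i ≡ k → (m : c ∈ᵈ lookup t i) (m′ : c ∈ᵈ lookup t k) → towards (lookup t k) m′ ≡ towards (lookup t i) m
      same {i} refl m m′ = towards-unique i m′ m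

    compatible : All (Compatible D) t
    compatible = All.tabulate λ {d} d∈t → subst (Compatible D) (sym (lookup-index d∈t)) (at (index d∈t))
      where
      at : ∀ i → Compatible D (lookup t i)
      at i = (λ p e → D-towards i p (subst (In L M N) (pt-injective (trans (sym (Placed.white≡ (place i))) (sym e))) (Placed.w-in (place i))) (inj₁ e))
           , (λ p e → D-towards i p (subst (In L M N) (pt-injective (trans (sym (Placed.black≡ (place i))) (sym e))) (Placed.b-in (place i))) (inj₂ e))

    D-valid : Valid (In L M N) D
    D-valid p p-in with cover (pt p) (In⇒InBox p p-in)
    ... | i , inj₁ e , _ with place i
    ...   | P@record { w = w ; b = b ; b-in = b-in ; nb = nb ; white≡ = white≡ } with pt-injective {p} {w} (trans e white≡)
    ...     | refl = b , subst (λ d → Nb p d b) (sym Dp) nb , b-in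
                   , trans (D-towards i b b-in (inj₂ (sym (Placed.black≡ P)))) (cong opp (sym Dp))
      where
      Dp : D p ≡ dir (lookup t i)
      Dp = D-towards i p p-in (inj₁ e)
    D-valid p p-in | i , inj₂ e , _ with place i
    ...   | P@record { w = w ; b = b ; w-in = w-in ; nb = nb ; white≡ = white≡ } with pt-injective {p} {b} (trans e (Placed.black≡ P))
    ...     | refl = w , subst (λ d → Nb p d w) (sym Dp) (Nb-sym nb) , w-in
                   , trans (D-towards i w w-in (inj₁ (sym white≡))) (trans (sym (opp-involutive _)) (cong opp (sym Dp)))
      where
      Dp : D p ≡ opp (dir (lookup t i))
      Dp = D-towards i p p-in (inj₂ e)

  parity : ∀ n → (2 ℕD.∣ n × sg n ≡ 1ℤ) ⊎ sg n ≡ -1ℤ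
  parity zero = inj₁ (2 ℕD.∣0 , refl)
  parity (suc zero) = inj₂ refl
  parity (suc (suc n)) with parity n
  ... | inj₁ (d , e) = inj₁ (ℕD.∣m∣n⇒∣m+n (ℕD.divides 1 refl) d , trans (ℤP.neg-involutive (sg n)) e)
  ... | inj₂ e = inj₂ (trans (ℤP.neg-involutive (sg n)) e)

  sgn : Pos → ℤ
  sgn (x , y , z) = sg (x ℕ.+ y ℕ.+ z)

  lookup-injective : ∀ {A : Set} {xs : List A} → Unique xs → ∀ i j → lookup xs i ≡ lookup xs j → i ≡ j
  lookup-injective (px ∷ u) Fin.zero Fin.zero e = refl
  lookup-injective (px ∷ u) Fin.zero (Fin.suc j) e = ⊥-elim (All.lookup px (∈-lookup j) e)
  lookup-injective (px ∷ u) (Fin.suc i) Fin.zero e = ⊥-elim (All.lookup px (∈-lookup i) (sym e))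
  lookup-injective (px ∷ u) (Fin.suc i) (Fin.suc j) e = cong Fin.suc (lookup-injective u i j e)

  module ToList {L M N D} (v : Valid (In L M N) D) where

    cells : List Pos
    cells = cartesianProduct (upTo L) (cartesianProduct (upTo M) (upTo N))

    whites : List Pos
    whites = filter (λ p → sgn p ℤP.≟ 1ℤ) cells

    dom : Pos → Domino
    dom p = domino (pt p) (D p)

    tiling : List Domino
    tiling = map dom whites

    whites⁻ : ∀ {p} → p ∈ whites → In L M N p × sgn p ≡ 1ℤ
    whites⁻ {p} m with ∈-filter⁻ (λ p → sgn p ℤP.≟ 1ℤ) {xs = cells} m
    ... | m′ , e with ∈-cartesianProduct⁻ (upTo L) (cartesianProduct (upTo M) (upTo N)) m′
    ...   | mx , m″ with ∈-cartesianProduct⁻ (upTo M) (upTo N) m″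
    ...     | my , mz = (∈-upTo⁻ mx , ∈-upTo⁻ my , ∈-upTo⁻ mz) , e

    whites⁺ : ∀ {p} → In L M N p → sgn p ≡ 1ℤ → p ∈ whites
    whites⁺ (lx , ly , lz) e = ∈-filter⁺ (λ p → sgn p ℤP.≟ 1ℤ)
      (∈-cartesianProduct⁺ (∈-upTo⁺ lx) (∈-cartesianProduct⁺ (∈-upTo⁺ ly) (∈-upTo⁺ lz))) e

    unique : Unique tiling
    unique = UniqueP.map⁺ (λ e → pt-injective (cong white e)) (UniqueP.filter⁺ (λ p → sgn p ℤP.≟ 1ℤ)
      (UniqueP.cartesianProduct⁺ (UniqueP.upTo⁺ L) (UniqueP.cartesianProduct⁺ (UniqueP.upTo⁺ M) (UniqueP.upTo⁺ N))))

    white-black : ∀ {p q} → sgn p ≡ 1ℤ → sgn q ≡ - sgn p → sgn q ≢ 1ℤ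
    white-black e f g with trans (sym g) (trans f (cong -_ e))
    ... | ()

    -- A domino is represented by its white cell, so a white cell represents itself and a black cell
    -- is represented by its partner; adjacent cells have opposite colours, which excludes any other
    -- representative.
    base : ∀ p → In L M N p → ∃ λ w → w ∈ whites × pt p ∈ᵈ dom w × (∀ w′ → w′ ∈ whites → pt p ∈ᵈ dom w′ → w′ ≡ w)
    base p p-in with v p p-in
    ... | q , nb , q-in , opposite with sgn p ℤP.≟ 1ℤ
    ...   | yes e = p , whites⁺ p-in e , inj₁ refl , λ
      { w′ m (inj₁ f) → sym (pt-injective f)
      ; w′ m (inj₂ f) → ⊥-elim (black≢ w′ m f) }
      where
      black≢ : ∀ w′ → w′ ∈ whites → pt p ≡ black (dom w′) → ⊥
      black≢ w′ m f with whites⁻ m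
      ... | w-in , e′ with v w′ w-in
      ...   | r , nb′ , _ , _ with pt-injective {p} {r} (trans f (Nb⇒black nb′))
      ...     | refl = white-black {w′} {p} e′ (color-Nb nb′) e
    ...   | no ne = q , whites⁺ q-in qe
      , inj₂ (sym (trans (cong (λ d → pt q +³ vec d) opposite) (Nb⇒black (Nb-sym nb))))
      , λ { w′ m (inj₁ f) → ⊥-elim (ne (trans (cong sgn (pt-injective f)) (proj₂ (whites⁻ m))))
          ; w′ m (inj₂ f) → from w′ m f }
      where
      odd : sgn p ≡ -1ℤ
      odd with parity (proj₁ p ℕ.+ proj₁ (proj₂ p) ℕ.+ proj₂ (proj₂ p))
      ... | inj₁ (_ , e) = ⊥-elim (ne e)
      ... | inj₂ e = e
      qe : sgn q ≡ 1ℤ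
      qe = trans (color-Nb nb) (cong -_ odd)
      from : ∀ w′ → w′ ∈ whites → pt p ≡ black (dom w′) → w′ ≡ q
      from w′ m f with v w′ (proj₁ (whites⁻ m))
      ... | r , nb′ , _ , o′ with pt-injective {p} {r} (trans f (Nb⇒black nb′))
      ...   | refl = Nb-functional (subst (λ d → Nb p d w′) (sym o′) (Nb-sym nb′)) nb

    is-tiling : IsTiling L M N tiling
    is-tiling = AllP.map⁺ (All.tabulate good) , cover
      where
      good : ∀ {p} → p ∈ whites → IsWhite (white (dom p)) × InBox L M N (white (dom p)) × InBox L M N (black (dom p))
      good {p} m with whites⁻ m
      ... | p-in , e with v p p-in | parity (proj₁ p ℕ.+ proj₁ (proj₂ p) ℕ.+ proj₂ (proj₂ p))
      ...   | q , nb , q-in , _ | inj₁ (two , _) = two , In⇒InBox p p-in , subst (InBox L M N) (sym (Nb⇒black nb)) (In⇒InBox q q-in)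
      ...   | _ | inj₂ o with trans (sym e) o
      ...     | ()
      cover : ∀ c → InBox L M N c → Σ (Fin _) λ i → (c ∈ᵈ lookup tiling i) × (∀ j → c ∈ᵈ lookup tiling j → j ≡ i)
      cover c c-in with InBox⇒In c c-in
      ... | p , refl , p-in with base p p-in
      ...   | w , w∈ , p∈w , uniq = index m , subst (pt p ∈ᵈ_) (lookup-index m) p∈w , λ j p∈j → lookup-injective unique j (index m) (same j p∈j)
        where
        m : dom w ∈ tiling
        m = ∈-map⁺ dom w∈
        same : ∀ j → pt p ∈ᵈ lookup tiling j → lookup tiling j ≡ lookup tiling (index m)
        same j p∈j with ∈-map⁻ dom (∈-lookup {xs = tiling} j)
        ... | w′ , w′∈ , e = trans e (trans (cong dom (uniq w′ w′∈ (subst (pt p ∈ᵈ_) e p∈j))) (lookup-index m))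

    compatible : All (Compatible D) tiling
    compatible = AllP.map⁺ (All.tabulate λ {p} m → (λ q e → cong D (pt-injective e)) , at m)
      where
      at : ∀ {p} → p ∈ whites → ∀ q → pt q ≡ black (dom p) → D q ≡ opp (D p)
      at {p} m q e with v p (proj₁ (whites⁻ m))
      ... | r , nb , _ , o with pt-injective {q} {r} (trans e (Nb⇒black nb))
      ...   | refl = o

  Qx-cong : ∀ {L M N D D′} → (∀ p → In L M N p → D p ≡ D′ p) → Qx L M N D ≡ Qx L M N D′
  Qx-cong {L} {M} {N} e = Σ-cong M λ y ly → Σ-cong N λ z lz → Area-cong L
    (λ x lx → cong (λ d → color x y z ℤ.* cY d) (e (x , y , z) (lx , ly , lz)))
    (λ x lx → cong (λ d → color x y z ℤ.* cZ d) (e (x , y , z) (lx , ly , lz)))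

  Valid-cong : ∀ {L M N D D′} → (∀ p → In L M N p → D p ≡ D′ p) → Valid (In L M N) D → Valid (In L M N) D′
  Valid-cong e v p p-in with v p p-in
  ... | q , nb , q-in , o = q , subst (λ d → Nb p d q) (e p p-in) nb , q-in
    , trans (sym (e q q-in)) (trans o (cong opp (e p p-in)))

  toF : Dir → Fin 6
  toF +x = Fin.zero
  toF -x = Fin.suc Fin.zero
  toF +y = Fin.suc (Fin.suc Fin.zero)
  toF -y = Fin.suc (Fin.suc (Fin.suc Fin.zero))
  toF +z = Fin.suc (Fin.suc (Fin.suc (Fin.suc Fin.zero)))
  toF -z = Fin.suc (Fin.suc (Fin.suc (Fin.suc (Fin.suc Fin.zero))))

  fromF : Fin 6 → Dir
  fromF Fin.zero = +x
  fromF (Fin.suc Fin.zero) = -x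
  fromF (Fin.suc (Fin.suc Fin.zero)) = +y
  fromF (Fin.suc (Fin.suc (Fin.suc Fin.zero))) = -y
  fromF (Fin.suc (Fin.suc (Fin.suc (Fin.suc Fin.zero)))) = +z
  fromF (Fin.suc (Fin.suc (Fin.suc (Fin.suc (Fin.suc Fin.zero))))) = -z

  fromF-toF : ∀ d → fromF (toF d) ≡ d
  fromF-toF = by-dir refl refl refl refl refl refl

  _≟ᴰ_ : (d e : Dir) → Dec (d ≡ e)
  d ≟ᴰ e = map′ (λ q → trans (sym (fromF-toF d)) (trans (cong fromF q) (fromF-toF e))) (cong toF) (toF d FinP.≟ toF e)

  step : ∀ p d → Dec (∃ (Nb p d))
  step p +x = yes (_ , n+x)
  step (suc x , _) -x = yes (_ , n-x)
  step (zero , _) -x = no λ { (_ , ()) }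
  step p +y = yes (_ , n+y)
  step (_ , suc y , _) -y = yes (_ , n-y)
  step (_ , zero , _) -y = no λ { (_ , ()) }
  step p +z = yes (_ , n+z)
  step (_ , _ , suc z) -z = yes (_ , n-z)
  step (_ , _ , zero) -z = no λ { (_ , ()) }

  Valid? : ∀ L M N D → Dec (Valid (In L M N) D)
  Valid? L M N D = map′
    (λ f p (lx , ly , lz) → f lx ly lz)
    (λ f {x} lx {y} ly {z} lz → f (x , y , z) (lx , ly , lz))
    (ℕP.allUpTo? (λ x → ℕP.allUpTo? (λ y → ℕP.allUpTo? (λ z → at (x , y , z)) N) M) L)
    where
    at : ∀ p → Dec (∃ λ q → Nb p (D p) q × In L M N q × D q ≡ opp (D p))
    at p with step p (D p)
    ... | no ne = no λ (q , nb , _) → ne (q , nb)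
    ... | yes (q , nb) = map′ (λ (i , o) → q , nb , i , o) (λ (q′ , nb′ , i , o) → subst (λ r → In L M N r × D r ≡ opp (D p)) (Nb-functional nb′ nb) (i , o))
      (In? L M N q ×-dec (D q ≟ᴰ opp (D p)))

  argmax : ∀ n {P : Fin n → Set} → (∀ i → Dec (P i)) → (f : Fin n → ℤ) → ∃ P →
    ∃ λ i → P i × ∀ j → P j → f j ≤ f i
  argmax zero P? f (() , _)
  argmax (suc n) {P} P? f w with FinP.any? (λ i → P? (Fin.suc i))
  ... | no none = first w
    where
    first : ∃ P → ∃ λ i → P i × ∀ j → P j → f j ≤ f i
    first (Fin.zero , p) = Fin.zero , p , λ { Fin.zero _ → ℤP.≤-refl ; (Fin.suc j) q → ⊥-elim (none (j , q)) }
    first (Fin.suc i , p) = ⊥-elim (none (i , p))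
  ... | yes some with argmax n (λ i → P? (Fin.suc i)) (λ i → f (Fin.suc i)) some
  ...   | i , p , best with P? Fin.zero | f Fin.zero ℤP.≤? f (Fin.suc i)
  ...     | no np | _ = Fin.suc i , p , λ { Fin.zero q → ⊥-elim (np q) ; (Fin.suc j) q → best j q }
  ...     | yes _ | yes le = Fin.suc i , p , λ { Fin.zero _ → le ; (Fin.suc j) q → best j q }
  ...     | yes q₀ | no gt = Fin.zero , q₀ , λ { Fin.zero _ → ℤP.≤-refl ; (Fin.suc j) q → ℤP.≤-trans (best j q) (ℤP.<⇒≤ (ℤP.≰⇒> gt)) }

  module _ (L M N : ℕ) where

    pos-code : ∀ p → In L M N p → Fin (L ℕ.* (M ℕ.* N))
    pos-code (x , y , z) (lx , ly , lz) = Fin.combine (Fin.fromℕ< lx) (Fin.combine (Fin.fromℕ< ly) (Fin.fromℕ< lz))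

    coords : Fin L × (Fin M × Fin N) → Pos
    coords (x , y , z) = Fin.toℕ x , Fin.toℕ y , Fin.toℕ z

    pos-decode : Fin (L ℕ.* (M ℕ.* N)) → Pos
    pos-decode i = split (Fin.remQuot {L} (M ℕ.* N) i)
      where
      split : Fin L × Fin (M ℕ.* N) → Pos
      split (x , j) = coords (x , Fin.remQuot {M} N j)

    pos-decode-code : ∀ p (i : In L M N p) → pos-decode (pos-code p i) ≡ p
    pos-decode-code (x , y , z) (lx , ly , lz) = trans
      (cong (λ r → coords (proj₁ r , Fin.remQuot {M} N (proj₂ r)))
        (FinP.remQuot-combine {L} {M ℕ.* N} (Fin.fromℕ< lx) (Fin.combine (Fin.fromℕ< ly) (Fin.fromℕ< lz))))
      (trans (cong (λ r → coords (Fin.fromℕ< lx , r)) (FinP.remQuot-combine {M} {N} (Fin.fromℕ< ly) (Fin.fromℕ< lz)))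
        (cong₂ _,_ (FinP.toℕ-fromℕ< lx) (cong₂ _,_ (FinP.toℕ-fromℕ< ly) (FinP.toℕ-fromℕ< lz))))

    decode : Fin (6 ℕ.^ (L ℕ.* (M ℕ.* N))) → Pos → Dir
    decode k p with In? L M N p
    ... | yes i = fromF (Fin.finToFun k (pos-code p i))
    ... | no _  = +x

    code : (Pos → Dir) → Fin (6 ℕ.^ (L ℕ.* (M ℕ.* N)))
    code D = Fin.funToFin (λ k → toF (D (pos-decode k)))

    decode-code : ∀ D p → In L M N p → D p ≡ decode (code D) p
    decode-code D p i with In? L M N p
    ... | no ne = ⊥-elim (ne i)
    ... | yes i = sym (trans (cong fromF (FinP.finToFun-funToFin (λ k → toF (D (pos-decode k))) (pos-code p i)))
      (trans (fromF-toF _) (cong D (pos-decode-code p i))))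

    -- Restricted to the box, direction maps form a finite set, coded by the numbers below 6 to the
    -- power LMN, and validity is decidable; a finite search therefore yields the maximum. A map and
    -- its decoded code agree only inside the box, which is enough for `Valid` and `Qx`.
    best : ∃ (Valid (In L M N)) → ∃ λ D → Valid (In L M N) D × ∀ D′ → Valid (In L M N) D′ → Qx L M N D′ ≤ Qx L M N D
    best (D₀ , v₀) with argmax _ (λ k → Valid? L M N (decode k)) (λ k → Qx L M N (decode k)) (code D₀ , Valid-cong (decode-code D₀) v₀)
    ... | k , v , b = decode k , v , λ D′ v′ → subst (_≤ Qx L M N (decode k)) (sym (Qx-cong (decode-code D′)))
      (b (code D′) (Valid-cong (decode-code D′) v′))

-- Lower bounds for the twist under reflections, permutations of the axes and gluing.

module Achievable where

  open Sums
  open Helicity using (sg)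
  open Partner
  open import Data.Nat as ℕ using (ℕ; suc)
  import Data.Nat.Properties as ℕP
  open import Data.Integer as ℤ using (ℤ; -_; _+_; _*_; _≤_; 0ℤ) renaming (+_ to pos)
  open import Data.Integer.Properties
  open import Data.Integer.Tactic.RingSolver using (solve-∀)
  open import Data.Product using (_×_; _,_; ∃; proj₁; proj₂)
  open import Data.Sum using (inj₁; inj₂)
  open import Data.Empty using (⊥-elim)
  open import Relation.Nullary using (Dec; yes; no)
  open import Relation.Binary.PropositionalEquality

  -- Witness of a tiling of twist at least `k`; the factor 4 is that of `Qx` = 4 `Tw`. Being an
  -- inequality, it is stable under estimates, and by reflection only the absolute value of the
  -- twist matters.
  record LB (L M N k : ℕ) : Set where
    constructor lb
    field
      tiling  : Pos → Dir
      valid   : Valid (In L M N) tiling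
      large   : pos (4 ℕ.* k) ≤ Qx L M N tiling

  -- One map `f` serves in both directions because the symmetries in question, reflections and
  -- transpositions of axes, are involutions.
  Valid-map : ∀ {R R′ : Pos → Set} {D} (f : Pos → Pos) (σ : Dir → Dir) →
    (∀ p → R′ p → R (f p)) → (∀ p → R p → R′ (f p)) → (∀ p → R′ p → f (f p) ≡ p) → (∀ q → R q → f (f q) ≡ q) →
    (∀ d → σ (opp d) ≡ opp (σ d)) → (∀ {p d q} → R p → R q → Nb p d q → Nb (f p) (σ d) (f q)) →
    Valid R D → Valid R′ (λ p → σ (D (f p)))
  Valid-map {D = D} f σ to from inv inv′ σ-opp nb-map v p p∈ with v (f p) (to p p∈)
  ... | q , nb , q∈ , o = f q
    , subst (λ r → Nb r (σ (D (f p))) (f q)) (inv p p∈) (nb-map (to p p∈) q∈ nb)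
    , from q q∈ , trans (cong (λ r → σ (D r)) (inv′ q q∈)) (trans (cong σ o) (σ-opp (D (f p))))

  flipY : Dir → Dir
  flipY +x = +x
  flipY -x = -x
  flipY +y = -y
  flipY -y = +y
  flipY +z = +z
  flipY -z = -z

  -- The reflection permutes the lines in direction x and negates the y-component of each step. On a
  -- given line the colouring changes by a constant sign, which occurs squared in the area.
  reflect : ∀ {L M N D} → Valid (In L M N) D → ∃ λ D′ → Valid (In L M N) D′ × Qx L M N D′ ≡ - Qx L M N D
  reflect {L} {M} {N} {D} v = D′ , Valid-map f flipY f-in f-in f-inv f-inv flip-opp nb-map v , area
    where
    f : Pos → Pos
    f (x , y , z) = x , M ℕ.∸ suc y , z
    D′ : Pos → Dir
    D′ p = flipY (D (f p))
    rev< : ∀ {y} → y ℕ.< M → M ℕ.∸ suc y ℕ.< M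
    rev< {y} (ℕ.s≤s {n = n} l) = ℕ.s≤s (ℕP.m∸n≤m n y)
    f-in : ∀ p → In L M N p → In L M N (f p)
    f-in p (a , b , c) = a , rev< b , c
    f-inv : ∀ p → In L M N p → f (f p) ≡ p
    f-inv (x , y , z) (_ , ℕ.s≤s l , _) = cong (λ t → x , t , z) (ℕP.m∸[m∸n]≡n l)
    flip-opp : ∀ d → flipY (opp d) ≡ opp (flipY d)
    flip-opp = by-dir refl refl refl refl refl refl
    pred : ∀ y → suc y ℕ.< M → M ℕ.∸ suc y ≡ suc (M ℕ.∸ suc (suc y))
    pred y l = ℕP.+-∸-assoc 1 l
    nb-map : ∀ {p d q} → In L M N p → In L M N q → Nb p d q → Nb (f p) (flipY d) (f q)
    nb-map _ _ n+x = n+x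
    nb-map _ _ n-x = n-x
    nb-map _ (_ , l , _) (n+y {x} {y} {z}) = subst (λ t → Nb (x , t , z) -y (x , M ℕ.∸ suc (suc y) , z)) (sym (pred y l)) n-y
    nb-map (_ , l , _) _ (n-y {x} {y} {z}) = subst (λ t → Nb (x , M ℕ.∸ suc (suc y) , z) +y (x , t , z)) (sym (pred y l)) n+y
    nb-map _ _ n+z = n+z
    nb-map _ _ n-z = n-z
    flip-Y : ∀ d → cY (flipY d) ≡ - cY d
    flip-Y = by-dir refl refl refl refl refl refl
    flip-Z : ∀ d → cZ (flipY d) ≡ cZ d
    flip-Z = by-dir refl refl refl refl refl refl
    recolor : ∀ x y y′ z → color x y z ≡ sg y * sg y′ * color x y′ z
    recolor x y y′ z = trans (color-sep x y z) (sym (trans (cong (sg y * sg y′ *_) (color-sep x y′ z))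
      (trans (h (sg y) (sg y′) (sg x) (sg z)) (trans (cong (_* (sg x * sg z * sg y)) (sg² y′)) (*-identityˡ _)))))
      where
      h : ∀ a b c d → a * b * (c * d * b) ≡ b * b * (c * d * a)
      h = solve-∀
    line : ∀ y z → Area L (λ x → wY D′ x y z) (λ x → wZ D′ x y z) ≡
      - Area L (λ x → wY D x (M ℕ.∸ suc y) z) (λ x → wZ D x (M ℕ.∸ suc y) z)
    line y z = trans (Area-cong L
        (λ x _ → trans (cong₂ _*_ (recolor x y y′ z) (flip-Y (D (x , y′ , z)))) (h₁ s (color x y′ z) (cY (D (x , y′ , z)))))
        (λ x _ → trans (cong₂ _*_ (recolor x y y′ z) (flip-Z (D (x , y′ , z)))) (*-assoc s (color x y′ z) _)))
      (trans (Area-scale L (- s) s (λ x → wY D x y′ z) (λ x → wZ D x y′ z))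
        (trans (cong (_* Area L (λ x → wY D x y′ z) (λ x → wZ D x y′ z)) (trans (h₂ (sg y) (sg y′)) (cong₂ (λ a b → - (a * b)) (sg² y) (sg² y′))))
          (-1*i≡-i _)))
      where
      y′ : ℕ
      y′ = M ℕ.∸ suc y
      s : ℤ
      s = sg y * sg y′
      h₁ : ∀ s c d → s * c * - d ≡ - s * (c * d)
      h₁ = solve-∀
      h₂ : ∀ a b → - (a * b) * (a * b) ≡ - (a * a * (b * b))
      h₂ = solve-∀
    area : Qx L M N D′ ≡ - Qx L M N D
    area = trans (Σ-cong′ M λ y → trans (Σ-cong′ N λ z → line y z) (Σ-neg N _))
      (trans (Σ-neg M _) (cong -_ (Σ-rev M (λ y → Σ< N λ z → Area L (λ x → wY D x y z) (λ x → wZ D x y z)))))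

  LB-neg : ∀ {L M N D k} → Valid (In L M N) D → pos (4 ℕ.* k) ≤ - Qx L M N D → LB L M N k
  LB-neg {L} {M} {N} {D} {k} v le = from (reflect v)
    where
    from : (∃ λ D′ → Valid (In L M N) D′ × Qx L M N D′ ≡ - Qx L M N D) → LB L M N k
    from (D′ , v′ , e) = lb D′ v′ (subst (pos (4 ℕ.* k) ≤_) (sym e) le)

  swapXY : Dir → Dir
  swapXY +x = +y
  swapXY -x = -y
  swapXY +y = +x
  swapXY -y = -x
  swapXY +z = +z
  swapXY -z = -z

  swapYZ : Dir → Dir
  swapYZ +x = +x
  swapYZ -x = -x
  swapYZ +y = +z
  swapYZ -y = -z
  swapYZ +z = +y
  swapYZ -z = -y

  -- The form along the new x-axis is the old one along y up to sign, so the independence of the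
  -- direction enters here. A transposition reverses orientation and negates the twist, and `LB-neg`
  -- restores the sign.
  LB-swapXY : ∀ {L M N k} → LB L M N k → LB M L N k
  LB-swapXY {L} {M} {N} {k} (lb D v le) =
    LB-neg {D = D′} (Valid-map f swapXY (λ _ (a , b , c) → b , a , c) (λ _ (a , b , c) → b , a , c) (λ _ _ → refl) (λ _ _ → refl) swap-opp (λ _ _ → nb-map) v)
      (subst (pos (4 ℕ.* k) ≤_) (trans (sym (Qy≡Qx v)) area) le)
    where
    f : Pos → Pos
    f (x , y , z) = y , x , z
    D′ : Pos → Dir
    D′ p = swapXY (D (f p))
    swap-opp : ∀ d → swapXY (opp d) ≡ opp (swapXY d)
    swap-opp = by-dir refl refl refl refl refl refl
    nb-map : ∀ {p d q} → Nb p d q → Nb (f p) (swapXY d) (f q)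
    nb-map n+x = n+y
    nb-map n-x = n-y
    nb-map n+y = n+x
    nb-map n-y = n-x
    nb-map n+z = n+z
    nb-map n-z = n-z
    swap-Y : ∀ d → cY (swapXY d) ≡ cX d
    swap-Y = by-dir refl refl refl refl refl refl
    swap-Z : ∀ d → cZ (swapXY d) ≡ cZ d
    swap-Z = by-dir refl refl refl refl refl refl
    col : ∀ x y z → color x y z ≡ color y x z
    col x y z = cong (λ t → sg (t ℕ.+ z)) (ℕP.+-comm x y)
    area : Qy L M N D ≡ - Qx M L N D′
    area = sym (trans (sym (trans (Σ-cong′ L λ y → Σ-neg N _) (Σ-neg L _)))
      (trans (Σ-cong′ L λ y → Σ-cong′ N λ z → trans (sym (Area-antisym M (λ x → wZ D′ x y z) (λ x → wY D′ x y z)))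
          (Area-cong M (λ x _ → cong₂ _*_ (col x y z) (swap-Z (D (y , x , z)))) (λ x _ → cong₂ _*_ (col x y z) (swap-Y (D (y , x , z))))))
        (Σ-swap L N _)))

  LB-swapYZ : ∀ {L M N k} → LB L M N k → LB L N M k
  LB-swapYZ {L} {M} {N} {k} (lb D v le) =
    LB-neg {D = D′} (Valid-map f swapYZ (λ _ (a , b , c) → a , c , b) (λ _ (a , b , c) → a , c , b) (λ _ _ → refl) (λ _ _ → refl) swap-opp (λ _ _ → nb-map) v)
      (subst (pos (4 ℕ.* k) ≤_) area le)
    where
    f : Pos → Pos
    f (x , y , z) = x , z , y
    D′ : Pos → Dir
    D′ p = swapYZ (D (f p))
    swap-opp : ∀ d → swapYZ (opp d) ≡ opp (swapYZ d)
    swap-opp = by-dir refl refl refl refl refl refl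
    nb-map : ∀ {p d q} → Nb p d q → Nb (f p) (swapYZ d) (f q)
    nb-map n+x = n+x
    nb-map n-x = n-x
    nb-map n+y = n+z
    nb-map n-y = n-z
    nb-map n+z = n+y
    nb-map n-z = n-y
    swap-Y : ∀ d → cY (swapYZ d) ≡ cZ d
    swap-Y = by-dir refl refl refl refl refl refl
    swap-Z : ∀ d → cZ (swapYZ d) ≡ cY d
    swap-Z = by-dir refl refl refl refl refl refl
    col : ∀ x y z → color x y z ≡ color x z y
    col x y z = cong sg (trans (ℕP.+-assoc x y z) (trans (cong (x ℕ.+_) (ℕP.+-comm y z)) (sym (ℕP.+-assoc x z y))))
    area : Qx L M N D ≡ - Qx L N M D′
    area = sym (trans (sym (trans (Σ-cong′ N λ y → Σ-neg M _) (Σ-neg N _)))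
      (trans (Σ-cong′ N λ y → Σ-cong′ M λ z → trans (sym (Area-antisym L (λ x → wZ D′ x y z) (λ x → wY D′ x y z)))
          (Area-cong L (λ x _ → cong₂ _*_ (col x y z) (swap-Z (D (x , z , y)))) (λ x _ → cong₂ _*_ (col x y z) (swap-Y (D (x , z , y))))))
        (Σ-swap N M _)))

  -- A line in direction x stays in one of the two boxes, so the areas add up. Shifting the second
  -- box by `M₁` may exchange its colours, but the area is quadratic in the field.
  LB-glueY : ∀ {L M₁ M₂ N k₁ k₂} → LB L M₁ N k₁ → LB L M₂ N k₂ → LB L (M₁ ℕ.+ M₂) N (k₁ ℕ.+ k₂)
  LB-glueY {L} {M₁} {M₂} {N} {k₁} {k₂} (lb D₁ v₁ le₁) (lb D₂ v₂ le₂) = lb D valid le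
    where
    at : ∀ p → Dec (proj₁ (proj₂ p) ℕ.< M₁) → Dir
    at p (yes _) = D₁ p
    at (x , y , z) (no _) = D₂ (x , y ℕ.∸ M₁ , z)
    D : Pos → Dir
    D p = at p (proj₁ (proj₂ p) ℕP.<? M₁)
    D-low : ∀ x y z → y ℕ.< M₁ → D (x , y , z) ≡ D₁ (x , y , z)
    D-low x y z l with y ℕP.<? M₁
    ... | yes _ = refl
    ... | no n = ⊥-elim (n l)
    D-high : ∀ x i z → D (x , M₁ ℕ.+ i , z) ≡ D₂ (x , i , z)
    D-high x i z with M₁ ℕ.+ i ℕP.<? M₁
    ... | yes l = ⊥-elim (ℕP.m+n≮m M₁ i l)
    ... | no _ = cong (λ t → D₂ (x , t , z)) (ℕP.m+n∸m≡n M₁ i)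
    shift : Pos → Pos
    shift (x , y , z) = x , M₁ ℕ.+ y , z
    Nb-shift : ∀ {p d q} → Nb p d q → Nb (shift p) d (shift q)
    Nb-shift n+x = n+x
    Nb-shift n-x = n-x
    Nb-shift (n+y {x} {y} {z}) = subst (λ t → Nb (x , M₁ ℕ.+ y , z) +y (x , t , z)) (sym (ℕP.+-suc M₁ y)) n+y
    Nb-shift (n-y {x} {y} {z}) = subst (λ t → Nb (x , t , z) -y (x , M₁ ℕ.+ y , z)) (sym (ℕP.+-suc M₁ y)) n-y
    Nb-shift n+z = n+z
    Nb-shift n-z = n-z
    valid : Valid (In L (M₁ ℕ.+ M₂) N) D
    valid (x , y , z) (lx , ly , lz) with ℕP.<-≤-connex y M₁
    ... | inj₁ l with v₁ (x , y , z) (lx , l , lz)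
    ...   | q , nb , (qx , qy , qz) , o = q , subst (λ d → Nb _ d q) (sym (D-low x y z l)) nb
      , (qx , ℕP.≤-trans qy (ℕP.m≤m+n M₁ M₂) , qz) , trans (D-low _ _ _ qy) (trans o (cong opp (sym (D-low x y z l))))
    valid (x , y , z) (lx , ly , lz) | inj₂ ge with ℕP.m≤n⇒∃[o]m+o≡n ge
    ... | i , refl with v₂ (x , i , z) (lx , ℕP.+-cancelˡ-< M₁ i M₂ ly , lz)
    ...   | q , nb , (qx , qy , qz) , o = shift q , subst (λ d → Nb _ d (shift q)) (sym (D-high x i z)) (Nb-shift nb)
      , (qx , ℕP.+-monoʳ-< M₁ qy , qz) , trans (D-high _ _ _) (trans o (cong opp (sym (D-high x i z))))
    recolor : ∀ x i z → color x (M₁ ℕ.+ i) z ≡ sg M₁ * color x i z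
    recolor x i z = trans (color-sep x (M₁ ℕ.+ i) z) (trans (cong (sg x * sg z *_) (sg-+ M₁ i))
      (trans (h (sg x) (sg z) (sg M₁) (sg i)) (cong (sg M₁ *_) (sym (color-sep x i z)))))
      where
      h : ∀ a b c d → a * b * (c * d) ≡ c * (a * b * d)
      h = solve-∀
    high : ∀ (c : Dir → ℤ) x i z → color x (M₁ ℕ.+ i) z * c (D (x , M₁ ℕ.+ i , z)) ≡ sg M₁ * (color x i z * c (D₂ (x , i , z)))
    high c x i z = trans (cong₂ _*_ (recolor x i z) (cong c (D-high x i z))) (*-assoc (sg M₁) _ _)
    area : Qx L (M₁ ℕ.+ M₂) N D ≡ Qx L M₁ N D₁ + Qx L M₂ N D₂
    area = trans (Σ-split M₁ M₂ _) (cong₂ _+_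
      (Σ-cong M₁ λ y l → Σ-cong′ N λ z → Area-cong L
        (λ x _ → cong (λ d → color x y z * cY d) (D-low x y z l)) (λ x _ → cong (λ d → color x y z * cZ d) (D-low x y z l)))
      (Σ-cong′ M₂ λ i → Σ-cong′ N λ z → trans (Area-cong L (λ x _ → high cY x i z) (λ x _ → high cZ x i z))
        (trans (Area-scale L (sg M₁) (sg M₁) (λ x → wY D₂ x i z) (λ x → wZ D₂ x i z))
          (trans (cong (_* Area L (λ x → wY D₂ x i z) (λ x → wZ D₂ x i z)) (sg² M₁)) (*-identityˡ _)))))
    le : pos (4 ℕ.* (k₁ ℕ.+ k₂)) ≤ Qx L (M₁ ℕ.+ M₂) N D
    le = subst₂ _≤_ (trans (sym (pos-+ (4 ℕ.* k₁) (4 ℕ.* k₂))) (cong pos (sym (ℕP.*-distribˡ-+ 4 k₁ k₂)))) (sym area) (+-mono-≤ le₁ le₂)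

  LB-weaken : ∀ {L M N k k′} → k′ ℕ.≤ k → LB L M N k → LB L M N k′
  LB-weaken l (lb D v le) = lb D v (≤-trans (ℤ.+≤+ (ℕP.*-monoʳ-≤ 4 l)) le)

  LB-valid : ∀ {L M N D} → Valid (In L M N) D → LB L M N 0
  LB-valid {L} {M} {N} {D} v with ≤-total 0ℤ (Qx L M N D)
  ... | inj₁ p = lb D v p
  ... | inj₂ p = LB-neg v (neg-mono-≤ p)

  LB-glueX : ∀ {L₁ L₂ M N k₁ k₂} → LB L₁ M N k₁ → LB L₂ M N k₂ → LB (L₁ ℕ.+ L₂) M N (k₁ ℕ.+ k₂)
  LB-glueX a b = LB-swapXY (LB-glueY (LB-swapXY a) (LB-swapXY b))

  LB-glueZ : ∀ {L M N₁ N₂ k₁ k₂} → LB L M N₁ k₁ → LB L M N₂ k₂ → LB L M (N₁ ℕ.+ N₂) (k₁ ℕ.+ k₂)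
  LB-glueZ a b = LB-swapYZ (LB-glueY (LB-swapYZ a) (LB-swapYZ b))

  LB-swapXZ : ∀ {L M N k} → LB L M N k → LB N M L k
  LB-swapXZ a = LB-swapXY (LB-swapYZ (LB-swapXY a))

-- Nested planar rings around a rectangular hole.

module Annulus where

  open import Data.Bool using (Bool; true; false; not; if_then_else_)
  open import Data.Nat using (ℕ; zero; suc; pred; _+_; _<_; _≤_; s≤s; z≤n; z<s; s<s)
  open import Data.Nat.Properties
  open import Data.Product using (_×_; _,_; ∃; proj₁; proj₂)
  open import Data.Sum using (_⊎_; inj₁; inj₂)
  open import Data.Empty using (⊥)
  open import Relation.Binary.PropositionalEquality

  data Dir² : Set where
    E N W S : Dir²

  opp² : Dir² → Dir²
  opp² E = W
  opp² N = S
  opp² W = E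
  opp² S = N

  data Nb² : ℕ → ℕ → Dir² → ℕ → ℕ → Set where
    nE : ∀ {i j} → Nb² i j E (suc i) j
    nW : ∀ {i j} → Nb² (suc i) j W i j
    nN : ∀ {i j} → Nb² i j N i (suc j)
    nS : ∀ {i j} → Nb² i (suc j) S i j

  -- The position of a point relative to the interval [a, a + n).
  data Zone : Set where
    below  : Zone
    inside : ℕ → Zone
    above  : ℕ → Zone

  next : Zone → Zone
  next below = below
  next (inside i) = inside (suc i)
  next (above i) = above i

  zone : ℕ → ℕ → ℕ → Zone
  zone zero    zero    t       = above t
  zone zero    (suc n) zero    = inside zero
  zone zero    (suc n) (suc t) = next (zone zero n t)
  zone (suc a) n       zero    = below
  zone (suc a) n       (suc t) = zone a n t

  zone-below : ∀ {a} n {t} → t < a → zone a n t ≡ below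
  zone-below {suc a} n {zero} l = refl
  zone-below {suc a} n {suc t} (s≤s l) = zone-below n l

  zone-inside : ∀ a {n t} → t < n → zone a n (a + t) ≡ inside t
  zone-inside zero {suc n} {zero} l = refl
  zone-inside zero {suc n} {suc t} (s≤s l) = cong next (zone-inside zero l)
  zone-inside (suc a) l = zone-inside a l

  zone-above : ∀ a n t → zone a n (a + n + t) ≡ above t
  zone-above zero zero t = refl
  zone-above zero (suc n) t = cong next (zone-above zero n t)
  zone-above (suc a) n t = zone-above a n t

  data InZone (a n : ℕ) : ℕ → Set where
    isBelow  : ∀ {t} → t < a → InZone a n t
    isInside : ∀ t → t < n → InZone a n (a + t)
    isAbove  : ∀ t → InZone a n (a + n + t)

  inZone : ∀ a n t → InZone a n t
  inZone zero zero t = isAbove t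
  inZone zero (suc n) zero = isInside zero z<s
  inZone zero (suc n) (suc t) with inZone zero n t
  ... | isInside t l = isInside (suc t) (s<s l)
  ... | isAbove t = isAbove t
  inZone (suc a) n zero = isBelow z<s
  inZone (suc a) n (suc t) with inZone a n t
  ... | isBelow l = isBelow (s<s l)
  ... | isInside t l = isInside t l
  ... | isAbove t = isAbove t

  -- This is w + 2 r, by a recursion in which removing the outermost ring is a computation step.
  outer : ℕ → ℕ → ℕ
  outer zero    w = w
  outer (suc r) w = suc (suc (outer r w))

  outer-≡ : ∀ r w → outer r w ≡ r + (w + r)
  outer-≡ zero w = sym (+-identityʳ w)
  outer-≡ (suc r) w = cong suc (trans (cong suc (outer-≡ r w)) (trans (sym (+-suc r (w + r))) (cong (r +_) (sym (+-suc w r)))))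

  data Side : Set where
    lo mid hi : Side

  side : ℕ → ℕ → Side
  side n zero = lo
  side zero (suc i) = hi
  side (suc n) (suc zero) = mid
  side (suc n) (suc (suc i)) = side n (suc i)

  data Low : Side → Set where
    lo  : Low lo
    mid : Low mid

  data Upp : Side → Set where
    mid : Upp mid
    hi  : Upp hi

  side-hi : ∀ n → side n (suc n) ≡ hi
  side-hi zero = refl
  side-hi (suc n) = side-hi n

  side-mid : ∀ {n i} → i < n → side n (suc i) ≡ mid
  side-mid {suc n} {zero} l = refl
  side-mid {suc n} {suc i} (s≤s l) = side-mid l

  low : ∀ n {i} → i ≤ n → Low (side n i)
  low n {zero} l = lo
  low n {suc i} l rewrite side-mid l = mid

  upp : ∀ n i → Upp (side n (suc i))
  upp zero i = hi
  upp (suc n) zero = mid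
  upp (suc n) (suc i) = upp n i

  -- The direction at a cell of a counterclockwise ring: to the next cell if b holds, else to the
  -- previous one.
  ring : Bool → Side → Side → Dir² → Dir²
  ring true  lo  lo  _ = E
  ring true  mid lo  _ = E
  ring true  hi  lo  _ = N
  ring true  hi  mid _ = N
  ring true  hi  hi  _ = W
  ring true  mid hi  _ = W
  ring true  lo  hi  _ = S
  ring true  lo  mid _ = S
  ring false lo  lo  _ = N
  ring false mid lo  _ = W
  ring false hi  lo  _ = W
  ring false hi  mid _ = S
  ring false hi  hi  _ = S
  ring false mid hi  _ = E
  ring false lo  hi  _ = E
  ring false lo  mid _ = N
  ring _     mid mid d = d

  ann : Bool → (r w h : ℕ) → ℕ → ℕ → Dir²
  -- A default value for the hole, which `Ann` excludes.
  ann b zero    w h i j = E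
  ann b (suc r) w h i j = ring b (side (outer r w) i) (side (outer r h) j) (ann b r w h (pred i) (pred j))

  -- The cells of `r` rings around a w × h hole, in coordinates of the outer rectangle. The sides
  -- overlap at the corners, so that a turn may name the corner as part of either side.
  data Ann (w h : ℕ) : ℕ → ℕ → ℕ → Set where
    bot   : ∀ {r i} → i < outer (suc r) w → Ann w h (suc r) i zero
    top   : ∀ {r i} → i < outer (suc r) w → Ann w h (suc r) i (suc (outer r h))
    left  : ∀ {r j} → j < outer (suc r) h → Ann w h (suc r) zero j
    right : ∀ {r j} → j < outer (suc r) h → Ann w h (suc r) (suc (outer r w)) j
    inner : ∀ {r i j} → Ann w h r i j → Ann w h (suc r) (suc i) (suc j)

  ann-bounds : ∀ {w h r i j} → Ann w h r i j → i < outer r w × j < outer r h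
  ann-bounds (bot l) = l , z<s
  ann-bounds (top l) = l , ≤-refl
  ann-bounds (left l) = z<s , l
  ann-bounds (right l) = ≤-refl , l
  ann-bounds (inner a) = s<s (m<n⇒m<1+n (proj₁ (ann-bounds a))) , s<s (m<n⇒m<1+n (proj₂ (ann-bounds a)))

  -- The flag is flipped at the partner because it stands for the colour of a cell: along a ring,
  -- cells pointing forwards and backwards alternate, and neighbours have opposite colours.
  Partner² : Bool → (w h r i j : ℕ) → Set
  Partner² b w h r i j = ∃ λ i′ → ∃ λ j′ →
    Nb² i j (ann b r w h i j) i′ j′ × Ann w h r i′ j′ × ann (not b) r w h i′ j′ ≡ opp² (ann b r w h i j)

  private
    mk : ∀ {b w h r i j i′ j′ d} → ann b r w h i j ≡ d → Nb² i j d i′ j′ → Ann w h r i′ j′ →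
      ann (not b) r w h i′ j′ ≡ opp² d → Partner² b w h r i j
    mk {b} {w} {h} {r} {i} {j} {i′} {j′} e n a o =
      i′ , j′ , subst (λ d → Nb² i j d i′ j′) (sym e) n , a , trans o (cong opp² (sym e))

    E-lo : ∀ {c d} → Low c → ring true c lo d ≡ E
    E-lo lo = refl
    E-lo mid = refl
    W-lo : ∀ {c d} → Upp c → ring false c lo d ≡ W
    W-lo mid = refl
    W-lo hi = refl
    N-hi : ∀ {c d} → Low c → ring true hi c d ≡ N
    N-hi lo = refl
    N-hi mid = refl
    S-hi : ∀ {c d} → Upp c → ring false hi c d ≡ S
    S-hi mid = refl
    S-hi hi = refl
    W-hi : ∀ {c d} → Upp c → ring true c hi d ≡ W
    W-hi mid = refl
    W-hi hi = refl
    E-hi : ∀ {c d} → Low c → ring false c hi d ≡ E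
    E-hi lo = refl
    E-hi mid = refl
    S-lo : ∀ {c d} → Upp c → ring true lo c d ≡ S
    S-lo mid = refl
    S-lo hi = refl
    N-lo : ∀ {c d} → Low c → ring false lo c d ≡ N
    N-lo lo = refl
    N-lo mid = refl

  module _ (w h r : ℕ) where

    private
      w′ = outer r w
      h′ = outer r h

      hi-row : ∀ b c d → ring b c (side h′ (suc h′)) d ≡ ring b c hi d
      hi-row b c d = cong (λ s → ring b c s d) (side-hi h′)
      hi-col : ∀ b c d → ring b (side w′ (suc w′)) c d ≡ ring b hi c d
      hi-col b c d = cong (λ s → ring b s c d) (side-hi w′)

      goE : ∀ {i} → i ≤ w′ → Partner² true w h (suc r) i zero
      goE {i} l = mk {b = true} (E-lo (low w′ l)) nE (bot (s<s (s≤s l))) (W-lo (upp w′ i))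
      backW : ∀ {i} → i ≤ w′ → Partner² false w h (suc r) (suc i) zero
      backW {i} l = mk {b = false} (W-lo (upp w′ i)) nW (bot (s≤s (m≤n⇒m≤1+n l))) (E-lo (low w′ l))
      goN : ∀ {j} → j ≤ h′ → Partner² true w h (suc r) (suc w′) j
      goN {j} l = mk {b = true} (trans (hi-col true _ _) (N-hi (low h′ l))) nN (right (s<s (s≤s l))) (trans (hi-col false _ _) (S-hi (upp h′ j)))
      backS : ∀ {j} → j ≤ h′ → Partner² false w h (suc r) (suc w′) (suc j)
      backS {j} l = mk {b = false} (trans (hi-col false _ _) (S-hi (upp h′ j))) nS (right (s≤s (m≤n⇒m≤1+n l))) (trans (hi-col true _ _) (N-hi (low h′ l)))
      goW : ∀ {i} → i ≤ w′ → Partner² true w h (suc r) (suc i) (suc h′)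
      goW {i} l = mk {b = true} (trans (hi-row true (side w′ (suc i)) _) (W-hi (upp w′ i))) nW (top (s≤s (m≤n⇒m≤1+n l))) (trans (hi-row false (side w′ i) _) (E-hi (low w′ l)))
      backE : ∀ {i} → i ≤ w′ → Partner² false w h (suc r) i (suc h′)
      backE {i} l = mk {b = false} (trans (hi-row false (side w′ i) _) (E-hi (low w′ l))) nE (top (s<s (s≤s l))) (trans (hi-row true (side w′ (suc i)) _) (W-hi (upp w′ i)))
      goS : ∀ {j} → j ≤ h′ → Partner² true w h (suc r) zero (suc j)
      goS {j} l = mk {b = true} (S-lo (upp h′ j)) nS (left (s≤s (m≤n⇒m≤1+n l))) (N-lo (low h′ l))
      backN : ∀ {j} → j ≤ h′ → Partner² false w h (suc r) zero j
      backN {j} l = mk {b = false} (N-lo (low h′ l)) nN (left (s<s (s≤s l))) (S-lo (upp h′ j))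

      last : ∀ {n i} → i < suc (suc n) → i ≤ n ⊎ i ≡ suc n
      last (s≤s l) with m≤n⇒m<n∨m≡n l
      ... | inj₁ (s≤s l′) = inj₁ l′
      ... | inj₂ e = inj₂ e

    -- Only the outermost ring is treated: a cell pairs with the next one on its side, except at the
    -- last cell, where the ring turns. The inner rings come in through the argument for `inner`.
    ann-border : ∀ b {i j} → Ann w h (suc r) i j → (∀ {i j} → Ann w h r i j → Partner² b w h (suc r) (suc i) (suc j)) → Partner² b w h (suc r) i j
    ann-border true (bot l) _ with last l
    ... | inj₁ l′ = goE l′
    ... | inj₂ refl = goN z≤n
    ann-border true (right l) _ with last l
    ... | inj₁ l′ = goN l′
    ... | inj₂ refl = goW ≤-refl
    ann-border true (top {i = zero} l) _ = goS ≤-refl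
    ann-border true (top {i = suc i} (s≤s (s≤s l))) _ = goW l
    ann-border true (left {j = zero} l) _ = goE z≤n
    ann-border true (left {j = suc j} (s≤s (s≤s l))) _ = goS l
    ann-border false (bot {i = zero} l) _ = backN z≤n
    ann-border false (bot {i = suc i} (s≤s (s≤s l))) _ = backW l
    ann-border false (right {j = zero} l) _ = backW ≤-refl
    ann-border false (right {j = suc j} (s≤s (s≤s l))) _ = backS l
    ann-border false (top l) _ with last l
    ... | inj₁ l′ = backE l′
    ... | inj₂ refl = backS ≤-refl
    ann-border false (left l) _ with last l
    ... | inj₁ l′ = backN l′
    ... | inj₂ refl = backE z≤n
    ann-border b (inner a) k = k a

  ann-core-step : ∀ b r w h {i j} → i < outer r w → j < outer r h → ann b (suc r) w h (suc i) (suc j) ≡ ann b r w h i j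
  ann-core-step b r w h li lj rewrite side-mid li | side-mid lj with b
  ... | true = refl
  ... | false = refl

  ann-partner : ∀ b {w h} r {i j} → Ann w h r i j → Partner² b w h r i j
  ann-partner b {w} {h} (suc r) a = ann-border w h r b a deeper
    where
    deeper : ∀ {i j} → Ann w h r i j → Partner² b w h (suc r) (suc i) (suc j)
    deeper {i} {j} a with ann-partner b r a | ann-bounds a
    ... | i′ , j′ , n , a′ , o | bi , bj = mk {b = b} (ann-core-step b r w h bi bj) (lift n) (inner a′)
      (trans (ann-core-step (not b) r w h (proj₁ (ann-bounds a′)) (proj₂ (ann-bounds a′))) o)
      where
      lift : ∀ {i j d i′ j′} → Nb² i j d i′ j′ → Nb² (suc i) (suc j) d (suc i′) (suc j′)
      lift nE = nE
      lift nW = nW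
      lift nN = nN
      lift nS = nS

  outer-+ : ∀ r w → r + w + r ≡ outer r w
  outer-+ r w = trans (+-assoc r w r) (sym (outer-≡ r w))

  r≤outer : ∀ r w → r ≤ outer r w
  r≤outer r w = ≤-trans (m≤m+n r (w + r)) (≤-reflexive (sym (outer-≡ r w)))

  ann-left : ∀ {w h} r {i j} → i < r → j < outer r h → Ann w h r i j
  ann-left (suc r) {zero} l lj = left lj
  ann-left (suc r) {suc i} {zero} (s≤s l) lj = bot (s<s (m<n⇒m<1+n (<-≤-trans l (r≤outer r _))))
  ann-left {w} {h} (suc r) {suc i} {suc j} (s≤s l) (s≤s (s≤s lj)) with m≤n⇒m<n∨m≡n lj
  ... | inj₁ lj′ = inner (ann-left r l lj′)
  ... | inj₂ refl = top (s<s (m<n⇒m<1+n (<-≤-trans l (r≤outer r w))))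

  transpose : ∀ {w h r i j} → Ann w h r i j → Ann h w r j i
  transpose (bot l) = left l
  transpose (top l) = right l
  transpose (left l) = bot l
  transpose (right l) = top l
  transpose (inner a) = inner (transpose a)

  ann-right : ∀ {w h} r {i j} → i < r → j < outer r h → Ann w h r (r + w + i) j
  ann-right {w} (suc r) {i} {j} (s≤s l) lj with m≤n⇒m<n∨m≡n l
  ... | inj₂ refl = subst (λ t → Ann w _ (suc i) (suc t) j) (sym (outer-+ i w)) (right lj)
  ann-right {w} (suc r) {i} {zero} (s≤s l) lj | inj₁ l′ =
    bot (s<s (<-≤-trans (+-monoʳ-< (r + w) l′) (≤-trans (≤-reflexive (outer-+ r w)) (n≤1+n _))))
  ann-right {w} {h} (suc r) {i} {suc j} (s≤s l) (s≤s (s≤s lj)) | inj₁ l′ with m≤n⇒m<n∨m≡n lj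
  ... | inj₁ lj′ = inner (ann-right r l′ lj′)
  ... | inj₂ refl = top (s<s (<-≤-trans (+-monoʳ-< (r + w) l′) (≤-trans (≤-reflexive (outer-+ r w)) (n≤1+n _))))

  ann-core : ∀ {w h} r {i j} → i < w → j < h → Ann w h r (r + i) (r + j) → ⊥
  ann-core {w} {h} r {i} {j} li lj a = go r refl refl a
    where
    no : ∀ r {w i} → i < w → r + i ≢ outer r w
    no r {w} {i} l e = <-irrefl e (<-≤-trans (+-monoʳ-< r l) (≤-trans (+-monoʳ-≤ r (m≤m+n w r)) (≤-reflexive (sym (outer-≡ r w)))))
    go : ∀ r {s t} → s ≡ r + i → t ≡ r + j → Ann w h r s t → ⊥
    go (suc r) e f (bot l) with () ← f
    go (suc r) e f (top l) = no r lj (sym (suc-injective f))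
    go (suc r) e f (left l) with () ← e
    go (suc r) e f (right l) = no r li (sym (suc-injective e))
    go (suc r) e f (inner a) = go r (suc-injective e) (suc-injective f) a

  -- Beside the hole each ring is straight, running down on the left and up on the right. These are
  -- the only explicit values of `ann` that enter the main term of the twist.
  ann-straightˡ : ∀ b {w h} r {i j} → i < r → j < h → ann b r w h i (r + j) ≡ (if b then S else N)
  ann-straightˡ b {w} {h} (suc r) {zero} {j} l lj rewrite side-mid {outer r h} (<-≤-trans (+-monoʳ-< r lj)
    (≤-trans (+-monoʳ-≤ r (m≤m+n h r)) (≤-reflexive (sym (outer-≡ r h))))) with b
  ... | true = refl
  ... | false = refl
  ann-straightˡ b {w} {h} (suc r) {suc i} {j} (s≤s l) lj =
    trans (ann-core-step b r w h (<-≤-trans l (≤-trans (m≤m+n r (w + r)) (≤-reflexive (sym (outer-≡ r w)))))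
      (<-≤-trans (+-monoʳ-< r lj) (≤-trans (+-monoʳ-≤ r (m≤m+n h r)) (≤-reflexive (sym (outer-≡ r h))))))
      (ann-straightˡ b r l lj)

  ann-straightʳ : ∀ b {w h} r {i j} → i < r → j < h → ann b r w h (r + w + i) (r + j) ≡ (if b then N else S)
  ann-straightʳ b {w} {h} (suc r) {i} {j} (s≤s l) lj with m≤n⇒m<n∨m≡n l
  ... | inj₁ l′ = trans (ann-core-step b r w h (<-≤-trans (+-monoʳ-< (r + w) l′) (≤-reflexive (outer-+ r w)))
      (<-≤-trans (+-monoʳ-< r lj) (≤-trans (+-monoʳ-≤ r (m≤m+n h r)) (≤-reflexive (sym (outer-≡ r h))))))
      (ann-straightʳ b r l′ lj)
  ... | inj₂ refl rewrite outer-+ i w | side-hi (outer i w) | side-mid {outer i h} (<-≤-trans (+-monoʳ-< i lj)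
      (≤-trans (+-monoʳ-≤ i (m≤m+n h i)) (≤-reflexive (sym (outer-≡ i h))))) with b
  ...   | true = refl
  ...   | false = refl

-- The tiling by a solid torus with two linked stacks of rings.

module Linked where

  open Partner
  open Annulus
  open import Data.Bool using (Bool; true; false; not; if_then_else_; _xor_)
  open import Data.Bool.Properties using (not-involutive)
  open import Data.Nat using (ℕ; zero; suc; _+_; _∸_; _<_; _≤_)
  open import Data.Nat.Properties
  open import Data.Nat.Tactic.RingSolver using (solve-∀)
  open import Data.Product using (_×_; _,_; ∃; proj₁; proj₂)
  open import Data.Sum using (_⊎_; inj₁; inj₂)
  open import Data.Empty using (⊥-elim)
  open import Relation.Binary.PropositionalEquality

  ev : ℕ → Bool
  ev zero = true
  ev (suc n) = not (ev n)

  even : Pos → Bool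
  even (x , y , z) = ev (x + y + z)

  even-Nb : ∀ {p d q} → Nb p d q → even q ≡ not (even p)
  even-Nb n+x = refl
  even-Nb n-x = sym (not-involutive _)
  even-Nb (n+y {x} {y} {z}) rewrite +-suc x y = refl
  even-Nb (n-y {x} {y} {z}) rewrite +-suc x y = sym (not-involutive _)
  even-Nb (n+z {x} {y} {z}) rewrite +-suc (x + y) z = refl
  even-Nb (n-z {x} {y} {z}) rewrite +-suc (x + y) z = sym (not-involutive _)

  not-xor : ∀ a b → not a xor b ≡ not (a xor b)
  not-xor true b = sym (not-involutive b)
  not-xor false b = refl

  embXY embXZ : Dir² → Dir
  embXY E = +x
  embXY N = +y
  embXY W = -x
  embXY S = -y
  embXZ E = +x
  embXZ N = +z
  embXZ W = -x
  embXZ S = -z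

  embXY-opp : ∀ d → embXY (opp² d) ≡ opp (embXY d)
  embXY-opp E = refl
  embXY-opp N = refl
  embXY-opp W = refl
  embXY-opp S = refl

  embXZ-opp : ∀ d → embXZ (opp² d) ≡ opp (embXZ d)
  embXZ-opp E = refl
  embXZ-opp N = refl
  embXZ-opp W = refl
  embXZ-opp S = refl

  nb-E : ∀ {x x′ y z} → x′ ≡ suc x → Nb (x , y , z) +x (x′ , y , z)
  nb-E refl = n+x

  nb-W : ∀ {x x′ y z} → x ≡ suc x′ → Nb (x , y , z) -x (x′ , y , z)
  nb-W refl = n-x

  Nb-XY : ∀ a {i j d i′ j′ z} → Nb² i j d i′ j′ → Nb (a + i , j , z) (embXY d) (a + i′ , j′ , z)
  Nb-XY a (nE {i}) = nb-E (+-suc a i)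
  Nb-XY a (nW {i}) = nb-W (+-suc a i)
  Nb-XY a nN = n+y
  Nb-XY a nS = n-y

  Nb-XZ : ∀ a {i j d i′ j′ y} → Nb² i j d i′ j′ → Nb (a + i , y , j) (embXZ d) (a + i′ , y , j′)
  Nb-XZ a (nE {i}) = nb-E (+-suc a i)
  Nb-XZ a (nW {i}) = nb-W (+-suc a i)
  Nb-XZ a nN = n+z
  Nb-XZ a nS = n-z

  data Out : Zone → Set where
    below : Out below
    above : ∀ {i} → Out (above i)

  ev-double : ∀ n → ev (n + n) ≡ true
  ev-double zero = refl
  ev-double (suc n) rewrite +-suc n n = trans (not-involutive _) (ev-double n)

  even-succ : ∀ {t n} → t < n + n → ev t ≡ true → suc t < n + n
  even-succ {t} {n} l e with m≤n⇒m<n∨m≡n l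
  ... | inj₁ l′ = l′
  ... | inj₂ at-end with trans (cong not (sym e)) (trans (cong ev at-end) (ev-double n))
  ...   | ()

  odd-pred : ∀ {t} → ev t ≡ false → ∃ λ t′ → t ≡ suc t′ × ev t′ ≡ true
  odd-pred {suc t} e = t , refl , trans (sym (not-involutive (ev t))) (cong not e)

  -- A solid torus C of p × q closed rings parallel to the xy-plane.  Two stacks of m layers of r
  -- nested rings parallel to the xz-plane wind, in opposite senses, around the two long sides of C,
  -- where C is straight.  The rest, next to the short sides of C, is filled with columns and rows.
  module Link (r p q m b l : ℕ) (b+2l : outer r q ≡ b + (l + l)) (b≤r : b ≤ r) (ε : Bool) where

    A : ℕ
    A = outer r p

    C : ℕ
    C = outer p (r + r)

    X Y Z : ℕ
    X = A + A
    Y = outer p m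
    Z = outer r q

    tube : Zone → Zone → Dir → Dir → Dir
    tube (inside _) (inside _) c a = c
    tube _          _          c a = a

    lineX lineZ : ℕ → Dir
    lineX n = if ev n then +x else -x
    lineZ n = if ev n then +z else -z

    inC : Pos → Dir
    inC (x , y , z) = embXY (ann (even (x , y , z)) p (r + r) m (x ∸ r) y)

    -- The parity of the cell chooses forwards or backwards; `β` makes the two stacks wind in
    -- opposite senses, and `ε` reverses both of them at once.
    inA : Bool → Pos → ℕ → Dir
    inA β c@(x , y , z) i = embXZ (ann (β xor (even c xor ε)) r p q i z)

    half : Zone → Pos → Dir
    half below      c = inC c
    half (inside i) c@(_ , _ , z) = tube (zone r p i) (zone r q z) (inC c) (inA false c i)
    half (above i)  c@(_ , _ , z) = tube (zone r p i) (zone r q z) (inC c) (inA true c i)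

    column : Zone → ℕ → Dir
    column (inside i) k = lineX i
    column _          k = lineZ k

    -- Every run has even length: rows across the whole width X = 2 A in the layers z < b, then
    -- columns of height 2 l on both flanks of the torus and rows of length `C` below and above it.
    -- Here `b` corrects the parity of the height, and b ≤ r keeps those layers below the torus.
    fill : Zone → Pos → Dir
    fill (above k) (x , _ , _) = column (zone r C x) k
    fill _         (x , _ , _) = lineX x

    slice : Zone → Pos → Dir
    slice (inside _) c@(x , _ , _) = half (zone zero A x) c
    slice _          c@(x , _ , z) = tube (zone r q z) (zone r C x) (inC c) (fill (zone zero b z) c)

    D : Pos → Dir
    D c@(_ , y , _) = slice (zone p m y) c

    -- Both sides locate the i-th cell of the right arm of the torus: from the hole of the second
    -- stack, and from the left edge of the torus across its left arm and its hole.
    C-width : ∀ i → A + (r + i) ≡ r + (p + (r + r) + i)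
    C-width i rewrite outer-≡ r p = h r p i
      where
      h : ∀ r p i → r + (p + r) + (r + i) ≡ r + (p + (r + r) + i)
      h = solve-∀

    X-width : r + (C + r) ≡ X
    X-width rewrite outer-≡ r p | outer-≡ p (r + r) = h r p
      where
      h : ∀ r p → r + (p + (r + r + p) + r) ≡ r + (p + r) + (r + (p + r))
      h = solve-∀

    tube-C : ∀ {i k c a} → i < p → k < q → tube (zone r p (r + i)) (zone r q (r + k)) c a ≡ c
    tube-C li lk rewrite zone-inside r li | zone-inside r lk = refl

    tube-A : ∀ {i k c a} → Ann p q r i k → tube (zone r p i) (zone r q k) c a ≡ a
    tube-A {i} {k} an with inZone r p i | inZone r q k
    ... | isBelow l | _ rewrite zone-below p l = refl
    ... | isAbove t | _ rewrite zone-above r p t = refl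
    ... | isInside t l | isBelow l′ rewrite zone-inside r l | zone-below q l′ = refl
    ... | isInside t l | isAbove t′ rewrite zone-inside r l | zone-above r q t′ = refl
    ... | isInside t l | isInside t′ l′ = ⊥-elim (ann-core r l l′ an)

    slice-out : ∀ {w} → Out w → ∀ x y z → slice w (x , y , z) ≡ tube (zone r q z) (zone r C x) (inC (x , y , z)) (fill (zone zero b z) (x , y , z))
    slice-out below x y z = refl
    slice-out above x y z = refl

    out-below : ∀ {a n t} → t < a → Out (zone a n t)
    out-below {n = n} l rewrite zone-below n l = below

    out-above : ∀ a n t → Out (zone a n (a + n + t))
    out-above a n t rewrite zone-above a n t = above

    inC-at : ∀ i j k → inC (r + i , j , k) ≡ embXY (ann (even (r + i , j , k)) p (r + r) m i j)
    inC-at i j k rewrite m+n∸m≡n r i = refl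

    D-C : ∀ {i j k} → Ann (r + r) m p i j → k < q →
      D (r + i , j , r + k) ≡ embXY (ann (even (r + i , j , r + k)) p (r + r) m i j)
    D-C {i} {j} {k} an lk = trans (go (inZone p m j) (inZone p (r + r) i) an) (inC-at i j (r + k))
      where
      ends : ∀ {i j} → Out (zone p m j) → i < C → D (r + i , j , r + k) ≡ inC (r + i , j , r + k)
      ends {i} {j} o li rewrite slice-out o (r + i) j (r + k) | zone-inside r lk | zone-inside r li = refl
      go : ∀ {i j} → InZone p m j → InZone p (r + r) i → Ann (r + r) m p i j → D (r + i , j , r + k) ≡ inC (r + i , j , r + k)
      go (isBelow l) _ an = ends (out-below l) (proj₁ (ann-bounds an))
      go (isAbove t) _ an = ends (out-above p m t) (proj₁ (ann-bounds an))
      go {i} (isInside j lj) (isBelow li) an rewrite zone-inside p lj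
        | zone-inside zero {A} {r + i} (≤-trans (+-monoʳ-< r li) (≤-trans (+-monoʳ-≤ r (m≤m+n p r)) (≤-reflexive (sym (outer-≡ r p))))) = tube-C li lk
      go (isInside j lj) (isInside i li) an = ⊥-elim (ann-core p li lj an)
      go (isInside j lj) (isAbove i) an rewrite zone-inside p lj
        | sym (C-width i) | zone-above zero A (r + i) = tube-C (+-cancelˡ-< (p + (r + r)) i p (≤-trans (proj₁ (ann-bounds an)) (≤-reflexive (sym (outer-+ p (r + r)))))) lk

    D-A₁ : ∀ {i j k} → Ann p q r i k → j < m → D (i , p + j , k) ≡ inA false (i , p + j , k) i
    D-A₁ an lj rewrite zone-inside p lj | zone-inside zero (proj₁ (ann-bounds an)) = tube-A an

    D-A₂ : ∀ {i j k} → Ann p q r i k → j < m → D (A + i , p + j , k) ≡ inA true (A + i , p + j , k) i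
    D-A₂ {i} an lj rewrite zone-inside p lj | zone-above zero A i = tube-A an

    tube-out₁ : ∀ {w w′ c a} → Out w → tube w w′ c a ≡ a
    tube-out₁ below = refl
    tube-out₁ above = refl

    tube-out₂ : ∀ w {w′ c a} → Out w′ → tube w w′ c a ≡ a
    tube-out₂ below _ = refl
    tube-out₂ (above _) _ = refl
    tube-out₂ (inside _) below = refl
    tube-out₂ (inside _) above = refl

    D-F₀ : ∀ {x y z} → Out (zone p m y) → z < b → D (x , y , z) ≡ lineX x
    D-F₀ {x} {y} {z} o l = trans (slice-out o x y z) (trans (tube-out₁ (out-below (<-≤-trans l b≤r)))
      (cong (λ w → fill w (x , y , z)) (zone-inside zero l)))

    D-Fx : ∀ {i y k} → Out (zone p m y) → Out (zone r q (b + k)) → i < C → D (r + i , y , b + k) ≡ lineX i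
    D-Fx {i} {y} {k} o o′ l = trans (slice-out o (r + i) y (b + k)) (trans (tube-out₁ o′)
      (trans (cong (λ w → fill w (r + i , y , b + k)) (zone-above zero b k)) (cong (λ w → column w k) (zone-inside r l))))

    D-Fz : ∀ {x y k} → Out (zone p m y) → Out (zone r C x) → D (x , y , b + k) ≡ lineZ k
    D-Fz {x} {y} {k} o o′ = trans (slice-out o x y (b + k)) (trans (tube-out₂ (zone r q (b + k)) o′)
      (trans (cong (λ w → fill w (x , y , b + k)) (zone-above zero b k)) (col o′)))
      where
      col : ∀ {w} → Out w → column w k ≡ lineZ k
      col below = refl
      col above = refl

    Has : Pos → Set
    Has c = ∃ λ c′ → Nb c (D c) c′ × In X Y Z c′ × D c′ ≡ opp (D c)

    has : ∀ {c c′ d} → D c ≡ d → Nb c d c′ → In X Y Z c′ → D c′ ≡ opp d → Has c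
    has {c} {c′} e n i o = c′ , subst (λ d → Nb c d c′) (sym e) n , i , trans o (cong opp (sym e))

    C-in : ∀ {i j k} → Ann (r + r) m p i j → k < q → In X Y Z (r + i , j , r + k)
    C-in {k = k} an lk =
      ≤-trans (+-monoʳ-< r (proj₁ (ann-bounds an))) (≤-trans (+-monoʳ-≤ r (m≤m+n C r)) (≤-reflexive X-width))
      , proj₂ (ann-bounds an)
      , ≤-trans (+-monoʳ-< r lk) (≤-trans (+-monoʳ-≤ r (m≤m+n q r)) (≤-reflexive (sym (outer-≡ r q))))

    has-C : ∀ {i j k} → Ann (r + r) m p i j → k < q → Has (r + i , j , r + k)
    has-C {i} {j} {k} an lk with ann-partner (even (r + i , j , r + k)) p an
    ... | i′ , j′ , n , an′ , o = has (D-C an lk) n³ (C-in an′ lk)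
      (trans (D-C an′ lk) (trans (cong (λ β → embXY (ann β p (r + r) m i′ j′)) (even-Nb n³)) (trans (cong embXY o) (embXY-opp _))))
      where
      n³ = Nb-XY r {z = r + k} n

    A<X : ∀ {i} → i < A → A + i < X
    A<X l = +-monoʳ-< A l

    Y-mid : ∀ {j} → j < m → p + j < Y
    Y-mid l = ≤-trans (+-monoʳ-< p l) (≤-trans (+-monoʳ-≤ p (m≤m+n m p)) (≤-reflexive (sym (outer-≡ p m))))

    has-A₁ : ∀ {i j k} → Ann p q r i k → j < m → Has (i , p + j , k)
    has-A₁ {i} {j} {k} an lj with ann-partner (even (i , p + j , k) xor ε) r an
    ... | i′ , k′ , n , an′ , o = has (D-A₁ an lj) n³
      (≤-trans (proj₁ (ann-bounds an′)) (m≤m+n A A) , Y-mid lj , proj₂ (ann-bounds an′))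
      (trans (D-A₁ an′ lj) (trans (cong (λ β → embXZ (ann (β xor ε) r p q i′ k′)) (even-Nb n³))
        (trans (cong (λ β → embXZ (ann β r p q i′ k′)) (not-xor (even (i , p + j , k)) ε)) (trans (cong embXZ o) (embXZ-opp _)))))
      where
      n³ = Nb-XZ 0 {y = p + j} n

    has-A₂ : ∀ {i j k} → Ann p q r i k → j < m → Has (A + i , p + j , k)
    has-A₂ {i} {j} {k} an lj with ann-partner (not (even (A + i , p + j , k) xor ε)) r an
    ... | i′ , k′ , n , an′ , o = has (D-A₂ an lj) n³
      (A<X (proj₁ (ann-bounds an′)) , Y-mid lj , proj₂ (ann-bounds an′))
      (trans (D-A₂ an′ lj) (trans (cong (λ β → embXZ (ann (not (β xor ε)) r p q i′ k′)) (even-Nb n³))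
        (trans (cong (λ β → embXZ (ann (not β) r p q i′ k′)) (not-xor (even (A + i , p + j , k)) ε)) (trans (cong embXZ o) (embXZ-opp _)))))
      where
      n³ = Nb-XZ A {y = p + j} n

    has-lineX : ∀ a n {y z} → y < Y → z < Z → a + (n + n) ≤ X → (∀ t → t < n + n → D (a + t , y , z) ≡ lineX t) →
      ∀ {t} → t < n + n → Has (a + t , y , z)
    has-lineX a n ly lz le e {t} l with ev t in et
    ... | true = has (trans (e t l) (cong (λ β → if β then +x else -x) et)) (nb-E (+-suc a t))
      (<-≤-trans (+-monoʳ-< a (even-succ {n = n} l et)) le , ly , lz)
      (trans (e (suc t) (even-succ {n = n} l et)) (cong (λ β → if not β then +x else -x) et))
    ... | false with odd-pred {t} et
    ...   | t′ , refl , et′ = has (trans (e t l) (cong (λ β → if β then +x else -x) et)) (nb-W (+-suc a t′))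
      (<-≤-trans (+-monoʳ-< a l′) le , ly , lz)
      (trans (e t′ l′) (cong (λ β → if β then +x else -x) et′))
      where
      l′ : t′ < n + n
      l′ = <-trans (n<1+n t′) l

    has-lineZ : ∀ {x y} → x < X → y < Y → (∀ t → D (x , y , b + t) ≡ lineZ t) → ∀ {t} → t < l + l → Has (x , y , b + t)
    has-lineZ {x} {y} lx ly e {t} lt with ev t in et
    ... | true = has (trans (e t) (cong (λ β → if β then +z else -z) et)) (subst (λ s → Nb (x , y , b + t) +z (x , y , s)) (sym (+-suc b t)) n+z)
      (lx , ly , subst (b + suc t <_) (sym b+2l) (+-monoʳ-< b (even-succ {n = l} lt et)))
      (trans (e (suc t)) (cong (λ β → if not β then +z else -z) et))
    ... | false with odd-pred {t} et
    ...   | t′ , refl , et′ = has (trans (e t) (cong (λ β → if β then +z else -z) et)) (subst (λ s → Nb (x , y , s) -z (x , y , b + t′)) (sym (+-suc b t′)) n-z)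
      (lx , ly , subst (b + t′ <_) (sym b+2l) (+-monoʳ-< b (<-trans (n<1+n t′) lt)))
      (trans (e t′) (cong (λ β → if β then +z else -z) et′))

    C-even : C ≡ (p + r) + (p + r)
    C-even rewrite outer-≡ p (r + r) = h p r
      where
      h : ∀ p r → p + (r + r + p) ≡ p + r + (p + r)
      h = solve-∀

    tube-cover : ∀ {i k} → i < A → k < Z → (∃ λ i′ → ∃ λ k′ → i ≡ r + i′ × k ≡ r + k′ × i′ < p × k′ < q) ⊎ Ann p q r i k
    tube-cover {i} {k} li lk with inZone r p i | inZone r q k
    ... | isBelow l | _ = inj₂ (ann-left r l lk)
    ... | isAbove t | _ = inj₂ (ann-right r (+-cancelˡ-< (r + p) t r (≤-trans li (≤-reflexive (sym (outer-+ r p))))) lk)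
    ... | isInside t l | isBelow l′ = inj₂ (transpose (ann-left r l′ li))
    ... | isInside t l | isAbove t′ = inj₂ (transpose (ann-right r (+-cancelˡ-< (r + q) t′ r (≤-trans lk (≤-reflexive (sym (outer-+ r q))))) li))
    ... | isInside t l | isInside t′ l′ = inj₁ (t , t′ , refl , refl , l , l′)

    end : ∀ {x y z} → In X Y Z (x , y , z) → Out (zone p m y) → (∀ {i} → i < C → Ann (r + r) m p i y) → Has (x , y , z)
    end {x} {y} {z} (lx , ly , lz) o an with inZone zero b z
    ... | isInside z lb = has-lineX 0 A ly lz ≤-refl (λ t _ → D-F₀ o lb) lx
    ... | isAbove k with inZone r C x
    ...   | isBelow l′ = has-lineZ lx ly (λ t → D-Fz o (out-below l′)) (+-cancelˡ-< b k (l + l) (subst (b + k <_) b+2l lz))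
    ...   | isAbove t = has-lineZ lx ly (λ t → D-Fz o (out-above r C _)) (+-cancelˡ-< b k (l + l) (subst (b + k <_) b+2l lz))
    ...   | isInside i li = cross (inZone r q (b + k)) lz refl
      where
      across : Out (zone r q (b + k)) → Has (r + i , y , b + k)
      across o′ = has-lineX r (p + r) ly lz (≤-trans (+-monoʳ-≤ r (≤-trans (≤-reflexive (sym C-even)) (m≤m+n C r))) (≤-reflexive X-width))
        (λ t lt → D-Fx o o′ (subst (t <_) (sym C-even) lt)) (subst (i <_) C-even li)
      cross : ∀ {z} → InZone r q z → z < Z → z ≡ b + k → Has (r + i , y , b + k)
      cross (isBelow l′) _ e = across (subst (λ z → Out (zone r q z)) e (out-below l′))
      cross (isAbove t) _ e = across (subst (λ z → Out (zone r q z)) e (out-above r q t))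
      cross (isInside t l′) _ e = subst (λ z → Has (r + i , y , z)) e (has-C (an li) l′)

    valid : Valid (In X Y Z) D
    valid (x , y , z) (lx , ly , lz) with inZone p m y
    ... | isBelow l′ = end (lx , ly , lz) (out-below l′) (λ li → transpose (ann-left p l′ li))
    ... | isAbove t = end (lx , ly , lz) (out-above p m t) (λ li → transpose (ann-right p (+-cancelˡ-< (p + m) t p (≤-trans ly (≤-reflexive (sym (outer-+ p m))))) li))
    ... | isInside j lj with inZone zero A x
    ...   | isInside i li with tube-cover li lz
    ...     | inj₂ an = has-A₁ an lj
    ...     | inj₁ (i′ , k′ , refl , refl , li′ , lk′) = has-C (ann-left p li′ ly) lk′
    valid (x , y , z) (lx , ly , lz) | isInside j lj | isAbove i with tube-cover (+-cancelˡ-< A i A lx) lz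
    ...     | inj₂ an = has-A₂ an lj
    ...     | inj₁ (i′ , k′ , refl , refl , li′ , lk′) =
      subst (λ x → Has (x , p + j , r + k′)) (sym (C-width i′)) (has-C (ann-right p li′ ly) lk′)

-- The contribution of the linked rings to the twist.

module LinkedTwist where

  open Sums
  open Helicity using (sg)
  open Partner
  open Annulus
  open Linked
  open Achievable
  open import Data.Bool using (Bool; true; false; not; if_then_else_; _xor_)
  open import Data.Nat as ℕ using (ℕ; zero; suc; _<_)
  import Data.Nat.Properties as ℕP
  open import Data.Integer using (ℤ; -_; _+_; _*_; _-_; _≤_; 0ℤ; 1ℤ; -1ℤ) renaming (+_ to pos)
  open import Data.Integer.Properties
  open import Data.Integer.Tactic.RingSolver using (solve-∀)
  open import Data.Product using (_×_; _,_; ∃; proj₁; proj₂)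
  open import Data.Sum using (_⊎_; inj₁; inj₂)
  open import Data.Empty using (⊥-elim)
  open import Relation.Binary.PropositionalEquality

  sg-ev : ∀ n → sg n ≡ (if ev n then 1ℤ else -1ℤ)
  sg-ev zero = refl
  sg-ev (suc n) rewrite sg-ev n with ev n
  ... | true = refl
  ... | false = refl

  signOf : Bool → ℤ
  signOf true  = -1ℤ
  signOf false = 1ℤ

  -- The alternation along a ring and the colouring cancel, so that w is constant along a straight
  -- piece: the ring acts as a steady current.
  down-Z : ∀ n ε → sg n * cZ (embXZ (if (ev n xor ε) then S else N)) ≡ - signOf ε
  down-Z n ε rewrite sg-ev n with ev n | ε
  ... | true  | true  = refl
  ... | true  | false = refl
  ... | false | true  = refl
  ... | false | false = refl

  up-Z : ∀ n ε → sg n * cZ (embXZ (if (ev n xor ε) then N else S)) ≡ signOf ε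
  up-Z n ε rewrite sg-ev n with ev n | ε
  ... | true  | true  = refl
  ... | true  | false = refl
  ... | false | true  = refl
  ... | false | false = refl

  down-Z′ : ∀ n ε → sg n * cZ (embXZ (if not (ev n xor ε) then N else S)) ≡ - signOf ε
  down-Z′ n ε rewrite sg-ev n with ev n | ε
  ... | true  | true  = refl
  ... | true  | false = refl
  ... | false | true  = refl
  ... | false | false = refl

  up-Z′ : ∀ n ε → sg n * cZ (embXZ (if not (ev n xor ε) then S else N)) ≡ signOf ε
  up-Z′ n ε rewrite sg-ev n with ev n | ε
  ... | true  | true  = refl
  ... | true  | false = refl
  ... | false | true  = refl
  ... | false | false = refl

  down-Y : ∀ n → sg n * cY (embXY (if ev n then S else N)) ≡ -1ℤ
  down-Y n rewrite sg-ev n with ev n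
  ... | true  = refl
  ... | false = refl

  up-Y : ∀ n → sg n * cY (embXY (if ev n then N else S)) ≡ 1ℤ
  up-Y n rewrite sg-ev n with ev n
  ... | true  = refl
  ... | false = refl

  Y-XZ : ∀ d → cY (embXZ d) ≡ 0ℤ
  Y-XZ E = refl
  Y-XZ N = refl
  Y-XZ W = refl
  Y-XZ S = refl

  Z-XY : ∀ d → cZ (embXY d) ≡ 0ℤ
  Z-XY E = refl
  Z-XY N = refl
  Z-XY W = refl
  Z-XY S = refl

  flat-Y : ∀ {d e} s → d ≡ embXZ e → s * cY d ≡ 0ℤ
  flat-Y {e = e} s refl = trans (cong (s *_) (Y-XZ e)) (*-zeroʳ s)

  flat-Z : ∀ {d e} s → d ≡ embXY e → s * cZ d ≡ 0ℤ
  flat-Z {e = e} s refl = trans (cong (s *_) (Z-XY e)) (*-zeroʳ s)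

  -- The walk traces three sides of an r × p rectangle: out through one wall of the stack, across an
  -- arm of the torus, back through the other wall. Twice the enclosed area is 2 r p up to sign, and
  -- the v-displacement returns to zero.
  wall-arm-wall : ∀ r p u v a c →
    (∀ i → i < r → u i ≡ 0ℤ × v i ≡ a) →
    (∀ i → i < p → u (r ℕ.+ i) ≡ c × v (r ℕ.+ i) ≡ 0ℤ) →
    (∀ i → i < r → u (r ℕ.+ p ℕ.+ i) ≡ 0ℤ × v (r ℕ.+ p ℕ.+ i) ≡ - a) →
    Area (r ℕ.+ p ℕ.+ r) u v ≡ pos 2 * (a * c) * (pos r * pos p) × Σ< (r ℕ.+ p ℕ.+ r) v ≡ 0ℤ
  wall-arm-wall r p u v a c e₁ e₂ e₃ =
    trans (Area-split (r ℕ.+ p) r u v)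
      (trans (cong₂ _+_ (cong₂ _+_ (trans (Area-split r p u v) (cong₂ _+_ (cong₂ _+_ A₁ A₂) (cong₂ _-_ (cong₂ _*_ U₂ V₁) (cong₂ _*_ V₂ U₁)))) A₃)
        (cong₂ _-_ (cong₂ _*_ U₃ (trans (Σ-split r p v) (cong₂ _+_ V₁ V₂))) (cong₂ _*_ V₃ (trans (Σ-split r p u) (cong₂ _+_ U₁ U₂)))))
        (h a c (pos r) (pos p)))
    , trans (Σ-split (r ℕ.+ p) r v) (trans (cong₂ _+_ (trans (Σ-split r p v) (cong₂ _+_ V₁ V₂)) V₃) (h′ a (pos r) (pos p)))
    where
    U₁ : Σ< r u ≡ pos r * 0ℤ
    U₁ = trans (Σ-cong r λ i l → proj₁ (e₁ i l)) (Σ-const r 0ℤ)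
    V₁ : Σ< r v ≡ pos r * a
    V₁ = trans (Σ-cong r λ i l → proj₂ (e₁ i l)) (Σ-const r a)
    U₂ : Σ< p (λ i → u (r ℕ.+ i)) ≡ pos p * c
    U₂ = trans (Σ-cong p λ i l → proj₁ (e₂ i l)) (Σ-const p c)
    V₂ : Σ< p (λ i → v (r ℕ.+ i)) ≡ pos p * 0ℤ
    V₂ = trans (Σ-cong p λ i l → proj₂ (e₂ i l)) (Σ-const p 0ℤ)
    U₃ : Σ< r (λ i → u (r ℕ.+ p ℕ.+ i)) ≡ pos r * 0ℤ
    U₃ = trans (Σ-cong r λ i l → proj₁ (e₃ i l)) (Σ-const r 0ℤ)
    V₃ : Σ< r (λ i → v (r ℕ.+ p ℕ.+ i)) ≡ pos r * - a
    V₃ = trans (Σ-cong r λ i l → proj₂ (e₃ i l)) (Σ-const r (- a))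
    A₁ : Area r u v ≡ 0ℤ
    A₁ = trans (Area-cong r (λ i l → proj₁ (e₁ i l)) (λ i l → proj₂ (e₁ i l))) (Area-const r 0ℤ a)
    A₂ : Area p (λ i → u (r ℕ.+ i)) (λ i → v (r ℕ.+ i)) ≡ 0ℤ
    A₂ = trans (Area-cong p (λ i l → proj₁ (e₂ i l)) (λ i l → proj₂ (e₂ i l))) (Area-const p c 0ℤ)
    A₃ : Area r (λ i → u (r ℕ.+ p ℕ.+ i)) (λ i → v (r ℕ.+ p ℕ.+ i)) ≡ 0ℤ
    A₃ = trans (Area-cong r (λ i l → proj₁ (e₃ i l)) (λ i l → proj₂ (e₃ i l))) (Area-const r 0ℤ (- a))
    h : ∀ a c r p → 0ℤ + 0ℤ + (p * c * (r * a) - p * 0ℤ * (r * 0ℤ)) + 0ℤ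
      + (r * 0ℤ * (r * a + p * 0ℤ) - r * - a * (r * 0ℤ + p * c)) ≡ pos 2 * (a * c) * (r * p)
    h = solve-∀
    h′ : ∀ a r p → r * a + p * 0ℤ + r * - a ≡ 0ℤ
    h′ = solve-∀

  module LinkLines (r p q m b l : ℕ) (b+2l : outer r q ≡ b ℕ.+ (l ℕ.+ l)) (b≤r : b ℕ.≤ r) (ε : Bool) where

    open Link r p q m b l b+2l b≤r ε

    line : ℕ → ℕ → ℤ
    line y z = Area X (λ x → wY D x y z) (λ x → wZ D x y z)

    Z-mid : ∀ {k} → k < q → r ℕ.+ k < Z
    Z-mid l = ℕP.≤-trans (ℕP.+-monoʳ-< r l) (ℕP.≤-trans (ℕP.+-monoʳ-≤ r (ℕP.m≤m+n q r)) (ℕP.≤-reflexive (sym (outer-≡ r q))))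

    -- Both halves contribute with the same sign, since the arm of the torus and the stack around it
    -- both reverse from one half to the other. The cross term vanishes because each half has no
    -- displacement along z.
    line-core : ∀ {j k} → j < m → k < q → line (p ℕ.+ j) (r ℕ.+ k) ≡ pos 4 * (signOf ε * (pos r * pos p))
    line-core {j} {k} lj lk =
      trans (Area-split A A fy fz)
        (trans (cong₂ _+_ (cong₂ _+_ (at (λ n → Area n fy fz) (proj₁ half₁)) (at (λ n → Area n fy′ fz′) (proj₁ half₂)))
            (cong₂ _-_ (cong₂ _*_ (refl {x = Σ< A fy′}) (at (λ n → Σ< n fz) (proj₂ half₁))) (cong₂ _*_ (at (λ n → Σ< n fz′) (proj₂ half₂)) (refl {x = Σ< A fy}))))
          (h (signOf ε) (pos r) (pos p) (Σ< A fy′) (Σ< A fy)))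
      where
      fy fz fy′ fz′ : ℕ → ℤ
      fy x = wY D x (p ℕ.+ j) (r ℕ.+ k)
      fz x = wZ D x (p ℕ.+ j) (r ℕ.+ k)
      fy′ x = fy (A ℕ.+ x)
      fz′ x = fz (A ℕ.+ x)
      A-≡ : r ℕ.+ p ℕ.+ r ≡ A
      A-≡ = outer-+ r p
      at : ∀ (f : ℕ → ℤ) {c} → f (r ℕ.+ p ℕ.+ r) ≡ c → f A ≡ c
      at f e = trans (cong f (sym A-≡)) e
      h : ∀ e r p x y → pos 2 * (- e * -1ℤ) * (r * p) + pos 2 * (e * 1ℤ) * (r * p) + (x * 0ℤ - 0ℤ * y) ≡ pos 4 * (e * (r * p))
      h = solve-∀
      n : ℕ → ℕ
      n x = x ℕ.+ (p ℕ.+ j) ℕ.+ (r ℕ.+ k)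
      value : ∀ {x d} (c : Dir → ℤ) {t} → D (x , p ℕ.+ j , r ℕ.+ k) ≡ d → sg (n x) * c d ≡ t → sg (n x) * c (D (x , p ℕ.+ j , r ℕ.+ k)) ≡ t
      value c refl e = e
      A₁ : ∀ {i} (an : Ann p q r i (r ℕ.+ k)) {d} → ann (ev (n i) xor ε) r p q i (r ℕ.+ k) ≡ d → D (i , p ℕ.+ j , r ℕ.+ k) ≡ embXZ d
      A₁ an e = trans (D-A₁ an lj) (cong embXZ e)
      A₂ : ∀ {i} (an : Ann p q r i (r ℕ.+ k)) {d} → ann (not (ev (n (A ℕ.+ i)) xor ε)) r p q i (r ℕ.+ k) ≡ d → D (A ℕ.+ i , p ℕ.+ j , r ℕ.+ k) ≡ embXZ d
      A₂ an e = trans (D-A₂ an lj) (cong embXZ e)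
      C₁ : ∀ {i} (an : Ann (r ℕ.+ r) m p i (p ℕ.+ j)) {d} → ann (ev (n (r ℕ.+ i))) p (r ℕ.+ r) m i (p ℕ.+ j) ≡ d → D (r ℕ.+ i , p ℕ.+ j , r ℕ.+ k) ≡ embXY d
      C₁ an e = trans (D-C an lk) (cong embXY e)
      half₁ : Area (r ℕ.+ p ℕ.+ r) fy fz ≡ pos 2 * (- signOf ε * -1ℤ) * (pos r * pos p) × Σ< (r ℕ.+ p ℕ.+ r) fz ≡ 0ℤ
      half₁ = wall-arm-wall r p fy fz (- signOf ε) -1ℤ
        (λ i li → flat-Y (sg (n i)) (A₁ (ann-left r li (Z-mid lk)) refl)
                , value cZ (A₁ (ann-left r li (Z-mid lk)) (ann-straightˡ _ r li lk)) (down-Z (n i) ε))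
        (λ i li → value cY (C₁ (ann-left p li (Y-mid lj)) (ann-straightˡ _ p li lj)) (down-Y (n (r ℕ.+ i)))
                , flat-Z (sg (n (r ℕ.+ i))) (C₁ (ann-left p li (Y-mid lj)) refl))
        (λ i li → flat-Y (sg (n (r ℕ.+ p ℕ.+ i))) (A₁ (ann-right r li (Z-mid lk)) refl)
                , trans (value cZ (A₁ (ann-right r li (Z-mid lk)) (ann-straightʳ _ r li lk)) (up-Z (n (r ℕ.+ p ℕ.+ i)) ε)) (sym (neg-involutive _)))
      half₂ : Area (r ℕ.+ p ℕ.+ r) fy′ fz′ ≡ pos 2 * (signOf ε * 1ℤ) * (pos r * pos p) × Σ< (r ℕ.+ p ℕ.+ r) fz′ ≡ 0ℤ
      half₂ = wall-arm-wall r p fy′ fz′ (signOf ε) 1ℤ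
        (λ i li → flat-Y (sg (n (A ℕ.+ i))) (A₂ (ann-left r li (Z-mid lk)) refl)
                , value cZ (A₂ (ann-left r li (Z-mid lk)) (ann-straightˡ _ r li lk)) (up-Z′ (n (A ℕ.+ i)) ε))
        (λ i li → subst (λ x → sg (n x) * cY (D (x , p ℕ.+ j , r ℕ.+ k)) ≡ 1ℤ) (sym (C-width i))
                    (value cY (C₁ (ann-right p li (Y-mid lj)) (ann-straightʳ _ p li lj)) (up-Y (n (r ℕ.+ (p ℕ.+ (r ℕ.+ r) ℕ.+ i)))))
                , subst (λ x → sg (n x) * cZ (D (x , p ℕ.+ j , r ℕ.+ k)) ≡ 0ℤ) (sym (C-width i))
                    (flat-Z (sg (n (r ℕ.+ (p ℕ.+ (r ℕ.+ r) ℕ.+ i)))) (C₁ (ann-right p li (Y-mid lj)) refl)))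
        (λ i li → flat-Y (sg (n (A ℕ.+ (r ℕ.+ p ℕ.+ i)))) (A₂ (ann-right r li (Z-mid lk)) refl)
                , value cZ (A₂ (ann-right r li (Z-mid lk)) (ann-straightʳ _ r li lk)) (down-Z′ (n (A ℕ.+ (r ℕ.+ p ℕ.+ i))) ε))

    -- At these heights the line passes below or above the torus and meets only rings in the
    -- xz-plane, whose steps have no y-component.
    line-flat : ∀ {j z} → j < m → z < Z → (∀ k → k < q → z ≢ r ℕ.+ k) → line (p ℕ.+ j) z ≡ 0ℤ
    line-flat {j} {z} lj lz ne = Area-zeroˡ X _ _ λ x lx → flat x lx (inZone zero A x)
      where
      flat : ∀ x → x < X → InZone zero A x → wY D x (p ℕ.+ j) z ≡ 0ℤ
      flat _ lx (isInside i li) with tube-cover li lz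
      ... | inj₁ (_ , k , _ , e , _ , lk) = ⊥-elim (ne k lk e)
      ... | inj₂ an = flat-Y (color i (p ℕ.+ j) z) (D-A₁ an lj)
      flat _ lx (isAbove i) with tube-cover (ℕP.+-cancelˡ-< A i A lx) lz
      ... | inj₁ (_ , k , _ , e , _ , lk) = ⊥-elim (ne k lk e)
      ... | inj₂ an = flat-Y (color (A ℕ.+ i) (p ℕ.+ j) z) (D-A₂ an lj)

    slab : ℕ → ℤ
    slab y = Σ< Z (line y)

    slab-mid : ∀ {j} → j < m → slab (p ℕ.+ j) ≡ pos q * (pos 4 * (signOf ε * (pos r * pos p)))
    slab-mid {j} lj = trans (cong (λ n → Σ< n (line (p ℕ.+ j))) (outer-≡ r q))
      (trans (Σ-split r (q ℕ.+ r) _) (trans (cong₂ _+_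
        (Σ-zero′ r λ z lz → line-flat lj (ℕP.<-≤-trans lz r≤Z) λ k _ e → ℕP.<-irrefl e (ℕP.<-≤-trans lz (ℕP.m≤m+n r k)))
        (trans (Σ-split q r _) (cong₂ _+_ (trans (Σ-cong q λ k lk → line-core lj lk) (Σ-const q _))
          (Σ-zero′ r λ t lt → line-flat lj (t-in lt) λ k lk e → ℕP.<-irrefl (ℕP.+-cancelˡ-≡ r _ _ (sym e)) (ℕP.<-≤-trans lk (ℕP.m≤m+n q t))))))
        (trans (+-identityˡ _) (+-identityʳ _))))
      where
      r≤Z : r ℕ.≤ Z
      r≤Z = ℕP.≤-trans (ℕP.m≤m+n r (q ℕ.+ r)) (ℕP.≤-reflexive (sym (outer-≡ r q)))
      t-in : ∀ {t} → t < r → r ℕ.+ (q ℕ.+ t) < Z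
      t-in lt = ℕP.≤-trans (ℕP.+-monoʳ-< r (ℕP.+-monoʳ-< q lt)) (ℕP.≤-reflexive (sym (outer-≡ r q)))

    Qx-split : Qx X Y Z D ≡ Σ< p slab + Σ< p (λ t → slab (p ℕ.+ (m ℕ.+ t))) + pos m * (pos q * (pos 4 * (signOf ε * (pos r * pos p))))
    Qx-split = trans (cong (λ n → Σ< n slab) (outer-≡ p m))
      (trans (Σ-split p (m ℕ.+ p) slab) (trans (cong (Σ< p slab +_)
        (trans (Σ-split m p _) (cong (_+ Σ< p (λ t → slab (p ℕ.+ (m ℕ.+ t)))) (trans (Σ-cong m λ j lj → slab-mid lj) (Σ-const m _)))))
        (h (Σ< p slab) _ _)))
      where
      h : ∀ a b c → a + (c + b) ≡ a + b + c
      h = solve-∀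

  module _ (r p q m b l : ℕ) (b+2l : outer r q ≡ b ℕ.+ (l ℕ.+ l)) (b≤r : b ℕ.≤ r) where

    private
      module L₊ = Link r p q m b l b+2l b≤r false
      module L₋ = Link r p q m b l b+2l b≤r true
      module Q₊ = LinkLines r p q m b l b+2l b≤r false
      module Q₋ = LinkLines r p q m b l b+2l b≤r true

    -- `ε` enters only through the stacks, and these occupy the range p ≤ y < p + m.
    ends-agree : ∀ {y} → Out (zone p m y) → Q₊.slab y ≡ Q₋.slab y
    ends-agree {y} o = Σ-cong′ L₊.Z λ z → Area-cong L₊.X (λ x _ → cong (λ d → color x y z * cY d) (same x z)) (λ x _ → cong (λ d → color x y z * cZ d) (same x z))
      where
      same : ∀ x z → L₊.D (x , y , z) ≡ L₋.D (x , y , z)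
      same x z = trans (L₊.slice-out o x y z) (sym (L₋.slice-out o x y z))

    -- Reversing the two stacks of rings changes Qx by 8 p q r m, so one orientation is good.
    LB-link : LB L₊.X L₊.Y L₊.Z (r ℕ.* p ℕ.* (q ℕ.* m))
    LB-link = choose (≤-total 0ℤ ends)
      where
      ends ends₋ k : ℤ
      ends = Σ< p Q₊.slab + Σ< p (λ t → Q₊.slab (p ℕ.+ (m ℕ.+ t)))
      ends₋ = Σ< p Q₋.slab + Σ< p (λ t → Q₋.slab (p ℕ.+ (m ℕ.+ t)))
      k = pos m * (pos q * (pos 4 * (1ℤ * (pos r * pos p))))
      ends-≡ : ends₋ ≡ ends
      ends-≡ = sym (cong₂ _+_ (Σ-cong p λ t l → ends-agree (L₊.out-below l))
        (Σ-cong p λ t l → ends-agree (subst (λ y → Out (zone p m y)) (ℕP.+-assoc p m t) (L₊.out-above p m t))))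
      h : ∀ r p q m → m * (q * (pos 4 * (1ℤ * (r * p)))) ≡ pos 4 * (r * p * (q * m))
      h = solve-∀
      h₋ : ∀ e r p q m → - (e + m * (q * (pos 4 * (-1ℤ * (r * p))))) ≡ - e + m * (q * (pos 4 * (1ℤ * (r * p))))
      h₋ = solve-∀
      k-≡ : k ≡ pos (4 ℕ.* (r ℕ.* p ℕ.* (q ℕ.* m)))
      k-≡ = trans (h (pos r) (pos p) (pos q) (pos m)) (trans (cong (pos 4 *_)
        (trans (cong₂ _*_ (sym (pos-* r p)) (sym (pos-* q m))) (sym (pos-* (r ℕ.* p) (q ℕ.* m))))) (sym (pos-* 4 (r ℕ.* p ℕ.* (q ℕ.* m)))))
      choose : 0ℤ ≤ ends ⊎ ends ≤ 0ℤ → LB L₊.X L₊.Y L₊.Z (r ℕ.* p ℕ.* (q ℕ.* m))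
      choose (inj₁ e≥0) = lb L₊.D L₊.valid
        (subst₂ _≤_ (trans (+-identityˡ k) k-≡) (sym Q₊.Qx-split) (+-monoˡ-≤ k e≥0))
      -- With reversed stacks the form is `ends` - `k`, and its negative is at least `k`.
      choose (inj₂ e≤0) = LB-neg {D = L₋.D} L₋.valid
        (subst₂ _≤_ (trans (+-identityˡ k) k-≡)
          (sym (trans (cong -_ (trans Q₋.Qx-split (cong (_+ pos m * (pos q * (pos 4 * (-1ℤ * (pos r * pos p))))) ends-≡)))
            (h₋ ends (pos r) (pos p) (pos q) (pos m))))
          (+-monoˡ-≤ k (neg-mono-≤ e≤0)))

  half-of : ∀ n → ∃ λ b → ∃ λ l → n ≡ b ℕ.+ (l ℕ.+ l) × b ℕ.≤ 1
  half-of zero = 0 , 0 , refl , ℕ.z≤n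
  half-of (suc zero) = 1 , 0 , refl , ℕP.≤-refl
  half-of (suc (suc n)) with half-of n
  ... | b , l , e , b≤1 = b , suc l , trans (cong (λ n → suc (suc n)) e)
    (trans (cong suc (sym (ℕP.+-suc b (l ℕ.+ l)))) (trans (sym (ℕP.+-suc b (suc (l ℕ.+ l)))) (cong (λ t → b ℕ.+ suc t) (sym (ℕP.+-suc l l))))) , b≤1

  LB-linked : ∀ r p q m → 1 ℕ.≤ r → LB (p ℕ.+ p ℕ.+ 4 ℕ.* r) (m ℕ.+ 2 ℕ.* p) (q ℕ.+ 2 ℕ.* r) (r ℕ.* p ℕ.* (q ℕ.* m))
  LB-linked r p q m r≥1 with half-of (outer r q)
  ... | b , l , e , b≤1 = resize (trans (cong₂ ℕ._+_ (outer-≡ r p) (outer-≡ r p)) (h₁ r p)) (trans (outer-≡ p m) (h₂ p m)) (trans (outer-≡ r q) (h₂ r q))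
    (LB-link r p q m b l e (ℕP.≤-trans b≤1 r≥1))
    where
    open import Data.Nat.Tactic.RingSolver renaming (solve-∀ to solve-ℕ)
    h₁ : ∀ r p → r ℕ.+ (p ℕ.+ r) ℕ.+ (r ℕ.+ (p ℕ.+ r)) ≡ p ℕ.+ p ℕ.+ 4 ℕ.* r
    h₁ = solve-ℕ
    h₂ : ∀ p m → p ℕ.+ (m ℕ.+ p) ≡ m ℕ.+ 2 ℕ.* p
    h₂ = solve-ℕ
    resize : ∀ {L L′ M M′ N N′ k} → L ≡ L′ → M ≡ M′ → N ≡ N′ → LB L M N k → LB L′ M′ N′ k
    resize refl refl refl x = x

-- The lower bound with constant 1/162.

module LowerBound where

  open Partner
  open Annulus using (ann)
  open Linked
  open LinkedTwist using (LB-linked)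
  open Conversion using (Valid?)
  open Achievable
  open import Data.Bool using (true; false; not; if_then_else_)
  open import Data.Nat
  open import Data.Nat.Properties
  open import Data.Nat.Divisibility using (_∣_; divides; ∣m+n∣m⇒∣n; _∣?_)
  open import Data.Nat.DivMod using (_/_; _%_; m≡m%n+[m/n]*n; m%n<n)
  open import Data.Nat.Tactic.RingSolver using (solve-∀)
  import Data.Integer as ℤ
  import Data.Integer.Properties as ℤP
  open import Data.Product using (_×_; _,_; ∃; proj₁; proj₂)
  open import Data.Sum using (_⊎_; inj₁; inj₂)
  open import Relation.Nullary using (Dec; yes; no)
  open import Relation.Nullary.Decidable using (toWitness; map′; _×-dec_; _⊎-dec_; _→-dec_)
  open import Relation.Binary.PropositionalEquality

  rows : Pos → Dir
  rows (x , _ , _) = if ev x then +x else -x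

  rows-valid : ∀ n M N → Valid (In (n + n) M N) rows
  rows-valid n M N (x , y , z) (lx , ly , lz) with ev x in e
  ... | true = (suc x , y , z) , n+x , (even-succ {n = n} lx e , ly , lz) , cong (λ β → if not β then +x else -x) e
  ... | false with odd-pred {x} e
  ...   | x′ , refl , e′ = (x′ , y , z) , n-x , (<-trans (n<1+n x′) lx , ly , lz) , cong (λ β → if β then +x else -x) e′

  fill-even : ∀ {L} M N → 2 ∣ L → LB L M N 0
  fill-even M N (divides n refl) = subst (λ L → LB L M N 0) (double n) (LB-valid (rows-valid n M N))
    where
    double : ∀ n → n + n ≡ n * 2
    double = solve-∀

  fill : ∀ {L M N} → OneEven L M N → LB L M N 0
  fill {L} {M} {N} (inj₁ e) = fill-even M N e
  fill {L} {M} {N} (inj₂ (inj₁ e)) = LB-swapXY (fill-even L N e)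
  fill {L} {M} {N} (inj₂ (inj₂ e)) = LB-swapXZ (fill-even M L e)

  +0 : ∀ {L M N k} → LB L M N (k + 0) → LB L M N k
  +0 {k = k} = LB-weaken (≤-reflexive (sym (+-identityʳ k)))

  -- The slabs added along y and z inherit the even side `X`, hence have a tiling. The last slab,
  -- along x, has the parity of `L` as its width because `X` is even, so the even side of the large
  -- box serves for it.
  LB-embed : ∀ {X Y Z L M N k} → X ≤ L → Y ≤ M → Z ≤ N → 2 ∣ X → OneEven L M N → LB X Y Z k → LB L M N k
  LB-embed {X} {Y} {Z} lx ly lz e o a with m≤n⇒∃[o]m+o≡n lx | m≤n⇒∃[o]m+o≡n ly | m≤n⇒∃[o]m+o≡n lz
  ... | x , refl | y , refl | z , refl =
    +0 (LB-glueX (+0 (LB-glueZ (+0 (LB-glueY a (fill-even y Z e))) (fill-even (Y + y) z e))) (fill (rest o)))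
    where
    rest : OneEven (X + x) (Y + y) (Z + z) → OneEven x (Y + y) (Z + z)
    rest (inj₁ d) = inj₁ (∣m+n∣m⇒∣n d e)
    rest (inj₂ d) = inj₂ d

  -- A single vertical domino linked with two rings of eight cells, one in each layer; its twist is
  -- found by evaluation. It is the unit from which the boxes of height 2, 3 and 4 are built.
  block : Pos → Dir
  block c@(1 , 1 , 0) = +z
  block c@(1 , 1 , _) = -z
  block c@(x , y , z) = embXY (ann (even c) 1 1 1 x y)

  LB-block : LB 3 3 2 1
  LB-block = lb block (toWitness {a? = Valid? 3 3 2 block} _) (toWitness {a? = ℤ.+ 4 ℤP.≤? Qx 3 3 2 block} _)

  -- The required bound when `L` is the shortest side. For fixed `L` the left-hand side is additive
  -- in `M` and in `N`, which makes it stable under gluing slabs.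
  Good : ℕ → ℕ → ℕ → Set
  Good L M N = ∃ λ k → LB L M N k × L * L * (M * N) ≤ 162 * k

  Good-swap : ∀ {L M N} → Good L M N → Good L N M
  Good-swap {L} {M} {N} (k , a , le) = k , LB-swapYZ a , subst (λ t → L * L * t ≤ 162 * k) (*-comm M N) le

  Good-glue : ∀ {L M₁ M₂ N} → Good L M₁ N → Good L M₂ N → Good L (M₁ + M₂) N
  Good-glue {L} {M₁} {M₂} {N} (k₁ , a₁ , le₁) (k₂ , a₂ , le₂) = k₁ + k₂ , LB-glueY a₁ a₂ ,
    subst₂ _≤_ (h L M₁ M₂ N) (sym (*-distribˡ-+ 162 k₁ k₂)) (+-mono-≤ le₁ le₂)
    where
    h : ∀ L a b N → L * L * (a * N) + L * L * (b * N) ≡ L * L * ((a + b) * N)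
    h = solve-∀

  grow : ∀ {P : ℕ → Set} s e → 0 < e → (∀ n → s ≤ n → n < e + s → P n) → (∀ n → s ≤ n → P n → P (e + n)) → ∀ n → s ≤ n → P n
  grow {P} s e e>0 base step n = go n n ≤-refl
    where
    go : ∀ f n → n ≤ f → s ≤ n → P n
    go zero n le sn = base n sn (<-≤-trans (s≤s (≤-trans le z≤n)) (≤-trans e>0 (m≤m+n e s)))
    go (suc f) n le sn with n <? e + s
    ... | yes l = base n sn l
    ... | no ge with m≤n⇒∃[o]m+o≡n (≤-trans (m≤m+n e s) (≮⇒≥ ge))
    ...   | n′ , refl = step n′ s≤n′ (go f n′ (≤-pred (≤-trans (+-monoˡ-≤ n′ e>0) le)) s≤n′)
      where
      s≤n′ : s ≤ n′
      s≤n′ = +-cancelˡ-≤ e s n′ (≮⇒≥ ge)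

  Even-drop : ∀ {L M N} e → 2 ∣ e → OneEven L (e + M) N → OneEven L M N
  Even-drop e d (inj₁ x) = inj₁ x
  Even-drop e d (inj₂ (inj₁ x)) = inj₂ (inj₁ (∣m+n∣m⇒∣n x d))
  Even-drop e d (inj₂ (inj₂ x)) = inj₂ (inj₂ x)

  Even-swap : ∀ {L M N} → OneEven L M N → OneEven L N M
  Even-swap (inj₁ x) = inj₁ x
  Even-swap (inj₂ (inj₁ x)) = inj₂ (inj₂ x)
  Even-swap (inj₂ (inj₂ x)) = inj₂ (inj₁ x)

  -- Slabs of even width e reduce the two long sides to the interval [s, e + s).
  reduce : ∀ L s e → 2 ∣ e → 0 < e → s ≤ e → 0 < s →
    (∀ M N → s ≤ M → M < e + s → s ≤ N → N < e + s → OneEven L M N → Good L M N) →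
    ∀ M N → s ≤ M → s ≤ N → OneEven L M N → Good L M N
  reduce L s e 2∣e e>0 s≤e s>0 base M N sM sN = grow {λ N → OneEven L M N → Good L M N} s e e>0
    (λ N sN lN → grow {λ M → OneEven L M N → Good L M N} s e e>0
      (λ M sM lM → base M N sM lM sN lN)
      -- The slab of width `e` is itself a base case, because s ≤ e < e + s, and its even width
      -- supplies the parity.
      (λ M sM rec o → Good-glue (base e N s≤e (m<m+n e s>0) sN lN (inj₂ (inj₁ 2∣e))) (rec (Even-drop e 2∣e o)))
      M sM)
    (λ N sN rec o → Good-swap (Good-glue
      (Good-swap (grow {λ M → Good L M e} s e e>0
        (λ M sM lM → base M e sM lM s≤e (m<m+n e s>0) (inj₂ (inj₂ 2∣e)))
        (λ M′ sM′ rec′ → Good-glue (base e e s≤e (m<m+n e s>0) s≤e (m<m+n e s>0) (inj₂ (inj₁ 2∣e))) rec′) M sM))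
      (Good-swap (rec (Even-swap (Even-drop e 2∣e (Even-swap o)))))))
    N sN

  two : ∀ {n} → 2 ∣ n + n
  two {n} = divides n (h n)
    where
    h : ∀ n → n + n ≡ n * 2
    h = solve-∀

  two∣2 : 2 ∣ 2
  two∣2 = divides 1 refl

  two∣4 : 2 ∣ 4
  two∣4 = divides 2 refl

  mn≤ : ∀ {M N} a b → M < suc a → N < suc b → M * N ≤ a * b
  mn≤ a b (s≤s p) (s≤s q) = *-mono-≤ p q

  good-2 : ∀ M N → 3 ≤ M → 3 ≤ N → OneEven 2 M N → Good 2 M N
  good-2 = reduce 2 3 4 two∣4 z<s (n≤1+n 3) z<s λ M N sM lM sN lN o →
    1 , LB-embed {2} {3} {3} ≤-refl sM sN two∣2 o (LB-swapXZ LB-block)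
      , ≤-trans (*-monoʳ-≤ 4 (mn≤ 6 6 lM lN)) (toWitness {a? = 144 ≤? 162} _)

  LB-334 : LB 3 3 4 2
  LB-334 = LB-glueZ LB-block LB-block

  even≥3⇒≥4 : ∀ {n} → 3 ≤ n → 2 ∣ n → 4 ≤ n
  even≥3⇒≥4 {3} _ (divides (suc (suc (suc _))) ())
  even≥3⇒≥4 {suc (suc (suc (suc n)))} _ _ = s≤s (s≤s (s≤s (s≤s z≤n)))
  even≥3⇒≥4 {suc zero} (s≤s ()) _
  even≥3⇒≥4 {suc (suc zero)} (s≤s (s≤s ())) _

  good-3 : ∀ M N → 3 ≤ M → 3 ≤ N → OneEven 3 M N → Good 3 M N
  good-3 = reduce 3 3 4 two∣4 z<s (n≤1+n 3) z<s base
    where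
    even-N : ∀ M N → 3 ≤ M → M < 7 → 3 ≤ N → N < 7 → 2 ∣ N → Good 3 M N
    even-N M N sM lM sN lN d = 2
      , LB-swapXZ (LB-embed {4} {3} {3} (even≥3⇒≥4 sN d) sM ≤-refl two∣4 (inj₁ d) (LB-swapXZ LB-334))
      -- At M = N = 6 this is the equality 9 · 36 = 162 · 2, so the estimate leaves no room for a
      -- larger constant.
      , ≤-trans (*-monoʳ-≤ 9 (mn≤ 6 6 lM lN)) ≤-refl
    base : ∀ M N → 3 ≤ M → M < 7 → 3 ≤ N → N < 7 → OneEven 3 M N → Good 3 M N
    base M N sM lM sN lN (inj₁ (divides (suc (suc _)) ()))
    base M N sM lM sN lN (inj₂ (inj₂ d)) = even-N M N sM lM sN lN d
    base M N sM lM sN lN (inj₂ (inj₁ d)) = Good-swap (even-N N M sN lN sM lM d)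

  LB-433 : LB 4 3 3 2
  LB-433 = LB-swapXZ LB-334

  LB-463 : LB 4 6 3 4
  LB-463 = LB-glueY LB-433 LB-433

  LB-466 : LB 4 6 6 8
  LB-466 = LB-glueZ LB-463 LB-463

  -- Splitting 5 as 2 + 3 makes room for one block beside the two of `LB-433`; twist 2 would not do
  -- here, since 16 · 25 = 400 exceeds 2 · 162.
  LB-455 : LB 4 5 5 3
  LB-455 = LB-glueZ {N₁ = 2} {N₂ = 3}
    (LB-swapXZ (LB-embed {2} {3} {3} {2} {5} {4} ≤-refl (m≤m+n 3 2) (m≤m+n 3 1) two∣2 (inj₁ two∣2) (LB-swapXZ LB-block)))
    (LB-embed {4} {3} {3} {4} {5} {3} ≤-refl (m≤m+n 3 2) ≤-refl two∣4 (inj₁ two∣4) LB-433)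

  good-4 : ∀ M N → 4 ≤ M → 4 ≤ N → OneEven 4 M N → Good 4 M N
  good-4 = reduce 4 4 4 two∣4 z<s ≤-refl z<s base
    where
    3≤ : ∀ {n} → 4 ≤ n → 3 ≤ n
    3≤ = ≤-trans (n≤1+n 3)
    embed : ∀ Y Z {M N k} → Y ≤ M → Z ≤ N → LB 4 Y Z k → LB 4 M N k
    embed Y Z ly lz = LB-embed {4} {Y} {Z} ≤-refl ly lz two∣4 (inj₁ two∣4)
    base : ∀ M N → 4 ≤ M → M < 8 → 4 ≤ N → N < 8 → OneEven 4 M N → Good 4 M N
    base M N sM lM sN lN o with 6 ≤? M | 6 ≤? N
    ... | yes p | yes q = 8 , embed 6 6 p q LB-466
      , ≤-trans (*-monoʳ-≤ 16 (mn≤ 7 7 lM lN)) (toWitness {a? = 784 ≤? 1296} _)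
    ... | yes p | no q = 4 , embed 6 3 p (3≤ sN) LB-463
      , ≤-trans (*-monoʳ-≤ 16 (mn≤ 7 5 lM (≰⇒> q))) (toWitness {a? = 560 ≤? 648} _)
    ... | no p | yes q = 4 , embed 3 6 (3≤ sM) q (LB-swapYZ LB-463)
      , ≤-trans (*-monoʳ-≤ 16 (mn≤ 5 7 (≰⇒> p) lN)) (toWitness {a? = 560 ≤? 648} _)
    ... | no p | no q with 5 ≤? M | 5 ≤? N
    ...   | yes p′ | yes q′ = 3 , embed 5 5 p′ q′ LB-455
      , ≤-trans (*-monoʳ-≤ 16 (mn≤ 5 5 (≰⇒> p) (≰⇒> q))) (toWitness {a? = 400 ≤? 486} _)
    ...   | no p′ | _ = 2 , embed 3 3 (3≤ sM) (3≤ sN) LB-433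
      , ≤-trans (*-monoʳ-≤ 16 (mn≤ 4 5 (≰⇒> p′) (≰⇒> q))) (toWitness {a? = 320 ≤? 324} _)
    ...   | yes _ | no q′ = 2 , embed 3 3 (3≤ sM) (3≤ sN) LB-433
      , ≤-trans (*-monoʳ-≤ 16 (mn≤ 5 4 (≰⇒> p) (≰⇒> q′))) (toWitness {a? = 320 ≤? 324} _)

  -- The width 2 p + 4 r of the torus with its stacks goes along `N`; `M` and `L` are filled
  -- completely, which makes m = M - 2 p and q = L - 2 r as large as possible.
  LB-fit : ∀ {L M N} r p → 1 ≤ r → p + p + 4 * r ≤ N → 2 * p ≤ M → 2 * r ≤ L → OneEven L M N →
    LB L M N (r * p * ((L ∸ 2 * r) * (M ∸ 2 * p)))
  LB-fit {L} {M} {N} r p r≥1 fx fy fz o = LB-swapXZ (LB-embed fx (≤-reflexive (m∸n+n≡m fy)) (≤-reflexive (m∸n+n≡m fz))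
    even-X (rot o) (LB-linked r p (L ∸ 2 * r) (M ∸ 2 * p) r≥1))
    where
    even-X : 2 ∣ p + p + 4 * r
    even-X = divides (p + 2 * r) (h p r)
      where
      h : ∀ p r → p + p + 4 * r ≡ (p + 2 * r) * 2
      h = solve-∀
    rot : OneEven L M N → OneEven N M L
    rot (inj₁ d) = inj₂ (inj₂ d)
    rot (inj₂ (inj₁ d)) = inj₂ (inj₁ d)
    rot (inj₂ (inj₂ d)) = inj₁ d

  record Fits (L M N r p : ℕ) : Set where
    constructor fits
    field
      in-N    : p + p + 4 * r ≤ N
      in-M    : 2 * p ≤ M
      enough  : L * L * (M * N) ≤ 162 * (r * p * ((L ∸ 2 * r) * (M ∸ 2 * p)))

  good-fit : ∀ {L M N} r p → 1 ≤ r → 2 * r ≤ L → OneEven L M N → Fits L M N r p → Good L M N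
  good-fit {L} {M} {N} r p r≥1 fz o (fits fx fy le) = r * p * ((L ∸ 2 * r) * (M ∸ 2 * p)) , LB-fit r p r≥1 fx fy fz o , le

  Fits? : ∀ L M N r p → Dec (Fits L M N r p)
  Fits? L M N r p = map′ (λ (a , b , c) → fits a b c) (λ (fits a b c) → a , b , c)
    ((p + p + 4 * r ≤? N) ×-dec (2 * p ≤? M) ×-dec (L * L * (M * N) ≤? 162 * (r * p * ((L ∸ 2 * r) * (M ∸ 2 * p)))))

  Some : ℕ → ℕ → ℕ → Set
  Some L M N = Fits L M N 1 1 ⊎ Fits L M N 1 2 ⊎ Fits L M N 1 3

  Some? : ∀ L M N → Dec (Some L M N)
  Some? L M N = Fits? L M N 1 1 ⊎-dec Fits? L M N 1 2 ⊎-dec Fits? L M N 1 3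

  OneEven? : ∀ L M N → Dec (OneEven L M N)
  OneEven? L M N = (2 ∣? L) ⊎-dec (2 ∣? M) ⊎-dec (2 ∣? N)

  -- Shortest sides 5 to 11 and long sides at most twice as long leave finitely many boxes. There r
  -- = 1 and p ≤ 3 suffice, provided that either long side may carry the width of the torus.
  Table : ℕ → ℕ → ℕ → Set
  Table l i j = i ≤ 5 + l → j ≤ 5 + l → OneEven (5 + l) (5 + l + i) (5 + l + j) →
    Some (5 + l) (5 + l + i) (5 + l + j) ⊎ Some (5 + l) (5 + l + j) (5 + l + i)

  Table? : ∀ l i j → Dec (Table l i j)
  Table? l i j = (i ≤? 5 + l) →-dec (j ≤? 5 + l) →-dec OneEven? (5 + l) (5 + l + i) (5 + l + j) →-dec
    (Some? (5 + l) (5 + l + i) (5 + l + j) ⊎-dec Some? (5 + l) (5 + l + j) (5 + l + i))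

  good-some : ∀ {L M N} → 2 ≤ L → OneEven L M N → Some L M N → Good L M N
  good-some fz o (inj₁ f) = good-fit 1 1 ≤-refl fz o f
  good-some fz o (inj₂ (inj₁ f)) = good-fit 1 2 ≤-refl fz o f
  good-some fz o (inj₂ (inj₂ f)) = good-fit 1 3 ≤-refl fz o f

  good-either : ∀ {L M N} → 2 ≤ L → OneEven L M N → Some L M N ⊎ Some L N M → Good L M N
  good-either fz o (inj₁ s) = good-some fz o s
  good-either fz o (inj₂ s) = Good-swap (good-some fz (Even-swap o) s)

  abstract
    table : ∀ {l} → l < 7 → ∀ {i} → i < 12 → ∀ {j} → j < 12 → Table l i j
    table = toWitness {a? = allUpTo? (λ l → allUpTo? (λ i → allUpTo? (λ j → Table? l i j) 12) 12) 7} _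

  even-above : ∀ L → ∃ λ e → 2 ∣ e × L ≤ e × e ≤ suc L
  even-above zero = 0 , divides 0 refl , z≤n , z≤n
  even-above (suc zero) = 2 , two∣2 , s≤s z≤n , ≤-refl
  even-above (suc (suc L)) with even-above L
  ... | e , divides q eq , a , b = suc (suc e) , divides (suc q) (cong (λ t → suc (suc t)) eq) , s≤s (s≤s a) , s≤s (s≤s b)

  halve : ∀ n → ∃ λ c → ∃ λ p → n ≡ c + (p + p) × c ≤ 1
  halve = LinkedTwist.half-of

  -- The slab width is the even one of L and L + 1, so the long sides drop below 2 L + 1.
  reduce-double : ∀ L → 0 < L →
    (∀ M N → L ≤ M → M ≤ L + L → L ≤ N → N ≤ L + L → OneEven L M N → Good L M N) →
    ∀ M N → L ≤ M → L ≤ N → OneEven L M N → Good L M N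
  reduce-double L L>0 base with even-above L
  ... | e , d , a , b = reduce L L e d (<-≤-trans L>0 a) a L>0 λ M N sM lM sN lN →
    base M N sM (≤-pred (≤-trans lM (+-monoˡ-≤ L b))) sN (≤-pred (≤-trans lN (+-monoˡ-≤ L b)))

  good-5-to-11 : ∀ l → l < 7 → ∀ M N → 5 + l ≤ M → 5 + l ≤ N → OneEven (5 + l) M N → Good (5 + l) M N
  good-5-to-11 l l<7 = reduce-double (5 + l) z<s base
    where
    L : ℕ
    L = 5 + l
    bound : ∀ {i} → i ≤ 5 + l → i < 12
    bound le = s≤s (≤-trans le (+-monoʳ-≤ 5 (≤-pred l<7)))
    at : ∀ {M N} → M ≤ L + L → N ≤ L + L → OneEven L M N → (∃ λ i → L + i ≡ M) → (∃ λ j → L + j ≡ N) → Good L M N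
    at lM lN o (i , refl) (j , refl) = good-either (s≤s (s≤s z≤n)) o
      (table l<7 (bound (+-cancelˡ-≤ L i L lM)) (bound (+-cancelˡ-≤ L j L lN)) (+-cancelˡ-≤ L i L lM) (+-cancelˡ-≤ L j L lN) o)
    base : ∀ M N → L ≤ M → M ≤ L + L → L ≤ N → N ≤ L + L → OneEven L M N → Good L M N
    base M N sM lM sN lN o = at lM lN o (m≤n⇒∃[o]m+o≡n sM) (m≤n⇒∃[o]m+o≡n sN)

  +-slack-≤ : ∀ {x y a s} → x + a ≡ y + s → s ≤ a → x ≤ y
  +-slack-≤ {x} {y} {a} {s} e le = +-cancelʳ-≤ s x y (≤-trans (+-monoʳ-≤ x le) (≤-reflexive e))

  -- With L = 6 r + j and q = L - 2 r the leading terms are 252 r² and 324 r²; r ≥ 2 pays for the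
  -- remainder j ≤ 5. The constants here and in `width-ratio` fit together through 81 · 56 / 4 = 7 ·
  -- 162.
  height-ratio : ∀ r′ j → j ≤ 5 → let r = 2 + r′ in 7 * ((j + 6 * r) * (j + 6 * r)) ≤ 81 * (r * (4 * r + j))
  height-ratio r′ j j≤5 = +-slack-≤ (e (2 + r′) j) (≤-trans
      (+-mono-≤ (*-monoʳ-≤ (3 * (2 + r′)) j≤5) (*-monoʳ-≤ 7 (*-mono-≤ j≤5 j≤5)))
      (≤-trans (m≤m+n _ (83 + 273 * r′ + 72 * (r′ * r′))) (≤-reflexive (sym (f r′)))))
    where
    e : ∀ r j → 7 * ((j + 6 * r) * (j + 6 * r)) + 72 * (r * r) ≡ 81 * (r * (4 * r + j)) + (3 * r * j + 7 * (j * j))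
    e = solve-∀
    f : ∀ r → 72 * ((2 + r) * (2 + r)) ≡ 3 * (2 + r) * 5 + 7 * (5 * 5) + (83 + 273 * r + 72 * (r * r))
    f = solve-∀

  -- Rounding 2 r + s down to an even number costs at most 1, hence 2 p ≥ 2 r + s - 1. After
  -- expansion the only unfavourable term is s², and the bound s ≤ 10 + 6 r, which comes from M ≤ 2
  -- L, absorbs it.
  width-ratio : ∀ r′ s c p → let r = 2 + r′ in s ≤ 22 + 6 * r′ → c ≤ 1 → 2 * r + s ≡ c + (p + p) →
    (6 * r + s) * (6 * r + s) ≤ 56 * (r * p)
  width-ratio r′ s c p s≤ c≤1 eq = ≤-trans (+-slack-≤ (e r′ s) (≤-trans (*-monoʳ-≤ s s≤)
      (≤-trans (m≤m+n _ (24 + 52 * r′ + 20 * (r′ * r′) + 10 * s + 10 * (r′ * s))) (≤-reflexive (f r′ s)))))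
    (≤-trans (*-monoʳ-≤ (28 * (2 + r′)) p≥) (≤-reflexive (g r′ p)))
    where
    e : ∀ r s → (6 * (2 + r) + s) * (6 * (2 + r) + s) + (24 + 52 * r + 20 * (r * r) + 32 * s + 16 * (r * s))
      ≡ 28 * (2 + r) * (3 + 2 * r + s) + s * s
    e = solve-∀
    f : ∀ r s → s * (22 + 6 * r) + (24 + 52 * r + 20 * (r * r) + 10 * s + 10 * (r * s)) ≡ 24 + 52 * r + 20 * (r * r) + 32 * s + 16 * (r * s)
    f = solve-∀
    g : ∀ r p → 28 * (2 + r) * (p + p) ≡ 56 * ((2 + r) * p)
    g = solve-∀
    h : ∀ r s → 2 * (2 + r) + s ≡ suc (3 + 2 * r + s)
    h = solve-∀
    p≥ : 3 + 2 * r′ + s ≤ p + p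
    p≥ = ≤-pred (≤-trans (≤-reflexive (trans (sym (h r′ s)) eq)) (+-monoˡ-≤ (p + p) c≤1))

  fits-big : ∀ {L M N r r′ j s d c p} → j ≤ 5 → c ≤ 1 → r ≡ 2 + r′ → L ≡ j + 6 * r → M ≡ 6 * r + s → N ≡ M + d →
    2 * r + s ≡ c + (p + p) → M ≤ L + L → 2 * r ≤ L × Fits L N M r p
  fits-big {L} {M} {N} {r} {r′} {j} {s} {d} {c} {p} j≤5 c≤1 r≡ Lj Ms Nd eq M≤ =
    subst (2 * r ≤_) (sym L≡) (m≤m+n (2 * r) q) , fits
      (subst (p + p + 4 * r ≤_) (sym M≡) (≤-trans (≤-reflexive (+-comm (p + p) (4 * r))) (+-monoʳ-≤ (4 * r) (m≤n+m (p + p) c))))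
      (subst (2 * p ≤_) (sym N≡) (m≤m+n (2 * p) m))
      bound
    where
    q m : ℕ
    q = 4 * r + j
    m = 4 * r + c + d
    M≡ : M ≡ 4 * r + (c + (p + p))
    M≡ = trans Ms (trans (h r s) (cong (4 * r +_) eq))
      where
      h : ∀ r s → 6 * r + s ≡ 4 * r + (2 * r + s)
      h = solve-∀
    N≡ : N ≡ 2 * p + m
    N≡ = trans Nd (trans (cong (_+ d) M≡) (h r c p d))
      where
      h : ∀ r c p d → 4 * r + (c + (p + p)) + d ≡ 2 * p + (4 * r + c + d)
      h = solve-∀
    L≡ : L ≡ 2 * r + q
    L≡ = trans Lj (h j r)
      where
      h : ∀ j r → j + 6 * r ≡ 2 * r + (4 * r + j)
      h = solve-∀
    s≤ : s ≤ 22 + 6 * r′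
    s≤ = +-cancelˡ-≤ (6 * r) s _ (≤-trans (subst (_≤ L + L) Ms M≤) (≤-trans (subst (λ l → l + l ≤ 5 + 6 * r + (5 + 6 * r)) (sym Lj)
      (+-mono-≤ (+-monoˡ-≤ (6 * r) j≤5) (+-monoˡ-≤ (6 * r) j≤5))) (≤-reflexive (trans (h r) (trans (cong (λ t → 6 * r + (10 + 6 * t)) r≡) (cong (6 * r +_) (h′ r′)))))))
      where
      h : ∀ r → 5 + 6 * r + (5 + 6 * r) ≡ 6 * r + (10 + 6 * r)
      h = solve-∀
      h′ : ∀ r → 10 + 6 * (2 + r) ≡ 22 + 6 * r
      h′ = solve-∀
    4r≤M : 4 * r ≤ M
    4r≤M = subst (4 * r ≤_) (sym M≡) (m≤m+n (4 * r) _)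
    M>0 : 0 < M
    M>0 = <-≤-trans (subst (λ t → 0 < 4 * t) (sym r≡) z<s) 4r≤M
    -- Lengthening N beyond M by d adds d to m as well, so the proportion m / N stays at least 4 r /
    -- M.
    side : 4 * r * N ≤ m * M
    side = subst (λ n → 4 * r * n ≤ m * M) (sym Nd) (≤-trans (≤-reflexive (*-distribˡ-+ (4 * r) M d)) (≤-trans (+-monoʳ-≤ (4 * r * M) (*-monoˡ-≤ d 4r≤M))
      (≤-trans (m≤m+n _ (c * M)) (≤-reflexive (h r M d c)))))
      where
      h : ∀ r M d c → 4 * r * M + M * d + c * M ≡ (4 * r + c + d) * M
      h = solve-∀
    wide : M * M ≤ 56 * (r * p)
    wide = subst (λ t → t * t ≤ 56 * (r * p)) (sym Ms) (subst (λ r → (6 * r + s) * (6 * r + s) ≤ 56 * (r * p)) (sym r≡)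
      (width-ratio r′ s c p s≤ c≤1 (subst (λ r → 2 * r + s ≡ c + (p + p)) r≡ eq)))
    high : 7 * (L * L) ≤ 81 * (r * q)
    high = subst (λ l → 7 * (l * l) ≤ 81 * (r * q)) (sym Lj)
      (subst (λ r → 7 * ((j + 6 * r) * (j + 6 * r)) ≤ 81 * (r * (4 * r + j))) (sym r≡) (height-ratio r′ j j≤5))
    area : N * M ≤ 14 * (p * m)
    area = *-cancelˡ-≤ M {{>-nonZero M>0}} (≤-trans (≤-reflexive (h₀ M N))
      (≤-trans (*-monoˡ-≤ N wide) (≤-trans (≤-reflexive (h r p N))
        (≤-trans (*-monoʳ-≤ (14 * p) side) (≤-reflexive (h′ p m M))))))
      where
      h₀ : ∀ M N → M * (N * M) ≡ M * M * N
      h₀ = solve-∀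
      h : ∀ r p n → 56 * (r * p) * n ≡ 14 * p * (4 * r * n)
      h = solve-∀
      h′ : ∀ p m M → 14 * p * (m * M) ≡ M * (14 * (p * m))
      h′ = solve-∀
    product : L * L * (N * M) ≤ 162 * (r * p * (q * m))
    product = *-cancelˡ-≤ 7 (≤-trans (≤-reflexive (sym (*-assoc 7 (L * L) (N * M))))
        (≤-trans (*-mono-≤ high area) (≤-reflexive (h r q p m))))
      where
      h : ∀ r q p m → 81 * (r * q) * (14 * (p * m)) ≡ 7 * (162 * (r * p * (q * m)))
      h = solve-∀
    bound : L * L * (N * M) ≤ 162 * (r * p * ((L ∸ 2 * r) * (N ∸ 2 * p)))
    bound = subst₂ (λ a b → L * L * (N * M) ≤ 162 * (r * p * (a * b)))
      (sym (trans (cong (_∸ 2 * r) L≡) (m+n∸m≡n (2 * r) q))) (sym (trans (cong (_∸ 2 * p) N≡) (m+n∸m≡n (2 * p) m))) product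

  good-12 : ∀ L → 12 ≤ L → ∀ M N → L ≤ M → L ≤ N → OneEven L M N → Good L M N
  good-12 L L≥12 = reduce-double L (≤-trans (s≤s z≤n) L≥12) base
    where
    r : ℕ
    -- In a cube with 2 p = L - 4 r the twist is 2 r² (L - 4 r) (L - 2 r), with maximum near r =
    -- 0.152 L. The sixth part is close to it and still gives the fourth power of L divided by 81.
    r = L / 6
    L≡ : L ≡ L % 6 + 6 * r
    L≡ = trans (m≡m%n+[m/n]*n L 6) (cong (L % 6 +_) (*-comm r 6))
    r≥2 : 2 ≤ r
    r≥2 = ≮⇒≥ λ lt → <-irrefl refl (<-≤-trans
      (≤-trans (s≤s (≤-reflexive (m≡m%n+[m/n]*n L 6))) (+-mono-≤ (m%n<n L 6) (*-monoˡ-≤ 6 (≤-pred lt)))) L≥12)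
    ordered : ∀ M N → L ≤ M → M ≤ L + L → M ≤ N → OneEven L M N → Good L M N
    ordered M N LM M≤ MN o = go (m≤n⇒∃[o]m+o≡n r≥2) (m≤n⇒∃[o]m+o≡n (≤-trans (≤-trans (m≤n+m (6 * r) (L % 6)) (≤-reflexive (sym L≡))) LM)) (m≤n⇒∃[o]m+o≡n MN)
      where
      go : (∃ λ r′ → 2 + r′ ≡ r) → (∃ λ s → 6 * r + s ≡ M) → (∃ λ d → M + d ≡ N) → Good L M N
      go (r′ , er) (s , es) (d , ed) = fit (halve (2 * r + s))
        where
        fit : (∃ λ c → ∃ λ p → 2 * r + s ≡ c + (p + p) × c ≤ 1) → Good L M N
        fit (c , p , eq , c≤1) = Good-swap (good-fit r p (≤-trans (s≤s z≤n) r≥2) (proj₁ both) (Even-swap o) (proj₂ both))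
          where
          both : 2 * r ≤ L × Fits L N M r p
          both = fits-big (≤-pred (m%n<n L 6)) c≤1 (sym er) L≡ (sym es) (sym ed) eq M≤
    base : ∀ M N → L ≤ M → M ≤ L + L → L ≤ N → N ≤ L + L → OneEven L M N → Good L M N
    base M N sM lM sN lN o with ≤-total M N
    ... | inj₁ le = ordered M N sM lM le o
    ... | inj₂ le = Good-swap (ordered N M sN lN le (Even-swap o))

  good : ∀ L M N → 2 ≤ L → 3 ≤ M → 3 ≤ N → L ≤ M → L ≤ N → OneEven L M N → Good L M N
  good L M N L≥2 M≥3 N≥3 LM LN o with L <? 5 | L <? 12
  ... | no ge | no ge′ = good-12 L (≮⇒≥ ge′) M N LM LN o
  ... | no ge | yes lt with m≤n⇒∃[o]m+o≡n (≮⇒≥ ge)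
  ...   | l , refl = good-5-to-11 l (+-cancelˡ-< 5 l 7 lt) M N LM LN o
  good 2 M N _ M≥3 N≥3 _ _ o | yes _ | _ = good-2 M N M≥3 N≥3 o
  good 3 M N _ M≥3 N≥3 _ _ o | yes _ | _ = good-3 M N M≥3 N≥3 o
  good 4 M N _ _ _ LM LN o | yes _ | _ = good-4 M N LM LN o
  good 1 M N (s≤s ()) _ _ _ _ o | yes _ | _
  good (suc (suc (suc (suc (suc L))))) M N _ _ _ _ _ o | yes (s≤s (s≤s (s≤s (s≤s (s≤s ()))))) | _

  lower-bound : ∀ L M N → 2 ≤ L → 2 ≤ M → 2 ≤ N → TwoBig L M N → OneEven L M N →
    ∃ λ k → LB L M N k × LMNmin L M N ≤ 162 * k
  lower-bound L M N L≥2 M≥2 N≥2 big o = by-min (≤-total L M) (≤-total M N) (≤-total L N)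
    where
    Goal : Set
    Goal = ∃ λ k → LB L M N k × LMNmin L M N ≤ 162 * k
    min-L : L ≤ M → L ≤ N → Goal
    min-L LM LN with good L M N L≥2 (proj₁ M,N≥3) (proj₂ M,N≥3) LM LN o
      where
      cases : TwoBig L M N → 3 ≤ M × 3 ≤ N
      cases (inj₁ (l , m)) = m , ≤-trans l LN
      cases (inj₂ (inj₁ (l , n))) = ≤-trans l LM , n
      cases (inj₂ (inj₂ mn)) = mn
      M,N≥3 : 3 ≤ M × 3 ≤ N
      M,N≥3 = cases big
    ... | k , a , le = k , a , subst (_≤ 162 * k) (trans (h L M N) (cong (L * M * N *_) (sym (trans (cong (_⊓ N) (m≤n⇒m⊓n≡m LM)) (m≤n⇒m⊓n≡m LN))))) le
      where
      h : ∀ L M N → L * L * (M * N) ≡ L * M * N * L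
      h = solve-∀
    min-M : M ≤ L → M ≤ N → Goal
    min-M ML MN with good M L N M≥2 (proj₁ L,N≥3) (proj₂ L,N≥3) ML MN (flip o)
      where
      cases : TwoBig L M N → 3 ≤ L × 3 ≤ N
      cases (inj₁ (l , m)) = l , ≤-trans m MN
      cases (inj₂ (inj₁ ln)) = ln
      cases (inj₂ (inj₂ (m , n))) = ≤-trans m ML , n
      L,N≥3 : 3 ≤ L × 3 ≤ N
      L,N≥3 = cases big
      flip : OneEven L M N → OneEven M L N
      flip (inj₁ d) = inj₂ (inj₁ d)
      flip (inj₂ (inj₁ d)) = inj₁ d
      flip (inj₂ (inj₂ d)) = inj₂ (inj₂ d)
    ... | k , a , le = k , LB-swapXY a , subst (_≤ 162 * k) (trans (h L M N) (cong (L * M * N *_) (sym (trans (cong (_⊓ N) (m≥n⇒m⊓n≡n ML)) (m≤n⇒m⊓n≡m MN))))) le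
      where
      h : ∀ L M N → M * M * (L * N) ≡ L * M * N * M
      h = solve-∀
    min-N : N ≤ L → N ≤ M → Goal
    min-N NL NM with good N M L N≥2 (proj₂ L,M≥3) (proj₁ L,M≥3) NM NL (flip o)
      where
      cases : TwoBig L M N → 3 ≤ L × 3 ≤ M
      cases (inj₁ lm) = lm
      cases (inj₂ (inj₁ (l , n))) = l , ≤-trans n NM
      cases (inj₂ (inj₂ (m , n))) = ≤-trans n NL , m
      L,M≥3 : 3 ≤ L × 3 ≤ M
      L,M≥3 = cases big
      flip : OneEven L M N → OneEven N M L
      flip (inj₁ d) = inj₂ (inj₂ d)
      flip (inj₂ (inj₁ d)) = inj₂ (inj₁ d)
      flip (inj₂ (inj₂ d)) = inj₁ d
    ... | k , a , le = k , LB-swapXZ a , subst (_≤ 162 * k) (trans (h L M N) (cong (L * M * N *_) (sym (m≥n⇒m⊓n≡n (⊓-glb NL NM))))) le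
      where
      h : ∀ L M N → N * N * (M * L) ≡ L * M * N * N
      h = solve-∀
    by-min : L ≤ M ⊎ M ≤ L → M ≤ N ⊎ N ≤ M → L ≤ N ⊎ N ≤ L → Goal
    by-min (inj₁ LM) _ (inj₁ LN) = min-L LM LN
    by-min (inj₁ LM) _ (inj₂ NL) = min-N NL (≤-trans NL LM)
    by-min (inj₂ ML) (inj₁ MN) _ = min-M ML MN
    by-min (inj₂ ML) (inj₂ NM) _ = min-N (≤-trans NM ML) NM

-- Rational bounds, limit superior and limit inferior.

module Limits where

  open Partner
  open Twist using (quarter; quarter-≃; Tw≡Qx)
  open Conversion
  open Achievable
  open LowerBound using (fill; two; lower-bound)
  open LinkedTwist using (LB-linked)
  open import Data.Nat as ℕ using (ℕ; zero; suc; _⊓_; z≤n; s≤s)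
  import Data.Nat.Properties as ℕP
  open import Data.Integer as ℤ using (ℤ; +≤+) renaming (+_ to pos)
  import Data.Integer.Properties as ℤP
  open import Data.Integer.Tactic.RingSolver using (solve-∀)
  open import Data.Rational as ℚ using (ℚ; mkℚ; 0ℚ; _≤_; *<*)
  import Data.Rational.Properties as ℚP
  open import Data.Rational.Unnormalised as ℚᵘ using (mkℚᵘ; _≃_; *≤*)
  import Data.Rational.Unnormalised.Properties as ℚᵘP
  open import Data.Nat.Divisibility using (_∣_; divides; ∣m∣n⇒∣m+n)
  open import Data.Nat.Tactic.RingSolver renaming (solve-∀ to solve-ℕ)
  open import Data.Product using (Σ; _×_; _,_; ∃)
  open import Data.Sum using (inj₁; inj₂)
  open import Relation.Binary.PropositionalEquality

  quarter-mono : ∀ {a b} → a ℤ.≤ b → quarter a ≤ quarter b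
  quarter-mono {a} {b} le = ℚP.toℚᵘ-cancel-≤ (ℚᵘP.≤-respˡ-≃ (ℚᵘP.≃-sym (quarter-≃ a))
    (ℚᵘP.≤-respʳ-≃ (ℚᵘP.≃-sym (quarter-≃ b)) (*≤* (ℤP.*-monoʳ-≤-nonNeg (pos 4) le))))

  maximum : ∀ L M N → ∃ (Valid (In L M N)) → ∃ λ D →
    Valid (In L M N) D × (∀ D′ → Valid (In L M N) D′ → Qx L M N D′ ℤ.≤ Qx L M N D) × IsMaxTw L M N (quarter (Qx L M N D))
  maximum L M N some with best L M N some
  ... | D , v , b = D , v , b
    , (ToList.tiling v , ToList.is-tiling v , Tw≡Qx (ToList.is-tiling v) (ToList.compatible v))
    , λ t til → subst (_≤ quarter (Qx L M N D)) (sym (Tw≡Qx til (FromList.compatible til))) (quarter-mono (b _ (FromList.D-valid til)))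

  attained : ∀ {L M N m} → IsMaxTw L M N m → ∃ λ D → Valid (In L M N) D × m ≡ quarter (Qx L M N D)
  attained ((t , til , e) , _) = FromList.D til , FromList.D-valid til , trans (sym e) (Tw≡Qx til (FromList.compatible til))

  product-≃ : ∀ c n → ℚ.toℚᵘ (c ℚ.* toℚ n) ≃ ℚ.toℚᵘ c ℚᵘ.* mkℚᵘ (pos n) 0
  product-≃ c n = ℚᵘP.≃-trans (ℚP.toℚᵘ-homo-* c (toℚ n)) (ℚᵘP.*-congˡ {ℚ.toℚᵘ c} (ℚP.toℚᵘ-fromℚᵘ (mkℚᵘ (pos n) 0)))

  unit-fraction-≃ : ∀ d n → ℚ.toℚᵘ ((pos 1 ℚ./ suc d) ℚ.* toℚ n) ≃ mkℚᵘ (pos 1) d ℚᵘ.* mkℚᵘ (pos n) 0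
  unit-fraction-≃ d n = ℚᵘP.≃-trans (product-≃ (pos 1 ℚ./ suc d) n) (ℚᵘP.*-congʳ (ℚP.toℚᵘ-fromℚᵘ (mkℚᵘ (pos 1) d)))

  quarter-≤ : ∀ d n {Q} → Q ℤ.* pos (suc d) ℤ.≤ pos 4 ℤ.* pos n → quarter Q ≤ (pos 1 ℚ./ suc d) ℚ.* toℚ n
  quarter-≤ d n {Q} le = ℚP.toℚᵘ-cancel-≤ (ℚᵘP.≤-respˡ-≃ (ℚᵘP.≃-sym (quarter-≃ Q))
    (ℚᵘP.≤-respʳ-≃ (ℚᵘP.≃-sym (unit-fraction-≃ d n)) (*≤* (subst₂ ℤ._≤_ (cong (λ k → Q ℤ.* pos k) (sym (ℕP.*-identityʳ (suc d)))) (h (pos n)) le))))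
    where
    h : ∀ n → pos 4 ℤ.* n ≡ pos 1 ℤ.* n ℤ.* pos 4
    h = solve-∀

  ≤-quarter : ∀ d n {Q} → pos 4 ℤ.* pos n ℤ.≤ Q ℤ.* pos (suc d) → (pos 1 ℚ./ suc d) ℚ.* toℚ n ≤ quarter Q
  ≤-quarter d n {Q} le = ℚP.toℚᵘ-cancel-≤ (ℚᵘP.≤-respʳ-≃ (ℚᵘP.≃-sym (quarter-≃ Q))
    (ℚᵘP.≤-respˡ-≃ (ℚᵘP.≃-sym (unit-fraction-≃ d n)) (*≤* (subst₂ ℤ._≤_ (h (pos n)) (cong (λ k → Q ℤ.* pos k) (sym (ℕP.*-identityʳ (suc d)))) le))))
    where
    h : ∀ n → pos 4 ℤ.* n ≡ pos 1 ℤ.* n ℤ.* pos 4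
    h = solve-∀

  add-ε : ∀ c {ε m} n → 0ℚ ℚ.< ε → m ≤ c ℚ.* toℚ n → m ≤ (c ℚ.+ ε) ℚ.* toℚ n
  add-ε c {ε} n ε>0 le = ℚP.≤-trans le (ℚP.*-monoʳ-≤-nonNeg (toℚ n) {{nonneg n}}
    (subst (_≤ c ℚ.+ ε) (ℚP.+-identityʳ c) (ℚP.+-monoʳ-≤ c (ℚP.<⇒≤ ε>0))))
    where
    nonneg : ∀ n → ℚ.NonNegative (toℚ n)
    nonneg n = ℚP.normalize-nonNeg n 1

  module _ {L M N D} (v : Valid (In L M N) D) where

    private
      Q V : ℤ
      Q = Qx L M N D
      V = pos L ℤ.* pos M ℤ.* pos N

      drop : ∀ a b c → ℤ.0ℤ ℤ.≤ c → a ℤ.+ b ℤ.+ c ≡ V → a ℤ.+ b ℤ.≤ V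
      drop a b c c≥0 e = subst₂ ℤ._≤_ (ℤP.+-identityʳ (a ℤ.+ b)) e (ℤP.+-monoʳ-≤ (a ℤ.+ b) c≥0)

      le-X : pos 4 ℤ.* Q ℤ.≤ pos L ℤ.* V
      le-X = ℤP.≤-trans (bound-X v) (ℤP.*-monoˡ-≤-nonNeg (pos L)
        (drop (count v cY) (count v cZ) (count v cX) (count≥0 v cX) (trans (h (count v cX) (count v cY) (count v cZ)) (count-X+Y+Z v))))
        where
        h : ∀ a b c → b ℤ.+ c ℤ.+ a ≡ a ℤ.+ b ℤ.+ c
        h = solve-∀
      le-Y : pos 4 ℤ.* Q ℤ.≤ pos M ℤ.* V
      le-Y = ℤP.≤-trans (bound-Y v) (ℤP.*-monoˡ-≤-nonNeg (pos M)
        (drop (count v cZ) (count v cX) (count v cY) (count≥0 v cY) (trans (h (count v cX) (count v cY) (count v cZ)) (count-X+Y+Z v))))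
        where
        h : ∀ a b c → c ℤ.+ a ℤ.+ b ≡ a ℤ.+ b ℤ.+ c
        h = solve-∀
      le-Z : pos 4 ℤ.* Q ℤ.≤ pos N ℤ.* V
      le-Z = ℤP.≤-trans (bound-Z v) (ℤP.*-monoˡ-≤-nonNeg (pos N)
        (drop (count v cX) (count v cY) (count v cZ) (count≥0 v cZ) (count-X+Y+Z v)))

      volume : ∀ k → pos (L ℕ.* M ℕ.* N ℕ.* k) ≡ pos k ℤ.* V
      volume k = trans (ℤP.pos-* (L ℕ.* M ℕ.* N) k) (trans (ℤP.*-comm _ (pos k))
        (cong (pos k ℤ.*_) (trans (ℤP.pos-* (L ℕ.* M) N) (cong (ℤ._* pos N) (ℤP.pos-* L M)))))

    4Q≤ : pos 4 ℤ.* Q ℤ.≤ pos (LMNmin L M N)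
    4Q≤ = subst (pos 4 ℤ.* Q ℤ.≤_) (sym (volume (L ⊓ M ⊓ N)))
      (⊓-elim (λ k → pos 4 ℤ.* Q ℤ.≤ pos k ℤ.* V) (L ⊓ M) N (⊓-elim (λ k → pos 4 ℤ.* Q ℤ.≤ pos k ℤ.* V) L M le-X le-Y) le-Z)
      where
      ⊓-elim : ∀ (P : ℕ → Set) m n → P m → P n → P (m ⊓ n)
      ⊓-elim P m n p q with ℕP.⊓-sel m n
      ... | inj₁ e = subst P (sym e) p
      ... | inj₂ e = subst P (sym e) q

    upper : quarter Q ≤ (pos 1 ℚ./ 16) ℚ.* toℚ (LMNmin L M N)
    upper = quarter-≤ 15 (LMNmin L M N) {Q} (subst (ℤ._≤ pos 4 ℤ.* pos (LMNmin L M N)) (h Q) (ℤP.*-monoˡ-≤-nonNeg (pos 4) 4Q≤))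
      where
      h : ∀ q → pos 4 ℤ.* (pos 4 ℤ.* q) ≡ q ℤ.* pos 16
      h = solve-∀

  cube-upper : ∀ n {D} → Valid (In n n n) D → quarter (Qx n n n D) ≤ (pos 1 ℚ./ 24) ℚ.* toℚ (LMNmin n n n)
  -- The three directional bounds add up to 12 Q ≤ 2 n · n³; the factor 2 turns this into 24 Q ≤ 4
  -- `LMNmin`.
  cube-upper n {D} v = quarter-≤ 23 (LMNmin n n n) {Q} (subst₂ ℤ._≤_ (h₁ Q) vol
    (ℤP.*-monoˡ-≤-nonNeg (pos 2) (ℤP.+-mono-≤ (ℤP.+-mono-≤ (bound-X v) (bound-Y v)) (bound-Z v))))
    where
    Q : ℤ
    Q = Qx n n n D
    h₁ : ∀ q → pos 2 ℤ.* (pos 4 ℤ.* q ℤ.+ pos 4 ℤ.* q ℤ.+ pos 4 ℤ.* q) ≡ q ℤ.* pos 24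
    h₁ = solve-∀
    h₂ : ∀ n a b c → pos 2 ℤ.* (n ℤ.* (b ℤ.+ c) ℤ.+ n ℤ.* (c ℤ.+ a) ℤ.+ n ℤ.* (a ℤ.+ b)) ≡ pos 4 ℤ.* ((a ℤ.+ b ℤ.+ c) ℤ.* n)
    h₂ = solve-∀
    vol : pos 2 ℤ.* (pos n ℤ.* (count v cY ℤ.+ count v cZ) ℤ.+ pos n ℤ.* (count v cZ ℤ.+ count v cX) ℤ.+ pos n ℤ.* (count v cX ℤ.+ count v cY))
      ≡ pos 4 ℤ.* pos (LMNmin n n n)
    vol = trans (h₂ (pos n) (count v cX) (count v cY) (count v cZ)) (cong (pos 4 ℤ.*_)
      (trans (cong (ℤ._* pos n) (trans (count-X+Y+Z v) (sym (trans (ℤP.pos-* (n ℕ.* n) n) (cong (ℤ._* pos n) (ℤP.pos-* n n))))))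
        (trans (sym (ℤP.pos-* (n ℕ.* n ℕ.* n) n)) (cong (λ k → pos (n ℕ.* n ℕ.* n ℕ.* k))
          (sym (trans (cong (_⊓ n) (ℕP.⊓-idem n)) (ℕP.⊓-idem n)))))))

  -- Boxes of height 4 k that are long compared with their height in one direction, and long compared
  -- with their width in the other: there the ratio 1/16 is reached up to the factor (k / (k + 2))².
  module Long (k : ℕ) (k≥2 : 2 ℕ.≤ k) where

    open import Data.Nat using (_+_; _*_)

    X Y Z : ℕ
    X = k * k + k * k + 4 * k
    Y = k * (k * k) + 2 * (k * k)
    Z = 2 * k + 2 * k

    twist : ℕ
    twist = k * (k * k) * (2 * k * (k * (k * k)))

    achieved : LB X Y Z twist
    -- Here r = k, p = k², q = 2 k and m = k³. Each of r, p, m is negligible against the next, so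
    -- that walls and ends cost little, and q = 2 r maximises q · 2 r for the given height.
    achieved = LB-linked k (k * k) (2 * k) (k * (k * k)) (ℕP.≤-trans (s≤s z≤n) k≥2)

    min≡ : X ⊓ Y ⊓ Z ≡ Z
    min≡ = ℕP.m≥n⇒m⊓n≡n (ℕP.⊓-glb
      (ℕP.≤-trans (ℕP.≤-reflexive (h k)) (ℕP.m≤n+m (4 * k) (k * k + k * k)))
      (ℕP.≤-trans (ℕP.≤-reflexive (h′ k)) (ℕP.≤-trans (ℕP.*-monoʳ-≤ (2 * k) k≥2) (ℕP.≤-trans (ℕP.≤-reflexive (h″ k)) (ℕP.m≤n+m (2 * (k * k)) (k * (k * k)))))))
      where
      h : ∀ k → 2 * k + 2 * k ≡ 4 * k
      h = solve-ℕ
      h′ : ∀ k → 2 * k + 2 * k ≡ 2 * k * 2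
      h′ = solve-ℕ
      h″ : ∀ k → 2 * k * k ≡ 2 * (k * k)
      h″ = solve-ℕ

    B : ℕ
    B = LMNmin X Y Z

    -- The ratio (k / (k + 2))² misses 1 by (4 k + 4) / (k + 2)² ≤ 4 / k, so by at most 16 / d when
    -- d ≤ k. In the application `d` is the denominator of ε.
    near : ∀ d → d ℕ.≤ k → d * B ℕ.≤ 16 * d * twist + 16 * B
    near d d≤k rewrite min≡ = ℕP.≤-trans (ℕP.≤-reflexive (h d k))
      (ℕP.≤-trans (ℕP.+-monoʳ-≤ (16 * d * twist) (ℕP.*-monoʳ-≤ (128 * (k * k * k * k * k)) (ℕP.*-monoˡ-≤ (k + 1) d≤k)))
        (ℕP.≤-trans (ℕP.m≤m+n _ (k * k * k * k * k * (384 * k * k + 1920 * k + 2048))) (ℕP.≤-reflexive (h′ d k))))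
      where
      h : ∀ d k → d * ((k * k + k * k + 4 * k) * (k * (k * k) + 2 * (k * k)) * (2 * k + 2 * k) * (2 * k + 2 * k))
        ≡ 16 * d * (k * (k * k) * (2 * k * (k * (k * k)))) + 128 * (k * k * k * k * k) * (d * (k + 1))
      h = solve-ℕ
      h′ : ∀ d k → 16 * d * (k * (k * k) * (2 * k * (k * (k * k)))) + 128 * (k * k * k * k * k) * (k * (k + 1))
        + k * k * k * k * k * (384 * k * k + 1920 * k + 2048)
        ≡ 16 * d * (k * (k * k) * (2 * k * (k * (k * k)))) + 16 * ((k * k + k * k + 4 * k) * (k * (k * k) + 2 * (k * k)) * (2 * k + 2 * k) * (2 * k + 2 * k))
      h′ = solve-ℕ

    -- A positive ε with denominator d is at least 1 / d = 16 / (16 d), and this is the loss that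
    -- `near` allows.
    subtract-ε : ∀ ε {Q} → 0ℚ ℚ.< ε → ℚ.↧ₙ ε ℕ.≤ k → pos (4 * twist) ℤ.≤ Q → ((pos 1 ℚ./ 16) ℚ.- ε) ℚ.* toℚ B ≤ quarter Q
    subtract-ε ε@(mkℚ (pos (suc n)) d-1 _) {Q} _ d≤k le = ℚP.toℚᵘ-cancel-≤ (ℚᵘP.≤-respʳ-≃ (ℚᵘP.≃-sym (quarter-≃ Q))
      (ℚᵘP.≤-respˡ-≃ (ℚᵘP.≃-sym (ℚᵘP.≃-trans (product-≃ ((pos 1 ℚ./ 16) ℚ.- ε) B) (ℚᵘP.*-congʳ diff)))
        (*≤* cross)))
      where
      diff : ℚ.toℚᵘ ((pos 1 ℚ./ 16) ℚ.- ε) ≃ mkℚᵘ (pos 1) 15 ℚᵘ.+ ℚᵘ.- mkℚᵘ (pos (suc n)) d-1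
      diff = ℚᵘP.≃-trans (ℚP.toℚᵘ-homo-+ (pos 1 ℚ./ 16) (ℚ.- ε)) (ℚᵘP.+-cong (ℚP.toℚᵘ-fromℚᵘ (mkℚᵘ (pos 1) 15)) (ℚP.toℚᵘ-homo‿- ε))
      cross : ((pos 1 ℤ.* pos (suc d-1) ℤ.+ (ℤ.- pos (suc n)) ℤ.* pos 16) ℤ.* pos B) ℤ.* pos 4 ℤ.≤ Q ℤ.* pos (16 * suc d-1 * 1)
      cross = ℤP.≤-trans (ℤP.≤-trans (ℤP.≤-reflexive (h₁ (pos d) (pos n) (pos B)))
          (subst (pos 4 ℤ.* (pos d ℤ.* pos B ℤ.- pos 16 ℤ.* pos B) ℤ.- pos 64 ℤ.* (pos n ℤ.* pos B) ℤ.≤_) (ℤP.+-identityʳ _)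
            (ℤP.+-monoʳ-≤ (pos 4 ℤ.* (pos d ℤ.* pos B ℤ.- pos 16 ℤ.* pos B))
              (ℤP.neg-mono-≤ (subst (ℤ.0ℤ ℤ.≤_) (trans (ℤP.pos-* 64 (n * B)) (cong (pos 64 ℤ.*_) (ℤP.pos-* n B))) (+≤+ z≤n))))))
        (ℤP.≤-trans (ℤP.*-monoˡ-≤-nonNeg (pos 4) slack)
          (ℤP.≤-trans (ℤP.≤-reflexive (trans (h₂ (pos d) (pos twist)) (cong (ℤ._* (pos 16 ℤ.* pos d)) (sym (ℤP.pos-* 4 twist)))))
            (subst (pos (4 * twist) ℤ.* (pos 16 ℤ.* pos d) ℤ.≤_) (cong (Q ℤ.*_) (trans (sym (ℤP.pos-* 16 d)) (cong pos (sym (ℕP.*-identityʳ (16 * d))))))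
              (subst (λ t → pos (4 * twist) ℤ.* t ℤ.≤ Q ℤ.* t) (ℤP.pos-* 16 d) (ℤP.*-monoʳ-≤-nonNeg (pos (16 * d)) le)))))
        where
        d : ℕ
        d = suc d-1
        h₁ : ∀ d n b → ((pos 1 ℤ.* d ℤ.+ (ℤ.- (pos 1 ℤ.+ n)) ℤ.* pos 16) ℤ.* b) ℤ.* pos 4 ≡ pos 4 ℤ.* (d ℤ.* b ℤ.- pos 16 ℤ.* b) ℤ.- pos 64 ℤ.* (n ℤ.* b)
        h₁ = solve-∀
        h₂ : ∀ d t → pos 4 ℤ.* (pos 16 ℤ.* d ℤ.* t) ≡ pos 4 ℤ.* t ℤ.* (pos 16 ℤ.* d)
        h₂ = solve-∀
        h₃ : ∀ a b → a ℤ.+ b ℤ.- b ≡ a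
        h₃ = solve-∀
        slack : pos d ℤ.* pos B ℤ.- pos 16 ℤ.* pos B ℤ.≤ pos 16 ℤ.* pos d ℤ.* pos twist
        slack = ℤP.≤-trans (ℤP.+-monoˡ-≤ (ℤ.- (pos 16 ℤ.* pos B)) (subst₂ ℤ._≤_ (ℤP.pos-* d B)
          (trans (ℤP.pos-+ (16 * d * twist) (16 * B)) (cong₂ ℤ._+_ (trans (ℤP.pos-* (16 * d) twist) (cong (ℤ._* pos twist) (ℤP.pos-* 16 d))) (ℤP.pos-* 16 B)))
          (+≤+ (near d d≤k))))
          (ℤP.≤-reflexive (h₃ (pos 16 ℤ.* pos d ℤ.* pos twist) (pos 16 ℤ.* pos B)))
    subtract-ε (mkℚ (pos zero) _ _) (*<* (ℤ.+<+ ()))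
    subtract-ε (mkℚ ℤ.-[1+ _ ] _ _) (*<* ())

  optimum : ∀ {L M N k} → LB L M N k → Σ ℚ λ m → IsMaxTw L M N m
    × (∃ λ Q → m ≡ quarter Q × pos (4 ℕ.* k) ℤ.≤ Q) × m ≤ (pos 1 ℚ./ 16) ℚ.* toℚ (LMNmin L M N)
  optimum {L} {M} {N} {k} (lb D₀ v₀ le) = from (maximum L M N (D₀ , v₀))
    where
    from : (∃ λ D → Valid (In L M N) D × (∀ D′ → Valid (In L M N) D′ → Qx L M N D′ ℤ.≤ Qx L M N D) × IsMaxTw L M N (quarter (Qx L M N D))) →
      Σ ℚ λ m → IsMaxTw L M N m × (∃ λ Q → m ≡ quarter Q × pos (4 ℕ.* k) ℤ.≤ Q) × m ≤ (pos 1 ℚ./ 16) ℚ.* toℚ (LMNmin L M N)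
    from (D , v , b , is-max) = quarter (Qx L M N D) , is-max , (Qx L M N D , refl , ℤP.≤-trans le (b D₀ v₀)) , upper v

  bounds : ∀ L M N → 2 ℕ.≤ L → 2 ℕ.≤ M → 2 ℕ.≤ N → TwoBig L M N → OneEven L M N →
    Σ ℚ λ m → IsMaxTw L M N m
      × (((pos 1) ℚ./ 162) ℚ.* toℚ (LMNmin L M N) ≤ m)
      × (m ≤ ((pos 1) ℚ./ 16) ℚ.* toℚ (LMNmin L M N))
  bounds L M N L≥2 M≥2 N≥2 big o = from (lower-bound L M N L≥2 M≥2 N≥2 big o)
    where
    above : ∀ {k Q} n → n ℕ.≤ 162 ℕ.* k → pos (4 ℕ.* k) ℤ.≤ Q → pos 4 ℤ.* pos n ℤ.≤ Q ℤ.* pos 162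
    above {k} {Q} n le 4k≤Q = ℤP.≤-trans (ℤP.*-monoˡ-≤-nonNeg (pos 4) (+≤+ le))
      (ℤP.≤-trans (ℤP.≤-reflexive (trans (cong (pos 4 ℤ.*_) (ℤP.pos-* 162 k)) (trans (h (pos k)) (cong (ℤ._* pos 162) (sym (ℤP.pos-* 4 k))))))
        (ℤP.*-monoʳ-≤-nonNeg (pos 162) 4k≤Q))
      where
      h : ∀ k → pos 4 ℤ.* (pos 162 ℤ.* k) ≡ pos 4 ℤ.* k ℤ.* pos 162
      h = solve-∀
    from : (∃ λ k → LB L M N k × LMNmin L M N ℕ.≤ 162 ℕ.* k) → Σ ℚ λ m → IsMaxTw L M N m
      × (((pos 1) ℚ./ 162) ℚ.* toℚ (LMNmin L M N) ≤ m) × (m ≤ ((pos 1) ℚ./ 16) ℚ.* toℚ (LMNmin L M N))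
    from (k , a , le) = reached (optimum a)
      where
      reached : (Σ ℚ λ m → IsMaxTw L M N m × (∃ λ Q → m ≡ quarter Q × pos (4 ℕ.* k) ℤ.≤ Q) × m ≤ (pos 1 ℚ./ 16) ℚ.* toℚ (LMNmin L M N)) →
        Σ ℚ λ m → IsMaxTw L M N m
          × (((pos 1) ℚ./ 162) ℚ.* toℚ (LMNmin L M N) ≤ m) × (m ≤ ((pos 1) ℚ./ 16) ℚ.* toℚ (LMNmin L M N))
      reached (m , is-max , (Q , e , 4k≤Q) , up) = m , is-max
        , subst (((pos 1) ℚ./ 162) ℚ.* toℚ (LMNmin L M N) ≤_) (sym e) (≤-quarter 161 (LMNmin L M N) {Q} (above {k} {Q} (LMNmin L M N) le 4k≤Q)) , up

  limsup-≤ : ∀ ε → 0ℚ ℚ.< ε → Σ ℕ λ K → ∀ L M N → Admissible L M N → K ℕ.≤ L ⊓ M ⊓ N →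
    ∀ m → IsMaxTw L M N m → m ≤ ((pos 1 ℚ./ 16) ℚ.+ ε) ℚ.* toℚ (LMNmin L M N)
  -- The bound 1/16 holds for boxes of every size, hence the threshold 0.
  limsup-≤ ε ε>0 = 0 , λ L M N _ _ m is-max → add-ε (pos 1 ℚ./ 16) (LMNmin L M N) ε>0 (bound L M N m (attained is-max))
    where
    bound : ∀ L M N m → (∃ λ D → Valid (In L M N) D × m ≡ quarter (Qx L M N D)) → m ≤ (pos 1 ℚ./ 16) ℚ.* toℚ (LMNmin L M N)
    bound L M N _ (D , v , refl) = upper v

  long-box : ∀ ε → 0ℚ ℚ.< ε → ∀ K k → 2 ℕ.≤ k → K ℕ.≤ k → ℚ.↧ₙ ε ℕ.≤ k → Σ ℕ λ L → Σ ℕ λ M → Σ ℕ λ N →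
    Admissible L M N × K ℕ.≤ L ⊓ M ⊓ N ×
    (Σ ℚ λ m → IsMaxTw L M N m × (((pos 1 ℚ./ 16) ℚ.- ε) ℚ.* toℚ (LMNmin L M N) ≤ m))
  long-box ε ε>0 K k k≥2 K≤k ε≤k = X , Y , Z , (positive , inj₁ even-X) , ℕP.≤-trans K≤k k≤min , result (optimum achieved)
    where
    open Long k k≥2
    k≤min : k ℕ.≤ X ⊓ Y ⊓ Z
    k≤min = subst (k ℕ.≤_) (sym min≡) (ℕP.≤-trans (ℕP.m≤m+n k (k ℕ.+ 0)) (ℕP.m≤m+n (2 ℕ.* k) (2 ℕ.* k)))
    1≤min : 1 ℕ.≤ X ⊓ Y ⊓ Z
    1≤min = ℕP.≤-trans (ℕP.≤-trans (s≤s z≤n) k≥2) k≤min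
    positive : 1 ℕ.≤ X × 1 ℕ.≤ Y × 1 ℕ.≤ Z
    positive = ℕP.≤-trans 1≤min (ℕP.≤-trans (ℕP.m⊓n≤m (X ⊓ Y) Z) (ℕP.m⊓n≤m X Y))
      , ℕP.≤-trans 1≤min (ℕP.≤-trans (ℕP.m⊓n≤m (X ⊓ Y) Z) (ℕP.m⊓n≤n X Y))
      , ℕP.≤-trans 1≤min (ℕP.m⊓n≤n (X ⊓ Y) Z)
    even-X : 2 ∣ X
    even-X = ∣m∣n⇒∣m+n (two {k ℕ.* k}) (divides (2 ℕ.* k) (h k))
      where
      h : ∀ k → 4 ℕ.* k ≡ 2 ℕ.* k ℕ.* 2
      h = solve-ℕ
    result : (Σ ℚ λ m → IsMaxTw X Y Z m × (∃ λ Q → m ≡ quarter Q × pos (4 ℕ.* twist) ℤ.≤ Q) × m ≤ (pos 1 ℚ./ 16) ℚ.* toℚ (LMNmin X Y Z)) →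
      Σ ℚ λ m → IsMaxTw X Y Z m × (((pos 1 ℚ./ 16) ℚ.- ε) ℚ.* toℚ (LMNmin X Y Z) ≤ m)
    result (m , is-max , (Q , e , le) , _) = m , is-max
      , subst (((pos 1 ℚ./ 16) ℚ.- ε) ℚ.* toℚ (LMNmin X Y Z) ≤_) (sym e) (subtract-ε ε {Q} ε>0 ε≤k le)

  limsup-≥ : ∀ ε → 0ℚ ℚ.< ε → ∀ K → Σ ℕ λ L → Σ ℕ λ M → Σ ℕ λ N →
    Admissible L M N × K ℕ.≤ L ⊓ M ⊓ N ×
    (Σ ℚ λ m → IsMaxTw L M N m × (((pos 1 ℚ./ 16) ℚ.- ε) ℚ.* toℚ (LMNmin L M N) ≤ m))
  limsup-≥ ε ε>0 K = long-box ε ε>0 K (2 ℕ.+ (K ℕ.+ ℚ.↧ₙ ε)) (ℕP.m≤m+n 2 _)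
    (ℕP.≤-trans (ℕP.m≤m+n K (ℚ.↧ₙ ε)) (ℕP.m≤n+m _ 2)) (ℕP.≤-trans (ℕP.m≤n+m (ℚ.↧ₙ ε) K) (ℕP.m≤n+m _ 2))

  even-cube : ∀ ε → 0ℚ ℚ.< ε → ∀ n → 2 ∣ n →
    Σ ℚ λ m → IsMaxTw n n n m × (m ≤ ((pos 1 ℚ./ 24) ℚ.+ ε) ℚ.* toℚ (LMNmin n n n))
  even-cube ε ε>0 n e = from (maximum n n n (LB.tiling tiled , LB.valid tiled))
    where
    tiled : LB n n n 0
    tiled = fill (inj₁ e)
    from : (∃ λ D → Valid (In n n n) D × (∀ D′ → Valid (In n n n) D′ → Qx n n n D′ ℤ.≤ Qx n n n D) × IsMaxTw n n n (quarter (Qx n n n D))) →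
      Σ ℚ λ m → IsMaxTw n n n m × (m ≤ ((pos 1 ℚ./ 24) ℚ.+ ε) ℚ.* toℚ (LMNmin n n n))
    from (D , v , _ , is-max) = quarter (Qx n n n D) , is-max , add-ε (pos 1 ℚ./ 24) (LMNmin n n n) ε>0 (cube-upper n v)

  liminf-≤ : ∀ ε → 0ℚ ℚ.< ε → ∀ K → Σ ℕ λ L → Σ ℕ λ M → Σ ℕ λ N →
    Admissible L M N × K ℕ.≤ L ⊓ M ⊓ N ×
    (Σ ℚ λ m → IsMaxTw L M N m × (m ≤ ((pos 1 ℚ./ 24) ℚ.+ ε) ℚ.* toℚ (LMNmin L M N)))
  -- Cubes of side 2 (K + 1), which is even, positive and at least K.
  liminf-≤ ε ε>0 K = n , n , n , ((s≤s z≤n , s≤s z≤n , s≤s z≤n) , inj₁ (two {suc K}))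
    , ℕP.⊓-glb (ℕP.⊓-glb K≤n K≤n) K≤n , even-cube ε ε>0 n (two {suc K})
    where
    n : ℕ
    n = suc K ℕ.+ suc K
    K≤n : K ℕ.≤ n
    K≤n = ℕP.≤-trans (ℕP.n≤1+n K) (ℕP.m≤m+n (suc K) (suc K))

open import Data.Nat as ℕ using (ℕ; _⊓_)
open import Data.Integer using (+_)
open import Data.Rational as ℚ using (ℚ; 0ℚ)
open import Data.Product using (Σ; _×_; _,_)
theorem1p4 : (∀ L M N → 2 ℕ.≤ L → 2 ℕ.≤ M → 2 ℕ.≤ N → TwoBig L M N → OneEven L M N →
    Σ ℚ λ m → IsMaxTw L M N m
    × (((+ 1) ℚ./ 162) ℚ.* toℚ (LMNmin L M N) ℚ.≤ m)
    × (m ℚ.≤ ((+ 1) ℚ./ 16) ℚ.* toℚ (LMNmin L M N)))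
    × ((∀ ε → 0ℚ ℚ.< ε → Σ ℕ λ K → ∀ L M N → Admissible L M N → K ℕ.≤ L ⊓ M ⊓ N →
    ∀ m → IsMaxTw L M N m →
    m ℚ.≤ (((+ 1) ℚ./ 16) ℚ.+ ε) ℚ.* toℚ (LMNmin L M N))
    × (∀ ε → 0ℚ ℚ.< ε → ∀ K → Σ ℕ λ L → Σ ℕ λ M → Σ ℕ λ N →
    Admissible L M N × K ℕ.≤ L ⊓ M ⊓ N ×
    (Σ ℚ λ m → IsMaxTw L M N m
    × ((((+ 1) ℚ./ 16) ℚ.- ε) ℚ.* toℚ (LMNmin L M N) ℚ.≤ m))))
    × (∀ ε → 0ℚ ℚ.< ε → ∀ K → Σ ℕ λ L → Σ ℕ λ M → Σ ℕ λ N →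
    Admissible L M N × K ℕ.≤ L ⊓ M ⊓ N ×
    (Σ ℚ λ m → IsMaxTw L M N m
    × (m ℚ.≤ (((+ 1) ℚ./ 24) ℚ.+ ε) ℚ.* toℚ (LMNmin L M N))))
theorem1p4 = Limits.bounds , (Limits.limsup-≤ , Limits.limsup-≥) , Limits.liminf-≤
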